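{- If $G$ is a nice graph, then $G$ is $(1, \partial_2(G) + 1)$-weight choosable.
   Context: All graphs are finite, simple and loopless. A graph is nice if it has no connected component isomorphic to $K_2$. A graph $G$ is $(k,l)$-weight choosable if for every assignment of a list $L_v$ of $k$ real numbers to each vertex $v$ and a list $L_e$ of $l$ real numbers to each edge $e$, there is a choice of weights $w(v)\in L_v$ and $w(e)\in L_e$ (for all $v \in V(G)$, $e\in E(G)$) such that the function $v\mapsto w(v)+\sum_{e\ni v} w(e)$ is a proper colouring of $V(G)$ (adjacent vertices get different values). For a graph $H$ having two vertices at distance exactly $2$ in $H$, let $\delta_2(H)$ be the minimum of $d_H(u)+d_H(v)$ over all pairs $u,v\in V(H)$ at distance exactly $2$ in $H$. Then $\partial_2(G) = \max \delta_2(H)$, the maximum taken over all induced subgraphs $H$ of $G$ that have two vertices at distance exactly $2$. If no induced subgraph of $G$ has two vertices at distance exactly $2$, then by convention $\partial_2(G) = 2\Delta(G)$, where $\Delta(G)$ is the maximum degree of $G$. -}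

module Defs where

open import Data.Bool.Base using (Bool; true; false; not; T)
open import Data.Bool.Properties using (T?)
open import Data.Fin.Base as Fin using (Fin)
import Data.Fin.Properties as Fin
open import Data.Fin.Subset using (Subset; Nonempty; inside; outside; ∣_∣) renaming (_∈_ to _∈ˢ_)
open import Data.Fin.Subset.Properties using (_∈?_)
open import Data.List.Base as List
  using (List; []; _∷_; _++_; allFin; cartesianProduct; filter; foldr; length; mapMaybe)
open import Data.Maybe.Base using (Maybe; just; nothing; fromMaybe)
open import Data.Nat.Base as ℕ using (ℕ; zero; suc)
import Data.Nat.Properties as ℕ
open import Data.List.Extrema ℕ.≤-totalOrder using (min; max)
open import Data.Product.Base using (∃-syntax; Σ-syntax; _×_; _,_)
open import Data.Rational as ℚ using (ℚ; 0ℚ; ½)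
import Data.Rational.Properties as ℚ
open import Data.Rational.Solver using (module +-*-Solver)
open import Data.Sum.Base using (_⊎_)
open import Data.Vec.Base as Vec using (Vec; tabulate)
open import Data.Vec.Membership.Propositional using (_∈_)
open import Data.Vec.Relation.Unary.AllPairs using (AllPairs)
open import Function.Bundles using (_↔_; _⇔_; Inverse)
open import Relation.Nullary using (¬_; Dec; yes; no)
open import Relation.Nullary.Decidable using (⌊_⌋; _×-dec_; _⊎-dec_; ¬?)
open import Relation.Binary.PropositionalEquality
  using (_≡_; refl; sym; cong; subst; module ≡-Reasoning)
open import Data.Empty using (⊥-elim)

------------------------------------------------------------------------
-- Real numbers, as Cauchy sequences of rationals

record ℝ : Set where
  field
    seq    : ℕ → ℚ
    cauchy : ∀ ε → 0ℚ ℚ.< ε →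
             ∃[ N ] (∀ m n → N ℕ.≤ m → N ℕ.≤ n → ℚ.∣ seq m ℚ.- seq n ∣ ℚ.< ε)

open ℝ public

-- x # y says that the limits of x and y are different.  It is the usual
-- constructive inequality of reals: ¬ (x # y) holds exactly when x and y are
-- equal as reals, so classically x # y is the negation of that equality.
infix 4 _#_
_#_ : ℝ → ℝ → Set
x # y = ∃[ ε ] (0ℚ ℚ.< ε × ∃[ N ] (∀ n → N ℕ.≤ n → ε ℚ.≤ ℚ.∣ seq x n ℚ.- seq y n ∣))

0ʳ : ℝ
0ʳ = record { seq = λ _ → 0ℚ ; cauchy = λ ε 0<ε → 0 , λ _ _ _ _ → 0<ε }

private
  interchange : ∀ a b c d →
                (a ℚ.+ b) ℚ.- (c ℚ.+ d) ≡ (a ℚ.- c) ℚ.+ (b ℚ.- d)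
  interchange = solve 4 (λ a b c d →
    (a :+ b) :- (c :+ d) := (a :- c) :+ (b :- d)) refl
    where open +-*-Solver

  0<½* : ∀ {ε} → 0ℚ ℚ.< ε → 0ℚ ℚ.< ½ ℚ.* ε
  0<½* {ε} 0<ε = subst (ℚ._< ½ ℚ.* ε) (ℚ.*-zeroʳ ½) (ℚ.*-monoʳ-<-pos ½ 0<ε)

  halves : ∀ ε → ½ ℚ.* ε ℚ.+ ½ ℚ.* ε ≡ ε
  halves ε = begin
    ½ ℚ.* ε ℚ.+ ½ ℚ.* ε  ≡⟨ sym (ℚ.*-distribʳ-+ ε ½ ½) ⟩
    (½ ℚ.+ ½) ℚ.* ε      ≡⟨ ℚ.*-identityˡ ε ⟩
    ε                    ∎
    where open ≡-Reasoning

infixl 6 _+ʳ_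
_+ʳ_ : ℝ → ℝ → ℝ
seq (x +ʳ y) n = seq x n ℚ.+ seq y n
cauchy (x +ʳ y) ε 0<ε
  with cauchy x (½ ℚ.* ε) (0<½* 0<ε) | cauchy y (½ ℚ.* ε) (0<½* 0<ε)
... | M , closeˣ | N , closeʸ = M ℕ.⊔ N , λ m n M⊔N≤m M⊔N≤n → begin-strict
    ℚ.∣ (seq x m ℚ.+ seq y m) ℚ.- (seq x n ℚ.+ seq y n) ∣
      ≡⟨ cong ℚ.∣_∣ (interchange (seq x m) (seq y m) (seq x n) (seq y n)) ⟩
    ℚ.∣ (seq x m ℚ.- seq x n) ℚ.+ (seq y m ℚ.- seq y n) ∣
      ≤⟨ ℚ.∣p+q∣≤∣p∣+∣q∣ (seq x m ℚ.- seq x n) (seq y m ℚ.- seq y n) ⟩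
    ℚ.∣ seq x m ℚ.- seq x n ∣ ℚ.+ ℚ.∣ seq y m ℚ.- seq y n ∣
      <⟨ ℚ.+-mono-<
           (closeˣ m n (ℕ.m⊔n≤o⇒m≤o M N M⊔N≤m) (ℕ.m⊔n≤o⇒m≤o M N M⊔N≤n))
           (closeʸ m n (ℕ.m⊔n≤o⇒n≤o M N M⊔N≤m) (ℕ.m⊔n≤o⇒n≤o M N M⊔N≤n)) ⟩
    ½ ℚ.* ε ℚ.+ ½ ℚ.* ε
      ≡⟨ halves ε ⟩
    ε ∎
    where open ℚ.≤-Reasoning

sumʳ : List ℝ → ℝ
sumʳ = foldr _+ʳ_ 0ʳ

------------------------------------------------------------------------
-- Graphs

record Graph (n : ℕ) : Set where
  field
    adj        : Fin n → Fin n → Bool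
    adj-sym    : ∀ u v → adj u v ≡ adj v u
    adj-irrefl : ∀ v → adj v v ≡ false

  Adj : Fin n → Fin n → Set
  Adj u v = T (adj u v)

  degree : Fin n → ℕ
  degree v = ∣ tabulate (adj v) ∣

  -- Each edge is stored once, with its smaller end first.  The proofs are
  -- irrelevant, so an edge is determined by its two ends.
  record Edge : Set where
    constructor edge
    field
      lo hi     : Fin n
      .lo<hi    : lo Fin.< hi
      .adjacent : Adj lo hi

  Incident : Fin n → Edge → Set
  Incident v e = v ≡ Edge.lo e ⊎ v ≡ Edge.hi e

  edge? : Fin n × Fin n → Maybe Edge
  edge? (u , v) with u Fin.<? v | T? (adj u v)
  ... | yes u<v | yes uv = just (edge u v u<v uv)
  ... | _       | _      = nothing

  edges : List Edge
  edges = mapMaybe edge? (cartesianProduct (allFin n) (allFin n))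

  incident? : ∀ v e → Dec (Incident v e)
  incident? v e = v Fin.≟ Edge.lo e ⊎-dec v Fin.≟ Edge.hi e

  edgesAt : Fin n → List Edge
  edgesAt v = filter (incident? v) edges

  Walk : ℕ → Fin n → Fin n → Set
  Walk zero    u v = u ≡ v
  Walk (suc k) u v = ∃[ w ] (Adj u w × Walk k w v)

  walk? : ∀ k u v → Dec (Walk k u v)
  walk? zero    u v = u Fin.≟ v
  walk? (suc k) u v = Fin.any? (λ w → T? (adj u w) ×-dec walk? k w v)

  Distance : ℕ → Fin n → Fin n → Set
  Distance k u v = Walk k u v × (∀ {j} → j ℕ.< k → ¬ Walk j u v)

  distance? : ∀ k u v → Dec (Distance k u v)
  distance? k u v = walk? k u v ×-dec ℕ.allUpTo? (λ j → ¬? (walk? j u v)) k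

open Graph public

Δ : ∀ {n} → Graph n → ℕ
Δ {n} G = max 0 (List.map (degree G) (allFin n))

------------------------------------------------------------------------
-- Induced subgraphs, isomorphism, components

-- The vertices in S are renumbered 0, 1, …, in increasing order.
elements : ∀ {n} → Subset n → List (Fin n)
elements {n} S = filter (_∈? S) (allFin n)

induced : ∀ {n} (G : Graph n) (S : Subset n) → Graph (length (elements S))
induced G S = record
  { adj        = λ i j → adj G (vertex i) (vertex j)
  ; adj-sym    = λ i j → adj-sym G (vertex i) (vertex j)
  ; adj-irrefl = λ i → adj-irrefl G (vertex i)
  }
  where vertex = List.lookup (elements S)

K : ∀ n → Graph n
K n = record
  { adj        = λ u v → not ⌊ u Fin.≟ v ⌋
  ; adj-sym    = λ u v → cong not (≟-sym u v)
  ; adj-irrefl = λ v → cong not (≟-refl v)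
  }
  where
  ≟-sym : (u v : Fin n) → ⌊ u Fin.≟ v ⌋ ≡ ⌊ v Fin.≟ u ⌋
  ≟-sym u v with u Fin.≟ v | v Fin.≟ u
  ... | yes _   | yes _   = refl
  ... | no _    | no _    = refl
  ... | yes u≡v | no v≢u  = ⊥-elim (v≢u (sym u≡v))
  ... | no u≢v  | yes v≡u = ⊥-elim (u≢v (sym v≡u))

  ≟-refl : (v : Fin n) → ⌊ v Fin.≟ v ⌋ ≡ true
  ≟-refl v with v Fin.≟ v
  ... | yes _  = refl
  ... | no v≢v = ⊥-elim (v≢v refl)

infix 4 _≅_
_≅_ : ∀ {m n} → Graph m → Graph n → Set
_≅_ {m} {n} G H = Σ[ f ∈ Fin m ↔ Fin n ]
  (∀ u v → adj G u v ≡ adj H (Inverse.to f u) (Inverse.to f v))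

IsComponent : ∀ {n} → Graph n → Subset n → Set
IsComponent G S =
  Nonempty S × (∀ u → u ∈ˢ S → ∀ v → v ∈ˢ S ⇔ (∃[ k ] Walk G k u v))

Nice : ∀ {n} → Graph n → Set
Nice G = ∀ S → IsComponent G S → ¬ (induced G S ≅ K 2)

------------------------------------------------------------------------
-- The parameter ∂₂

minimum : List ℕ → Maybe ℕ
minimum []       = nothing
minimum (x ∷ xs) = just (min x xs)

maximum : List ℕ → Maybe ℕ
maximum []       = nothing
maximum (x ∷ xs) = just (max x xs)

subsets : ∀ n → List (Subset n)
subsets zero    = Vec.[] ∷ []
subsets (suc n) =
  List.map (outside Vec.∷_) (subsets n) ++ List.map (inside Vec.∷_) (subsets n)

-- nothing when H has no two vertices at distance exactly 2
δ₂ : ∀ {n} → Graph n → Maybe ℕ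
δ₂ {n} H = minimum
  (List.map (λ (u , v) → degree H u ℕ.+ degree H v)
    (filter (λ (u , v) → distance? H 2 u v)
      (cartesianProduct (allFin n) (allFin n))))

∂₂ : ∀ {n} → Graph n → ℕ
∂₂ {n} G = fromMaybe (2 ℕ.* Δ G)
  (maximum (mapMaybe (λ S → δ₂ (induced G S)) (subsets n)))

------------------------------------------------------------------------
-- Weight choosability

weightedSum : ∀ {n} (G : Graph n) → (Fin n → ℝ) → (Edge G → ℝ) → Fin n → ℝ
weightedSum G wⱽ wᴱ v = wⱽ v +ʳ sumʳ (List.map wᴱ (edgesAt G v))

-- A list of k real numbers is a vector of k pairwise different reals.
WeightChoosable : ∀ {n} → Graph n → ℕ → ℕ → Set
WeightChoosable {n} G k l =
  (Lⱽ : Fin n → Vec ℝ k) (Lᴱ : Edge G → Vec ℝ l) →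
  (∀ v → AllPairs _#_ (Lⱽ v)) → (∀ e → AllPairs _#_ (Lᴱ e)) →
  ∃[ wⱽ ] ∃[ wᴱ ]
    ( (∀ v → wⱽ v ∈ Lⱽ v)
    × (∀ e → wᴱ e ∈ Lᴱ e)
    × (∀ u v → Adj G u v → weightedSum G wⱽ wᴱ u # weightedSum G wⱽ wᴱ v))

{-# OPTIONS --safe #-}
module Submission where

-- Order the ends of each edge and consider the matrix whose row r is the linear
-- form "sum at lo r minus sum at hi r" in the edge weights.  By the Combinatorial
-- Nullstellensatz it suffices to choose one column per row, every edge being chosen
-- at most ∂₂ G times, such that the permanent is nonzero; as the permanent is
-- multilinear, integer combinations of columns may be used instead, if each edge
-- occurs in at most ∂₂ G of them.  They are found by removing two vertices u, v
-- with a common neighbour w at a time: column wu minus column wv only sees the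
-- rows at u and v, where its entries are nonzero, so that the matrix becomes block
-- triangular.
--
-- If u and v are at distance 2 with least degree sum, the column wu - wv is used
-- once for each of the deg u + deg v rows.  If there are no such vertices, the
-- graph is a union of cliques; the 2k + 1 rows at two vertices with k common
-- neighbours w then get column uv twice and the columns wu - wv twice each, except
-- for one of them, which is used once.
--
-- An edge ab that becomes a component K₂ by the removal has an edge to u or v, whose
-- column serves the row ab.  It fails to be a new column only if ab is a pendant edge
-- at w, but then minimality of the degree sum makes the component a star K₁,₃.

-- The weight of an edge cancels in its own row, so an edge isolated by a removal has a zero row in
-- the rest; it must be served by an edge that leaves with the removed vertices.
--
-- The induction runs over all vertex subsets `S` because ∂₂ is a maximum over induced subgraphs:
-- the least degree sum in G[S] is at most ∂₂(G). Columns for the rest only involve edges inside the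
-- rest, so each removal may spend the full bound anew.
--
-- In a clique only the bound 2 is safe: the disjoint union of a path on three vertices and a clique
-- has ∂₂ = 2. The columns `wu - wv`, twice each, are one short of the number of rows; `uv` used
-- once as the missing column makes the permanent vanish, by the symmetry of `u` and `v`, while `uv`
-- used twice does not.
--
-- Vertex weights are constant terms of the rows and leave the top coefficient unchanged, so single
-- choices for them suffice. Equality of constructive reals is undecidable; hence the
-- Nullstellensatz is proved by iterated divided differences, and a good point is traced through
-- nonzero sums instead of searched for.

module Coefficients where

  open import Algebra.Bundles using (CommutativeRing)
  open import Data.Integer.Base as ℤ using (ℤ; 0ℤ; 1ℤ)
  open import Data.Product.Base using (∃-syntax)
  open import Data.Sum.Base using (_⊎_)
  open import Level using (Level; suc; _⊔_)
  open import Relation.Binary.PropositionalEquality using (_≢_)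

  -- What the proof needs of the real numbers: nonzero elements are invertible, and
  -- a nonzero sum has a nonzero summand.
  record CoefficientRing (c ℓ p : Level) : Set (suc (c ⊔ ℓ ⊔ p)) where
    field
      commutativeRing : CommutativeRing c ℓ

    open CommutativeRing commutativeRing hiding (zero) public

    field
      ι       : ℤ → Carrier
      ι-0     : ι 0ℤ ≈ 0#
      ι-1     : ι 1ℤ ≈ 1#
      ι-+     : ∀ a b → ι (a ℤ.+ b) ≈ ι a + ι b
      ι-*     : ∀ a b → ι (a ℤ.* b) ≈ ι a * ι b
      NZ      : Carrier → Set p
      NZ-resp : ∀ {a b} → a ≈ b → NZ a → NZ b
      NZ-+    : ∀ {a b} → NZ (a + b) → NZ a ⊎ NZ b
      NZ-*ˡ   : ∀ {a b} → NZ (a * b) → NZ a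
      NZ-ι    : ∀ {z} → z ≢ 0ℤ → NZ (ι z)
      invert  : ∀ {a} → NZ a → ∃[ b ] a * b ≈ 1#

-- Permanents and their expansions

module Permanent where

  open import Data.Integer.Base using (ℤ; +_; 0ℤ; 1ℤ; _+_; _*_; _-_; -_)
  import Data.Integer.Properties as ℤ
  open import Data.Integer.Tactic.RingSolver using (solve-∀)
  open import Data.List.Base using (List; []; _∷_; _++_; map; length; replicate)
  open import Data.List.Relation.Binary.Permutation.Propositional
    using (_↭_; ↭-refl; ↭-trans; ↭-prep; ↭-swap; refl; prep; swap; trans)
  open import Data.List.Relation.Binary.Pointwise.Base using (Pointwise; []; _∷_)
  open import Data.List.Relation.Unary.All using (All; []; _∷_)
  open import Data.List.Relation.Unary.AllPairs using ([]; _∷_)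
  open import Data.List.Relation.Unary.Any using (here; there)
  open import Data.List.Relation.Unary.Unique.Propositional using (Unique)
  open import Data.List.Membership.Propositional using (_∈_)
  import Data.List.Relation.Unary.All as All
  open import Data.Nat.Base as ℕ using (ℕ; zero; suc; _!)
  import Data.Nat.Properties as ℕ
  open import Data.Product.Base using (∃-syntax; _×_; _,_; proj₂)
  open import Data.Sum.Base using (inj₁; inj₂)
  open import Function.Base using (_∘_)
  open import Relation.Binary.PropositionalEquality
    using (_≡_; _≢_; cong; cong₂; sym; module ≡-Reasoning)
  import Relation.Binary.PropositionalEquality as ≡
  open import Relation.Nullary using (yes; no; contradiction)

  private variable
    A B E : Set

  sumOver prodOver : (A → ℤ) → List A → ℤ
  sumOver  f []       = 0ℤ
  sumOver  f (x ∷ xs) = f x + sumOver f xs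
  prodOver f []       = 1ℤ
  prodOver f (x ∷ xs) = f x * prodOver f xs

  pickSum : (A → List A → ℤ) → List A → ℤ
  pickSum g []       = 0ℤ
  pickSum g (x ∷ xs) = g x xs + pickSum (λ y ys → g y (x ∷ ys)) xs

  -- The proof of `y ∷ ys ↭ xs` handed to the hypothesis is how later inductions learn the length
  -- and the members of the remaining list.
  pickSum-cong : {g h : A → List A → ℤ} (xs : List A) →
                 (∀ y ys → y ∷ ys ↭ xs → g y ys ≡ h y ys) → pickSum g xs ≡ pickSum h xs
  pickSum-cong []       eq = ≡.refl
  pickSum-cong (x ∷ xs) eq = cong₂ _+_ (eq x xs ↭-refl)
    (pickSum-cong xs λ y ys p → eq y (x ∷ ys) (↭-trans (↭-swap y x ↭-refl) (↭-prep x p)))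

  pickSum-0 : (xs : List A) → pickSum (λ _ _ → 0ℤ) xs ≡ 0ℤ
  pickSum-0 []       = ≡.refl
  pickSum-0 (x ∷ xs) = ≡.trans (ℤ.+-identityˡ _) (pickSum-0 xs)

  pickSum-+ : (g h : A → List A → ℤ) (xs : List A) →
              pickSum (λ y ys → g y ys + h y ys) xs ≡ pickSum g xs + pickSum h xs
  pickSum-+ g h []       = ≡.refl
  pickSum-+ g h (x ∷ xs) = ≡.trans
    (cong (_+_ (g x xs + h x xs)) (pickSum-+ (λ y ys → g y (x ∷ ys)) (λ y ys → h y (x ∷ ys)) xs))
    (interchange (g x xs) (h x xs) (pickSum (λ y ys → g y (x ∷ ys)) xs) (pickSum (λ y ys → h y (x ∷ ys)) xs))
    where
    interchange : ∀ a b c d → (a + b) + (c + d) ≡ (a + c) + (b + d)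
    interchange = solve-∀

  pickSum-*ˡ : (c : ℤ) (g : A → List A → ℤ) (xs : List A) →
               pickSum (λ y ys → c * g y ys) xs ≡ c * pickSum g xs
  pickSum-*ˡ c g []       = sym (ℤ.*-zeroʳ c)
  pickSum-*ˡ c g (x ∷ xs) = ≡.trans
    (cong (_+_ (c * g x xs)) (pickSum-*ˡ c (λ y ys → g y (x ∷ ys)) xs))
    (sym (ℤ.*-distribˡ-+ c (g x xs) (pickSum (λ y ys → g y (x ∷ ys)) xs)))

  pickSum-*ʳ : (c : ℤ) (g : A → List A → ℤ) (xs : List A) →
               pickSum (λ y ys → g y ys * c) xs ≡ pickSum g xs * c
  pickSum-*ʳ c g xs = ≡.trans (pickSum-cong xs λ y ys _ → ℤ.*-comm (g y ys) c)
    (≡.trans (pickSum-*ˡ c g xs) (ℤ.*-comm c (pickSum g xs)))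

  pickSum-comm : (h : A → List A → B → List B → ℤ) (xs : List A) (ys : List B) →
                 pickSum (λ x xs′ → pickSum (λ y ys′ → h x xs′ y ys′) ys) xs ≡
                 pickSum (λ y ys′ → pickSum (λ x xs′ → h x xs′ y ys′) xs) ys
  pickSum-comm h []       ys = sym (pickSum-0 ys)
  pickSum-comm h (x ∷ xs) ys = ≡.trans
    (cong (_+_ (pickSum (h x xs) ys)) (pickSum-comm (λ x′ xs′ → h x′ (x ∷ xs′)) xs ys))
    (sym (pickSum-+ (h x xs) (λ y ys′ → pickSum (λ x′ xs′ → h x′ (x ∷ xs′) y ys′) xs) ys))

  pickSum-const : (f : A → ℤ) (xs : List A) → pickSum (λ y _ → f y) xs ≡ sumOver f xs
  pickSum-const f []       = ≡.refl
  pickSum-const f (x ∷ xs) = cong (_+_ (f x)) (pickSum-const f xs)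

  prodOver-↭ : (f : A → ℤ) {xs ys : List A} → xs ↭ ys → prodOver f xs ≡ prodOver f ys
  prodOver-↭ f refl         = ≡.refl
  prodOver-↭ f (prep x p)   = cong (f x *_) (prodOver-↭ f p)
  prodOver-↭ f (swap x y p) = ≡.trans (left-comm (f x) (f y) _)
    (cong (λ z → f y * (f x * z)) (prodOver-↭ f p))
    where
    left-comm : ∀ a b c → a * (b * c) ≡ b * (a * c)
    left-comm = solve-∀
  prodOver-↭ f (trans p q)  = ≡.trans (prodOver-↭ f p) (prodOver-↭ f q)

  sumOver-↭ : (f : A → ℤ) {xs ys : List A} → xs ↭ ys → sumOver f xs ≡ sumOver f ys
  sumOver-↭ f refl         = ≡.refl
  sumOver-↭ f (prep x p)   = cong (_+_ (f x)) (sumOver-↭ f p)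
  sumOver-↭ f (swap x y p) = ≡.trans (left-comm (f x) (f y) _)
    (cong (λ z → f y + (f x + z)) (sumOver-↭ f p))
    where
    left-comm : ∀ a b c → a + (b + c) ≡ b + (a + c)
    left-comm = solve-∀
  sumOver-↭ f (trans p q)  = ≡.trans (sumOver-↭ f p) (sumOver-↭ f q)

  prodOver-≢0 : (f : A → ℤ) (xs : List A) → (∀ {x} → x ∈ xs → f x ≢ 0ℤ) → prodOver f xs ≢ 0ℤ
  prodOver-≢0 f []       nz ()
  prodOver-≢0 f (x ∷ xs) nz eq with ℤ.i*j≡0⇒i≡0∨j≡0 (f x) eq
  ... | inj₁ fx≡0 = nz (here ≡.refl) fx≡0
  ... | inj₂ p≡0  = prodOver-≢0 f xs (nz ∘ there) p≡0

  -- Rows are labels and columns are functions of them; 0 when the matrix is not square.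
  per : List A → List (A → ℤ) → ℤ
  per rs       (c ∷ C) = pickSum (λ r rs′ → c r * per rs′ C) rs
  per []       []      = 1ℤ
  per (_ ∷ _)  []      = 0ℤ

  -- `per` expands along one column after the other; pulling out a row instead amounts to exchanging
  -- two sums over picks, by `pickSum-comm`.
  per-row : (r : A) (rs : List A) (C : List (A → ℤ)) →
            per (r ∷ rs) C ≡ pickSum (λ c C′ → c r * per rs C′) C
  per-row r rs []      = ≡.refl
  per-row r rs (c ∷ C) = cong (_+_ (c r * per rs C)) (begin
    pickSum (λ r′ rs′ → c r′ * per (r ∷ rs′) C) rs
      ≡⟨ pickSum-cong rs (λ r′ rs′ _ → cong (c r′ *_) (per-row r rs′ C)) ⟩
    pickSum (λ r′ rs′ → c r′ * pickSum (λ c′ C′ → c′ r * per rs′ C′) C) rs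
      ≡⟨ pickSum-cong rs (λ r′ rs′ _ → sym (pickSum-*ˡ (c r′) _ C)) ⟩
    pickSum (λ r′ rs′ → pickSum (λ c′ C′ → c r′ * (c′ r * per rs′ C′)) C) rs
      ≡⟨ pickSum-comm (λ r′ rs′ c′ C′ → c r′ * (c′ r * per rs′ C′)) rs C ⟩
    pickSum (λ c′ C′ → pickSum (λ r′ rs′ → c r′ * (c′ r * per rs′ C′)) rs) C
      ≡⟨ pickSum-cong C (λ c′ C′ _ → ≡.trans
           (pickSum-cong rs λ r′ rs′ _ → left-comm (c r′) (c′ r) _)
           (pickSum-*ˡ (c′ r) _ rs)) ⟩
    pickSum (λ c′ C′ → c′ r * pickSum (λ r′ rs′ → c r′ * per rs′ C′) rs) C
      ∎)
    where
    open ≡-Reasoning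
    left-comm : ∀ a b c → a * (b * c) ≡ b * (a * c)
    left-comm = solve-∀

  per-swap : (x y : A) (rs : List A) (C : List (A → ℤ)) →
             per (x ∷ y ∷ rs) C ≡ per (y ∷ x ∷ rs) C
  per-swap x y rs []      = ≡.refl
  per-swap x y rs (c ∷ C) = ≡.trans
    (left-comm (c x * per (y ∷ rs) C) (c y * per (x ∷ rs) C)
      (pickSum (λ r rs′ → c r * per (x ∷ y ∷ rs′) C) rs))
    (cong (λ z → c y * per (x ∷ rs) C + (c x * per (y ∷ rs) C + z))
      (pickSum-cong rs λ r rs′ _ → cong (c r *_) (per-swap x y rs′ C)))
    where
    left-comm : ∀ a b c → a + (b + c) ≡ b + (a + c)
    left-comm = solve-∀

  per-prep : (r : A) {rs rs′ : List A} → (∀ C → per rs C ≡ per rs′ C) →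
             (C : List (A → ℤ)) → per (r ∷ rs) C ≡ per (r ∷ rs′) C
  per-prep r {rs} {rs′} eq C = ≡.trans (per-row r rs C) (≡.trans
    (pickSum-cong C λ c C′ _ → cong (c r *_) (eq C′)) (sym (per-row r rs′ C)))

  per-↭ : {rs rs′ : List A} → rs ↭ rs′ → (C : List (A → ℤ)) → per rs C ≡ per rs′ C
  per-↭ refl                   C = ≡.refl
  per-↭ (prep r p)             C = per-prep r (per-↭ p) C
  per-↭ (swap {xs} {ys} x y p) C = ≡.trans (per-swap x y xs C)
    (per-prep y (per-prep x (per-↭ p)) C)
  per-↭ (trans p q)            C = ≡.trans (per-↭ p C) (per-↭ q C)

  per-cong : (rs : List A) {C C′ : List (A → ℤ)} →
             Pointwise (λ c c′ → ∀ r → c r ≡ c′ r) C C′ → per rs C ≡ per rs C′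
  per-cong []       []       = ≡.refl
  per-cong (_ ∷ _)  []       = ≡.refl
  per-cong []       (_ ∷ _)  = ≡.refl
  per-cong (r ∷ rs) (e ∷ es) = pickSum-cong (r ∷ rs) λ y ys _ →
    cong₂ _*_ (e y) (per-cong ys es)

  -- A column of `C₁` contributes only by picking a row of `rs₁`. There are as many of these columns
  -- as rows in `rs₁`, so they exhaust it and leave exactly `rs₂` to `C₂`, whatever the entries of
  -- `C₂` in `rs₁`.
  per-block : (rs₁ rs₂ : List A) (C₁ C₂ : List (A → ℤ)) → length C₁ ≡ length rs₁ →
              All (λ c → ∀ {r} → r ∈ rs₂ → c r ≡ 0ℤ) C₁ →
              per (rs₁ ++ rs₂) (C₁ ++ C₂) ≡ per rs₁ C₁ * per rs₂ C₂
  per-block []        rs₂ []       C₂ _   _          = sym (ℤ.*-identityˡ _)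
  per-block (r ∷ rs₁) rs₂ (c ∷ C₁) C₂ len (c₀ ∷ C₁₀) = begin
    pickSum (λ y ys → c y * per ys (C₁ ++ C₂)) (r ∷ rs₁ ++ rs₂)
      ≡⟨ restrict (λ y ys → c y * per ys (C₁ ++ C₂)) (r ∷ rs₁) rs₂
           (λ y ys y∈ → ≡.trans (cong (_* per ys (C₁ ++ C₂)) (c₀ y∈)) (ℤ.*-zeroˡ (per ys (C₁ ++ C₂)))) ⟩
    pickSum (λ y ys → c y * per (ys ++ rs₂) (C₁ ++ C₂)) (r ∷ rs₁)
      ≡⟨ pickSum-cong (r ∷ rs₁) (λ y ys p → ≡.trans
           (cong (c y *_) (per-block ys rs₂ C₁ C₂
             (ℕ.suc-injective (≡.trans len (sym (↭-length p)))) C₁₀))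
           (sym (ℤ.*-assoc (c y) (per ys C₁) (per rs₂ C₂)))) ⟩
    pickSum (λ y ys → c y * per ys C₁ * per rs₂ C₂) (r ∷ rs₁)
      ≡⟨ pickSum-*ʳ (per rs₂ C₂) (λ y ys → c y * per ys C₁) (r ∷ rs₁) ⟩
    pickSum (λ y ys → c y * per ys C₁) (r ∷ rs₁) * per rs₂ C₂
      ∎
    where
    open ≡-Reasoning
    open import Data.List.Relation.Binary.Permutation.Propositional.Properties using (↭-length)
    vanish : ∀ (g : _ → List _ → ℤ) ys → (∀ y ys′ → y ∈ ys → g y ys′ ≡ 0ℤ) → pickSum g ys ≡ 0ℤ
    vanish g []       g₀ = ≡.refl
    vanish g (y ∷ ys) g₀ = cong₂ _+_ (g₀ y ys (here ≡.refl))
      (vanish (λ z zs → g z (y ∷ zs)) ys (λ z zs z∈ → g₀ z (y ∷ zs) (there z∈)))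
    restrict : ∀ (g : _ → List _ → ℤ) xs ys → (∀ y ys′ → y ∈ ys → g y ys′ ≡ 0ℤ) →
               pickSum g (xs ++ ys) ≡ pickSum (λ x xs′ → g x (xs′ ++ ys)) xs
    restrict g []       ys g₀ = vanish g ys g₀
    restrict g (x ∷ xs) ys g₀ = cong (_+_ (g x (xs ++ ys))) 
      (restrict (λ y ys′ → g y (x ∷ ys′)) xs ys (λ y ys′ → g₀ y (x ∷ ys′)))

  -- Each row splits off together with its own column as a block of size one.
  per-diagonal : (c : A → A → ℤ) (rs : List A) → Unique rs →
                 (∀ {r r′} → r ∈ rs → r′ ∈ rs → r ≢ r′ → c r r′ ≡ 0ℤ) →
                 (∀ {r} → r ∈ rs → c r r ≢ 0ℤ) → per rs (map c rs) ≢ 0ℤ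
  per-diagonal c []       _          _   _  ()
  per-diagonal c (r ∷ rs) (r∉ ∷ uniq) off on eq
    with ℤ.i*j≡0⇒i≡0∨j≡0 (per (r ∷ []) (c r ∷ []))
           (≡.trans (sym (per-block (r ∷ []) rs (c r ∷ []) (map c rs) ≡.refl
             ((λ r′∈ → off (here ≡.refl) (there r′∈) (All.lookup r∉ r′∈)) ∷ []))) eq)
  ... | inj₁ eq₁ = on (here ≡.refl) (≡.trans (sym (simplify (c r r))) eq₁)
    where
    simplify : ∀ a → a * 1ℤ + 0ℤ ≡ a
    simplify = solve-∀
  ... | inj₂ eq₂ = per-diagonal c rs uniq
    (λ r∈ r′∈ → off (there r∈) (there r′∈)) (on ∘ there) eq₂

  -- `α r * prodOver α rs′` is the full product for every pick `r`, so it leaves the sum and only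
  -- the sum of `γ` remains. The factor `+ (k !) * prodOver α rs′` is the minor formed by `k` copies
  -- of `α`.
  sum-of-cofactors : (k : ℕ) (α γ : A → ℤ) (rs : List A) →
                     pickSum (λ r rs′ → γ r * α r * (+ (k !) * prodOver α rs′)) rs ≡
                     + (k !) * prodOver α rs * sumOver γ rs
  sum-of-cofactors k α γ rs = begin
    pickSum (λ r rs′ → γ r * α r * (+ (k !) * prodOver α rs′)) rs
      ≡⟨ pickSum-cong rs (λ r rs′ p → ≡.trans (regroup (γ r) (α r) (+ (k !)) _)
           (cong (λ z → + (k !) * z * γ r) (prodOver-↭ α p))) ⟩
    pickSum (λ r rs′ → + (k !) * prodOver α rs * γ r) rs
      ≡⟨ pickSum-*ˡ (+ (k !) * prodOver α rs) (λ r _ → γ r) rs ⟩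
    + (k !) * prodOver α rs * pickSum (λ r _ → γ r) rs
      ≡⟨ cong (_*_ (+ (k !) * prodOver α rs)) (pickSum-const γ rs) ⟩
    + (k !) * prodOver α rs * sumOver γ rs
      ∎
    where
    open ≡-Reasoning
    regroup : ∀ g a k p → g * a * (k * p) ≡ k * (a * p) * g
    regroup = solve-∀

  per-replicate : (k : ℕ) (α : A → ℤ) (rs : List A) → length rs ≡ k →
                  per rs (replicate k α) ≡ + (k !) * prodOver α rs
  per-replicate zero    α []           _   = ≡.refl
  per-replicate (suc k) α rs@(_ ∷ _) len = begin
    pickSum (λ r rs′ → α r * per rs′ (replicate k α)) rs
      ≡⟨ pickSum-cong rs (λ r rs′ p → cong₂ _*_ (sym (ℤ.*-identityˡ (α r)))
           (per-replicate k α rs′ (ℕ.suc-injective (≡.trans (↭-length p) len)))) ⟩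
    pickSum (λ r rs′ → 1ℤ * α r * (+ (k !) * prodOver α rs′)) rs
      ≡⟨ sum-of-cofactors k α (λ _ → 1ℤ) rs ⟩
    + (k !) * prodOver α rs * sumOver (λ _ → 1ℤ) rs
      ≡⟨ cong (_*_ (+ (k !) * prodOver α rs)) (≡.trans (count-ones rs) (cong +_ len)) ⟩
    + (k !) * prodOver α rs * + suc k
      ≡⟨ regroup (+ (k !)) (prodOver α rs) (+ suc k) ⟩
    + suc k * + (k !) * prodOver α rs
      ≡⟨ cong (_* prodOver α rs) (sym (ℤ.pos-* (suc k) (k !))) ⟩
    + (suc k !) * prodOver α rs
      ∎
    where
    open ≡-Reasoning
    open import Data.List.Relation.Binary.Permutation.Propositional.Properties using (↭-length)
    count-ones : ∀ (xs : List _) → sumOver (λ _ → 1ℤ) xs ≡ + length xs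
    count-ones []       = ≡.refl
    count-ones (x ∷ xs) = cong (_+_ 1ℤ) (count-ones xs)
    regroup : ∀ a b c → a * b * c ≡ c * a * b
    regroup = solve-∀

  -- Factoring `α r` out of each row leaves two columns `γ` and `k` columns of ones. The two columns
  -- `γ` pick distinct rows, and the sum of `γ r * γ s` over ordered pairs of distinct rows is the
  -- square of the sum minus the sum of the squares.
  per-twisted : (k : ℕ) (α β γ : A → ℤ) (rs : List A) → length rs ≡ suc (suc k) →
                (∀ {r} → r ∈ rs → β r ≡ γ r * α r) →
                per rs (β ∷ β ∷ replicate k α) ≡
                + (k !) * prodOver α rs *
                (sumOver γ rs * sumOver γ rs - sumOver (λ r → γ r * γ r) rs)
  per-twisted k α β γ rs@(_ ∷ _ ∷ _) len β≡γα = begin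
    pickSum (λ r rs′ → β r * per rs′ (β ∷ replicate k α)) rs
      ≡⟨ pickSum-cong rs (λ r rs′ p → cong₂ _*_ (β≡γα (∈-resp-↭ p (here ≡.refl)))
           (once rs′ (ℕ.suc-injective (≡.trans (↭-length p) len)) (λ r∈ → β≡γα (∈-resp-↭ p (there r∈))))) ⟩
    pickSum (λ r rs′ → γ r * α r * (+ (k !) * prodOver α rs′ * sumOver γ rs′)) rs
      -- `rs′` omits just `r`, so its sum of `γ` is the full sum minus `γ r`.
      ≡⟨ pickSum-cong rs (λ r rs′ p → ≡.trans
           (regroup (γ r) (α r) (+ (k !)) (prodOver α rs′) (sumOver γ rs′))
           (cong₂ (λ s t → γ r * (s - γ r) * α r * (+ (k !) * t))
             (sumOver-↭ γ p) ≡.refl)) ⟩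
    pickSum (λ r rs′ → γ r * (sumOver γ rs - γ r) * α r * (+ (k !) * prodOver α rs′)) rs
      ≡⟨ sum-of-cofactors k α (λ r → γ r * (sumOver γ rs - γ r)) rs ⟩
    + (k !) * prodOver α rs * sumOver (λ r → γ r * (sumOver γ rs - γ r)) rs
      ≡⟨ cong (_*_ (+ (k !) * prodOver α rs)) (expand (sumOver γ rs) rs) ⟩
    + (k !) * prodOver α rs * (sumOver γ rs * sumOver γ rs - sumOver (λ r → γ r * γ r) rs)
      ∎
    where
    open ≡-Reasoning
    open import Data.List.Relation.Binary.Permutation.Propositional.Properties
      using (↭-length; ∈-resp-↭)
    once : ∀ rs → length rs ≡ suc k → (∀ {r} → r ∈ rs → β r ≡ γ r * α r) →
           per rs (β ∷ replicate k α) ≡ + (k !) * prodOver α rs * sumOver γ rs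
    once rs@(_ ∷ _) len eq = ≡.trans
      (pickSum-cong rs λ r rs′ p → cong₂ _*_ (eq (∈-resp-↭ p (here ≡.refl)))
        (per-replicate k α rs′ (ℕ.suc-injective (≡.trans (↭-length p) len))))
      (sum-of-cofactors k α γ rs)
    regroup : ∀ g a k p s → g * a * (k * p * s) ≡ g * (g + s - g) * a * (k * p)
    regroup = solve-∀
    expand : ∀ s rs → sumOver (λ r → γ r * (s - γ r)) rs ≡
             sumOver γ rs * s - sumOver (λ r → γ r * γ r) rs
    expand s []       = ≡.refl
    expand s (r ∷ rs) = ≡.trans (cong (_+_ (γ r * (s - γ r))) (expand s rs))
      (step (γ r) s (sumOver γ rs) (sumOver (λ r → γ r * γ r) rs))
      where
      step : ∀ g s a b → g * (s - g) + (a * s - b) ≡ (g + a) * s - (g * g + b)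
      step = solve-∀

  Vector : Set → Set
  Vector E = List (ℤ × E)

  Support : Vector E → List E
  Support = map proj₂

  combine : (E → A → ℤ) → Vector E → A → ℤ
  combine col v r = sumOver (λ (z , e) → z * col e r) v

  per-linear : (rs : List A) (P C : List (A → ℤ)) (c d : A → ℤ) (z : ℤ) →
               per rs (P ++ (λ r → z * c r + d r) ∷ C) ≡
               z * per rs (P ++ c ∷ C) + per rs (P ++ d ∷ C)
  per-linear rs []      C c d z = begin
    pickSum (λ r rs′ → (z * c r + d r) * per rs′ C) rs
      ≡⟨ pickSum-cong rs (λ r rs′ _ → distrib z (c r) (d r) (per rs′ C)) ⟩
    pickSum (λ r rs′ → z * (c r * per rs′ C) + d r * per rs′ C) rs
      ≡⟨ pickSum-+ _ _ rs ⟩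
    pickSum (λ r rs′ → z * (c r * per rs′ C)) rs + pickSum (λ r rs′ → d r * per rs′ C) rs
      ≡⟨ cong (_+ pickSum (λ r rs′ → d r * per rs′ C) rs) (pickSum-*ˡ z _ rs) ⟩
    z * pickSum (λ r rs′ → c r * per rs′ C) rs + pickSum (λ r rs′ → d r * per rs′ C) rs
      ∎
    where
    open ≡-Reasoning
    distrib : ∀ z c d p → (z * c + d) * p ≡ z * (c * p) + d * p
    distrib = solve-∀
  per-linear rs (p ∷ P) C c d z = begin
    pickSum (λ r rs′ → p r * per rs′ (P ++ (λ r → z * c r + d r) ∷ C)) rs
      ≡⟨ pickSum-cong rs (λ r rs′ _ → ≡.trans (cong (p r *_) (per-linear rs′ P C c d z))
           (distrib z (p r) _ _)) ⟩
    pickSum (λ r rs′ → z * (p r * per rs′ (P ++ c ∷ C)) + p r * per rs′ (P ++ d ∷ C)) rs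
      ≡⟨ pickSum-+ _ _ rs ⟩
    pickSum (λ r rs′ → z * (p r * per rs′ (P ++ c ∷ C))) rs + _
      ≡⟨ cong (_+ pickSum (λ r rs′ → p r * per rs′ (P ++ d ∷ C)) rs) (pickSum-*ˡ z _ rs) ⟩
    _ ∎
    where
    open ≡-Reasoning
    distrib : ∀ z p a b → p * (z * a + b) ≡ z * (p * a) + p * b
    distrib = solve-∀

  per-0 : (rs : List A) (P C : List (A → ℤ)) → per rs (P ++ (λ _ → 0ℤ) ∷ C) ≡ 0ℤ
  per-0 rs []      C = ≡.trans (pickSum-cong rs λ _ rs′ _ → ℤ.*-zeroˡ (per rs′ C)) (pickSum-0 rs)
  per-0 rs (p ∷ P) C = ≡.trans
    (pickSum-cong rs λ r rs′ _ → ≡.trans (cong (p r *_) (per-0 rs′ P C)) (ℤ.*-zeroʳ (p r)))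
    (pickSum-0 rs)

  -- By multilinearity the permanent is a combination of permanents with one edge chosen from each
  -- support, so one of these is nonzero; decidable equality of integers finds it column by column.
  per-expand : (col : E → A → ℤ) (rs : List A) (vs : List (Vector E)) →
               per rs (map (combine col) vs) ≢ 0ℤ →
               ∃[ es ] (Pointwise (λ e v → e ∈ Support v) es vs × per rs (map col es) ≢ 0ℤ)
  per-expand {E = E} col rs vs = go [] vs
    where
    shift : ∀ ds e C → map col (ds ++ e ∷ []) ++ C ≡ map col ds ++ col e ∷ C
    shift []       e C = ≡.refl
    shift (d ∷ ds) e C = cong (col d ∷_) (shift ds e C)

    one : ∀ P C v → per rs (P ++ combine col v ∷ C) ≢ 0ℤ →
          ∃[ e ] (e ∈ Support v × per rs (P ++ col e ∷ C) ≢ 0ℤ)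
    one P C []            nz = contradiction (per-0 rs P C) nz
    one P C ((z , e) ∷ v) nz with per rs (P ++ col e ∷ C) ℤ.≟ 0ℤ
    ... | no  nz′ = e , here ≡.refl , nz′
    -- The term of `e` vanishes, so the rest of the combination alone still gives a nonzero
    -- permanent.
    ... | yes p≡0 with one P C v (λ q≡0 → nz (≡.trans (per-linear rs P C (col e) (combine col v) z)
                         (≡.trans (cong₂ (λ a b → z * a + b) p≡0 q≡0)
                           (cong (_+ 0ℤ) (ℤ.*-zeroʳ z)))))
    ...   | e′ , e′∈ , nz′ = e′ , there e′∈ , nz′

    -- `ds` collects the edges already chosen for the columns to the left.
    go : ∀ ds vs → per rs (map col ds ++ map (combine col) vs) ≢ 0ℤ →
         ∃[ es ] (Pointwise (λ e v → e ∈ Support v) es vs × per rs (map col ds ++ map col es) ≢ 0ℤ)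
    go ds []       nz = [] , [] , nz
    go ds (v ∷ vs) nz with one (map col ds) (map (combine col) vs) v nz
    ... | e , e∈ , nz′ with go (ds ++ e ∷ []) vs (nz′ ∘ ≡.trans (cong (per rs) (sym (shift ds e _))))
    ...   | es , es∈ , nz″ = e ∷ es , e∈ ∷ es∈ , nz″ ∘ ≡.trans (cong (per rs) (shift ds e _))

open Coefficients using (CoefficientRing)

-- The Combinatorial Nullstellensatz by divided differences

module Nullstellensatz {c ℓ p} (R : CoefficientRing c ℓ p) where

  open import Data.Integer.Base as ℤ using (ℤ; +_; 0ℤ; 1ℤ)
  open import Data.Fin.Base using (Fin; zero; suc)
  import Data.Fin.Properties as Fin
  open import Data.List.Base as List using (List; []; _∷_; length)
  import Data.List.Properties as List
  open import Data.List.Membership.Propositional using (_∈_)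
  open import Data.List.Relation.Binary.Permutation.Propositional
    using (_↭_; ↭-refl; ↭-trans; ↭-prep; ↭-swap)
  open import Data.List.Relation.Binary.Permutation.Propositional.Properties using (↭-length)
  open import Data.List.Relation.Unary.Any using (here; there)
  import Data.Integer.Properties as ℤ
  import Data.Maybe.Base as Maybe
  open import Data.Nat.Base as ℕ using (ℕ; zero; suc; pred; _≤_; _<_; s≤s)
  import Data.Nat.Properties as ℕ
  open import Data.Product.Base using (∃-syntax; _×_; _,_)
  open import Data.Sum.Base using (inj₁; inj₂)
  open import Data.Vec.Base as Vec using (Vec; []; _∷_; lookup; _[_]%=_)
  import Data.Vec.Properties as Vec
  open import Function.Base using (_∘_)
  open import Relation.Binary.PropositionalEquality as ≡ using (_≡_; _≢_)
  open import Relation.Nullary using (¬_; yes; no)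
  open import Relation.Unary using (Decidable)
  open import Relation.Nullary.Decidable using (dec⇒maybe)
  open import Algebra.Solver.Ring.AlmostCommutativeRing
    using (fromCommutativeRing; _-Raw-AlmostCommutative⟶_)
  import Algebra.Solver.Ring
  open Permanent using (per; per-row; pickSum; pickSum-0; pickSum-cong)

  open CoefficientRing R
  import Relation.Binary.Reasoning.Setoid setoid as ≈-Reasoning

  private
    ι-neg : ∀ a → ι (ℤ.- a) ≈ - ι a
    ι-neg a = inverseˡ-unique _ _ (trans (sym (ι-+ (ℤ.- a) a)) (trans (reflexive (≡.cong ι (ℤ.+-inverseˡ a))) ι-0))
      where open import Algebra.Properties.Ring ring using () renaming (+-inverseˡ-unique to inverseˡ-unique)

    ι-morphism : ℤ.+-*-rawRing -Raw-AlmostCommutative⟶ fromCommutativeRing commutativeRing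
    ι-morphism = record
      { ⟦_⟧ = ι ; +-homo = ι-+ ; *-homo = ι-* ; -‿homo = ι-neg ; 0-homo = ι-0 ; 1-homo = ι-1 }

    ι-≟ : ∀ a b → Maybe.Maybe (ι a ≈ ι b)
    ι-≟ a b = Maybe.map (λ a≡b → reflexive (≡.cong ι a≡b)) (dec⇒maybe (a ℤ.≟ b))

    open Algebra.Solver.Ring ℤ.+-*-rawRing (fromCommutativeRing commutativeRing) ι-morphism ι-≟
      using (solve; _:=_; _:+_; _:*_; :-_; con)

  ∑ : ∀ {m} → (Fin m → Carrier) → Carrier
  ∑ {zero}  f = 0#
  ∑ {suc m} f = f zero + ∑ (f ∘ suc)

  ∑-cong : ∀ {m} {f g : Fin m → Carrier} → (∀ i → f i ≈ g i) → ∑ f ≈ ∑ g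
  ∑-cong {zero}  eq = refl
  ∑-cong {suc m} eq = +-cong (eq zero) (∑-cong (eq ∘ suc))

  ∑-0 : ∀ m → ∑ {m} (λ _ → 0#) ≈ 0#
  ∑-0 zero    = refl
  ∑-0 (suc m) = trans (+-identityˡ _) (∑-0 m)

  ∑-+ : ∀ {m} (f g : Fin m → Carrier) → ∑ (λ i → f i + g i) ≈ ∑ f + ∑ g
  ∑-+ {zero}  f g = sym (+-identityˡ 0#)
  ∑-+ {suc m} f g = trans (+-congˡ (∑-+ (f ∘ suc) (g ∘ suc)))
    (solve 4 (λ a b c d → (a :+ b) :+ (c :+ d) := (a :+ c) :+ (b :+ d)) refl _ _ _ _)

  ∑-*ʳ : ∀ {m} (f : Fin m → Carrier) a → ∑ f * a ≈ ∑ (λ i → f i * a)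
  ∑-*ʳ {zero}  f a = zeroˡ a
  ∑-*ʳ {suc m} f a = trans (distribʳ a _ _) (+-congˡ (∑-*ʳ (f ∘ suc) a))

  affine-difference : ∀ {m} a b (p q : Fin m → ℤ) (y : Fin m → Carrier) →
    (a + ∑ λ i → ι (p i) * y i) - (b + ∑ λ i → ι (q i) * y i) ≈ (a - b) + ∑ λ i → ι (p i ℤ.- q i) * y i
  affine-difference {m} a b p q y = begin
    (a + P) - (b + Q)
      ≈⟨ +-congʳ (+-congˡ (trans (∑-cong λ i → split (p i) (q i) (y i)) (∑-+ {m} _ _))) ⟩
    (a + (∑ (λ i → ι (p i ℤ.- q i) * y i) + Q)) - (b + Q)
      ≈⟨ solve 4 (λ a b s q → (a :+ (s :+ q)) :+ :- (b :+ q) := (a :+ :- b) :+ s) refl a b _ Q ⟩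
    (a - b) + ∑ (λ i → ι (p i ℤ.- q i) * y i) ∎
    where
    open ≈-Reasoning
    P = ∑ λ i → ι (p i) * y i
    Q = ∑ λ i → ι (q i) * y i
    split : ∀ c d z → ι c * z ≈ ι (c ℤ.- d) * z + ι d * z
    split c d z = trans
      (solve 3 (λ c d z → c :* z := (c :+ :- d) :* z :+ d :* z) refl (ι c) (ι d) z)
      (+-congʳ (*-congʳ (sym (trans (ι-+ c (ℤ.- d)) (+-congˡ (ι-neg d))))))

  ∑ˡ : ∀ {a} {A : Set a} → (A → Carrier) → List A → Carrier
  ∑ˡ f xs = List.foldr _+_ 0# (List.map f xs)

  ∑ˡ-filter : ∀ {A : Set} {P : A → Set} (P? : Decidable P) (χ : A → ℤ) →
              (∀ {x} → P x → χ x ≡ 1ℤ) → (∀ {x} → ¬ P x → χ x ≡ 0ℤ) → (f : A → Carrier) (xs : List A) →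
              ∑ˡ f (List.filter P? xs) ≈ ∑ (λ i → ι (χ (List.lookup xs i)) * f (List.lookup xs i))
  ∑ˡ-filter P? χ χ-1 χ-0 f []       = refl
  ∑ˡ-filter P? χ χ-1 χ-0 f (x ∷ xs) with P? x
  ... | yes px = +-cong
    (sym (trans (*-congʳ (trans (reflexive (≡.cong ι (χ-1 px))) ι-1)) (*-identityˡ (f x))))
    (∑ˡ-filter P? χ χ-1 χ-0 f xs)
  ... | no ¬px = trans (∑ˡ-filter P? χ χ-1 χ-0 f xs) (trans (sym (+-identityˡ _)) (+-congʳ
    (sym (trans (*-congʳ (trans (reflexive (≡.cong ι (χ-0 ¬px))) ι-0)) (zeroˡ (f x))))))

  -- Turns a difference of two vertex sums, each over a filtered edge list, into one affine form in
  -- all edge weights; with incidences for `χ` and `ψ`, its coefficients are those recorded by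
  -- `column`.
  filter-difference : ∀ {A : Set} {P Q : A → Set} (P? : Decidable P) (Q? : Decidable Q) (χ ψ : A → ℤ) →
    (∀ {x} → P x → χ x ≡ 1ℤ) → (∀ {x} → ¬ P x → χ x ≡ 0ℤ) →
    (∀ {x} → Q x → ψ x ≡ 1ℤ) → (∀ {x} → ¬ Q x → ψ x ≡ 0ℤ) → ∀ a b (f : A → Carrier) (xs : List A) →
    (a + ∑ˡ f (List.filter P? xs)) - (b + ∑ˡ f (List.filter Q? xs)) ≈
    (a - b) + ∑ λ i → ι (χ (List.lookup xs i) ℤ.- ψ (List.lookup xs i)) * f (List.lookup xs i)
  filter-difference P? Q? χ ψ χ-1 χ-0 ψ-1 ψ-0 a b f xs = trans
    (+-cong (+-congˡ (∑ˡ-filter P? χ χ-1 χ-0 f xs)) (-‿cong (+-congˡ (∑ˡ-filter Q? ψ ψ-1 ψ-0 f xs))))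
    (affine-difference a b (χ ∘ List.lookup xs) (ψ ∘ List.lookup xs) (f ∘ List.lookup xs))

  -- The values of f at o, o+1, …, o+k, combined into k! times their divided
  -- difference at the nodes x o, …, x (o+k), where I i j inverts x j - x i.
  divided : (ℕ → ℕ → Carrier) → ℕ → ℕ → (ℕ → Carrier) → Carrier
  divided I o zero    f = f o
  divided I o (suc k) f =
    ι (+ suc k) * divided I (suc o) k (λ j → (f j - f o) * I o j)

  divided-cong : ∀ I o k {f g} → (∀ j → o ≤ j → j ≤ o ℕ.+ k → f j ≈ g j) →
                 divided I o k f ≈ divided I o k g
  divided-cong I o zero    eq = eq o ℕ.≤-refl (ℕ.m≤m+n o 0)
  divided-cong I o (suc k) eq = *-congˡ (divided-cong I (suc o) k λ j o<j j≤ →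
    *-congʳ (+-cong (eq j (ℕ.<⇒≤ o<j) (ℕ.≤-trans j≤ (ℕ.≤-reflexive (≡.sym (ℕ.+-suc o k)))))
      (-‿cong (eq o ℕ.≤-refl (ℕ.m≤m+n o (suc k))))))

  divided-+ : ∀ I o k f g → divided I o k (λ j → f j + g j) ≈ divided I o k f + divided I o k g
  divided-+ I o zero    f g = refl
  divided-+ I o (suc k) f g = trans
    (*-congˡ (trans
      (divided-cong I (suc o) k λ j _ _ →
        solve 5 (λ a b c d i → ((a :+ b) :+ :- (c :+ d)) :* i := (a :+ :- c) :* i :+ (b :+ :- d) :* i) refl
          (f j) (g j) (f o) (g o) (I o j))
      (divided-+ I (suc o) k _ _)))
    (distribˡ _ _ _)

  divided-* : ∀ I o k a f → divided I o k (λ j → a * f j) ≈ a * divided I o k f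
  divided-* I o zero    a f = refl
  divided-* I o (suc k) a f = trans
    (*-congˡ (trans
      (divided-cong I (suc o) k λ j _ _ →
        solve 4 (λ a b c i → (a :* b :+ :- (a :* c)) :* i := a :* ((b :+ :- c) :* i)) refl
          a (f j) (f o) (I o j))
      (divided-* I (suc o) k a _)))
    (solve 3 (λ n a d → n :* (a :* d) := a :* (n :* d)) refl _ a _)

  divided-0 : ∀ I o k → divided I o k (λ _ → 0#) ≈ 0#
  divided-0 I o k = trans (divided-cong I o k λ _ _ _ → sym (zeroˡ 0#))
    (trans (divided-* I o k 0# _) (zeroˡ _))

  divided-const : ∀ I o k a → divided I o (suc k) (λ _ → a) ≈ 0#
  divided-const I o k a = trans
    (*-congˡ (trans (divided-cong I (suc o) k λ j _ _ →
      trans (*-congʳ (-‿inverseʳ a)) (zeroˡ _)) (divided-0 I (suc o) k)))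
    (zeroʳ _)

  -- The Leibniz rule for divided differences, as the first difference of `x` is 1 and all higher
  -- ones vanish. The scaling by `k !` gives the second term the factor `k`, a multiplicity that the
  -- permanent will absorb. For `k = 0` the value of `pred` is harmless, since its coefficient is 0.
  divided-var : ∀ I (x : ℕ → Carrier) o k g →
    (∀ j → o < j → j ≤ o ℕ.+ k → (x j - x o) * I o j ≈ 1#) →
    divided I o k (λ j → x j * g j) ≈
    x o * divided I o k g + ι (+ k) * divided I (suc o) (pred k) g
  divided-var I x o zero    g inv = sym (trans (+-congˡ (trans (*-congʳ ι-0) (zeroˡ _))) (+-identityʳ _))
  divided-var I x o (suc k) g inv = begin
    ι (+ suc k) * divided I (suc o) k (λ j → (x j * g j - x o * g o) * I o j)
      ≈⟨ *-congˡ (divided-cong I (suc o) k λ j o<j j≤ → leibniz j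
           (inv j o<j (ℕ.≤-trans j≤ (ℕ.≤-reflexive (≡.sym (ℕ.+-suc o k)))))) ⟩
    ι (+ suc k) * divided I (suc o) k (λ j → x o * ((g j - g o) * I o j) + g j)
      ≈⟨ *-congˡ (trans (divided-+ I (suc o) k _ g) (+-congʳ (divided-* I (suc o) k (x o) _))) ⟩
    ι (+ suc k) * (x o * divided I (suc o) k (λ j → (g j - g o) * I o j) + divided I (suc o) k g)
      ≈⟨ solve 4 (λ n a b c → n :* (a :* b :+ c) := a :* (n :* b) :+ n :* c) refl _ (x o) _ _ ⟩
    x o * (ι (+ suc k) * divided I (suc o) k (λ j → (g j - g o) * I o j)) +
      ι (+ suc k) * divided I (suc o) k g
      ∎
    where
    open ≈-Reasoning
    leibniz : ∀ j → (x j - x o) * I o j ≈ 1# →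
              (x j * g j - x o * g o) * I o j ≈ x o * ((g j - g o) * I o j) + g j
    leibniz j eq = begin
      (x j * g j - x o * g o) * I o j
        ≈⟨ solve 5 (λ a b c d i → (a :* b :+ :- (c :* d)) :* i :=
             c :* ((b :+ :- d) :* i) :+ (a :+ :- c) :* i :* b) refl
             (x j) (g j) (x o) (g o) (I o j) ⟩
      x o * ((g j - g o) * I o j) + (x j - x o) * I o j * g j
        ≈⟨ +-congˡ (trans (*-congʳ eq) (*-identityˡ (g j))) ⟩
      x o * ((g j - g o) * I o j) + g j ∎

  -- Tensor product of the functionals `divided`, with orders `K` and first nodes `O`. On
  -- polynomials of total degree at most the sum of `K` it is the coefficient of the monomial with
  -- exponents `K`, times the product of the factorials of `K`.
  Λ : ∀ {m} → (Fin m → ℕ → ℕ → Carrier) → Vec ℕ m → Vec ℕ m → (Vec ℕ m → Carrier) → Carrier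
  Λ I []      []      F = F []
  Λ I (k ∷ K) (o ∷ O) F = divided (I zero) o k λ j → Λ (I ∘ suc) K O λ σ → F (j ∷ σ)

  Λ-cong : ∀ {m} I (K O : Vec ℕ m) {F G} → (∀ σ → F σ ≈ G σ) → Λ I K O F ≈ Λ I K O G
  Λ-cong I []      []      eq = eq []
  Λ-cong I (k ∷ K) (o ∷ O) eq = divided-cong (I zero) o k λ j _ _ →
    Λ-cong (I ∘ suc) K O λ σ → eq (j ∷ σ)

  Λ-+ : ∀ {m} I (K O : Vec ℕ m) F G → Λ I K O (λ σ → F σ + G σ) ≈ Λ I K O F + Λ I K O G
  Λ-+ I []      []      F G = refl
  Λ-+ I (k ∷ K) (o ∷ O) F G = trans
    (divided-cong (I zero) o k λ j _ _ → Λ-+ (I ∘ suc) K O (λ σ → F (j ∷ σ)) (λ σ → G (j ∷ σ)))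
    (divided-+ (I zero) o k _ _)

  Λ-* : ∀ {m} I (K O : Vec ℕ m) a F → Λ I K O (λ σ → a * F σ) ≈ a * Λ I K O F
  Λ-* I []      []      a F = refl
  Λ-* I (k ∷ K) (o ∷ O) a F = trans
    (divided-cong (I zero) o k λ j _ _ → Λ-* (I ∘ suc) K O a (λ σ → F (j ∷ σ)))
    (divided-* (I zero) o k a _)

  Λ-0 : ∀ {m} I (K O : Vec ℕ m) → Λ I K O (λ _ → 0#) ≈ 0#
  Λ-0 I K O = trans (Λ-cong I K O λ _ → sym (zeroˡ 0#)) (trans (Λ-* I K O 0# _) (zeroˡ _))

  Λ-∑ : ∀ {m n} I (K O : Vec ℕ m) (F : Fin n → Vec ℕ m → Carrier) →
        Λ I K O (λ σ → ∑ λ i → F i σ) ≈ ∑ λ i → Λ I K O (F i)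
  Λ-∑ {n = zero}  I K O F = Λ-0 I K O
  Λ-∑ {n = suc n} I K O F = trans (Λ-+ I K O _ _) (+-congˡ (Λ-∑ I K O (F ∘ suc)))

  Λ-const : ∀ {m} I (K O : Vec ℕ m) i a → Λ I (K [ i ]%= suc) O (λ _ → a) ≈ 0#
  Λ-const I (k ∷ K) (o ∷ O) zero    a = divided-const (I zero) o k _
  Λ-const I (k ∷ K) (o ∷ O) (suc i) a = trans
    (divided-cong (I zero) o k λ j _ _ → Λ-const (I ∘ suc) K O i a) (divided-0 (I zero) o k)

  Λ-const-0s : ∀ {m} I (O : Vec ℕ m) a → Λ I (Vec.replicate m 0) O (λ _ → a) ≈ a
  Λ-const-0s I []      a = refl
  Λ-const-0s I (o ∷ O) a = Λ-const-0s (I ∘ suc) O a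

  -- The inverses are data, available only for nodes known to be apart; indices beyond `D` carry no
  -- promise.
  Separated : ∀ {m} → ℕ → (Fin m → ℕ → Carrier) → (Fin m → ℕ → ℕ → Carrier) → Set ℓ
  Separated D x I = ∀ i o j → o < j → j ≤ D → (x i j - x i o) * I i o j ≈ 1#

  Λ-var : ∀ {m} D x I (K O : Vec ℕ m) → Separated D x I →
          (∀ i → lookup O i ℕ.+ lookup K i ≤ D) → ∀ i F →
          Λ I K O (λ σ → x i (lookup σ i) * F σ) ≈
          x i (lookup O i) * Λ I K O F +
          ι (+ lookup K i) * Λ I (K [ i ]%= pred) (O [ i ]%= suc) F
  Λ-var D x I (k ∷ K) (o ∷ O) sep bd zero    F = trans
    (divided-cong (I zero) o k λ j _ _ → Λ-* (I ∘ suc) K O (x zero j) _)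
    (divided-var (I zero) (x zero) o k _ λ j o<j j≤ → sep zero o j o<j (ℕ.≤-trans j≤ (bd zero)))
  Λ-var D x I (k ∷ K) (o ∷ O) sep bd (suc i) F = trans
    (divided-cong (I zero) o k λ j _ _ →
      Λ-var D (x ∘ suc) (I ∘ suc) K O (sep ∘ suc) (bd ∘ suc) i (λ σ → F (j ∷ σ)))
    (trans (divided-+ (I zero) o k _ _)
      (+-cong (divided-* (I zero) o k _ _) (divided-* (I zero) o k _ _)))

  counts : ∀ {m} → List (Fin m) → Vec ℕ m
  counts {m} []       = Vec.replicate m 0
  counts     (c ∷ cs) = counts cs [ c ]%= suc

  counts-↭ : ∀ {m} {cs ds : List (Fin m)} → cs ↭ ds → counts cs ≡ counts ds
  counts-↭ _↭_.refl         = ≡.refl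
  counts-↭ (_↭_.prep x p)   = ≡.cong (_[ x ]%= suc) (counts-↭ p)
  counts-↭ (_↭_.swap {_} {ds} x y p) = ≡.trans
    (≡.cong (λ v → v [ y ]%= suc [ x ]%= suc) (counts-↭ p)) (suc-comm (counts ds) y x)
    where
    suc-comm : ∀ {m} (v : Vec ℕ m) i j → v [ i ]%= suc [ j ]%= suc ≡ v [ j ]%= suc [ i ]%= suc
    suc-comm (k ∷ v) zero    zero    = ≡.refl
    suc-comm (k ∷ v) zero    (suc j) = ≡.refl
    suc-comm (k ∷ v) (suc i) zero    = ≡.refl
    suc-comm (k ∷ v) (suc i) (suc j) = ≡.cong (k ∷_) (suc-comm v i j)
  counts-↭ (_↭_.trans p q)  = ≡.trans (counts-↭ p) (counts-↭ q)

  pred-suc : ∀ {m} (v : Vec ℕ m) i → v [ i ]%= suc [ i ]%= pred ≡ v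
  pred-suc (k ∷ v) zero    = ≡.refl
  pred-suc (k ∷ v) (suc i) = ≡.cong (k ∷_) (pred-suc v i)

  -- Converts the multiplicities produced by `Λ-var` into a sum over the occurrences in `cs`, the
  -- shape of an expansion along a row.
  ∑-counts : ∀ {m} (g : Fin m → Carrier) cs →
             ∑ (λ i → ι (+ lookup (counts cs) i) * g i) ≈ ∑ˡ g cs
  ∑-counts {m} g []   = trans (∑-cong {m} λ i → trans
      (*-congʳ (trans (reflexive (≡.cong (ι ∘ +_) (Vec.lookup-replicate i 0))) ι-0)) (zeroˡ _))
    (∑-0 m)
  ∑-counts g (c ∷ cs) = trans (step (counts cs) c g) (+-congˡ (∑-counts g cs))
    where
    step : ∀ {m} (v : Vec ℕ m) c (g : Fin m → Carrier) →
           ∑ (λ i → ι (+ lookup (v [ c ]%= suc) i) * g i) ≈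
           g c + ∑ (λ i → ι (+ lookup v i) * g i)
    step (k ∷ v) zero    g = begin
      ι (+ suc k) * g zero + _       ≈⟨ +-congʳ (*-congʳ (trans (ι-+ 1ℤ (+ k)) (+-congʳ ι-1))) ⟩
      (1# + ι (+ k)) * g zero + _    ≈⟨ +-congʳ (distribʳ _ _ _) ⟩
      1# * g zero + ι (+ k) * g zero + _ ≈⟨ +-assoc _ _ _ ⟩
      1# * g zero + (ι (+ k) * g zero + _) ≈⟨ +-congʳ (*-identityˡ _) ⟩
      g zero + (ι (+ k) * g zero + _) ∎
      where open ≈-Reasoning
    step (k ∷ v) (suc c) g = trans (+-congˡ (step v c (g ∘ suc)))
      (solve 3 (λ a b c → a :+ (b :+ c) := b :+ (a :+ c)) refl _ _ _)

  ∑ˡ-pickSum : ∀ {A : Set} (h : A → Carrier) (g : A → List A → ℤ) cs →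
               (∀ y ys → y ∷ ys ↭ cs → h y ≈ ι (g y ys)) → ∑ˡ h cs ≈ ι (pickSum g cs)
  ∑ˡ-pickSum h g []       eq = sym ι-0
  ∑ˡ-pickSum h g (c ∷ cs) eq = trans
    (+-cong (eq c cs ↭-refl) (∑ˡ-pickSum h (λ y ys → g y (c ∷ ys)) cs λ y ys p →
      eq y (c ∷ ys) (↭-trans (↭-swap y c ↭-refl) (↭-prep c p))))
    (sym (ι-+ _ _))

  pickSum-map : ∀ {A B : Set} (f : A → B) (g : B → List B → ℤ) xs →
                pickSum g (List.map f xs) ≡ pickSum (λ y ys → g (f y) (List.map f ys)) xs
  pickSum-map f g []       = ≡.refl
  pickSum-map f g (x ∷ xs) = ≡.cong (ℤ._+_ (g (f x) (List.map f xs)))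
    (pickSum-map f (λ y ys → g y (f x ∷ ys)) xs)

  per-short : ∀ {A : Set} (rs : List A) C → length rs < length C → per rs C ≡ 0ℤ
  per-short rs (c ∷ C) (s≤s rs≤C) = ≡.trans
    (pickSum-cong rs λ r rs′ p → ≡.trans
      (≡.cong (c r ℤ.*_) (per-short rs′ C (ℕ.≤-trans (ℕ.≤-reflexive (↭-length p)) rs≤C)))
      (ℤ.*-zeroʳ (c r)))
    (pickSum-0 rs)

  module _ {A : Set} {m} (D : ℕ) (x : Fin m → ℕ → Carrier) (I : Fin m → ℕ → ℕ → Carrier)
           (sep : Separated D x I) (κ : A → Carrier) (λᶜ : Fin m → A → ℤ) where

    affine : A → Vec ℕ m → Carrier
    affine r σ = κ r + ∑ λ i → ι (λᶜ i r) * x i (lookup σ i)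

    ∏ : List A → Vec ℕ m → Carrier
    ∏ []       σ = 1#
    ∏ (r ∷ rs) σ = affine r σ * ∏ rs σ

    -- Induction on the rows. In the form of `r`, the constant term and, by `Λ-var`, the values at
    -- the first nodes multiply `Λ` of a product with fewer factors than `cs` has entries, which is
    -- 0 by induction. What remains is the expansion of the permanent along `r`. The inequality of
    -- lengths makes this vanishing part of the same induction. Each step raises `O` where it lowers
    -- the order, which preserves the bound `D`.
    Λ-∏ : ∀ rs cs (O : Vec ℕ m) → (∀ i → lookup O i ℕ.+ lookup (counts cs) i ≤ D) →
          length rs ≤ length cs → Λ I (counts cs) O (∏ rs) ≈ ι (per rs (List.map λᶜ cs))
    Λ-∏ []       []       O bd _ = trans (Λ-const-0s I O 1#) (sym ι-1)
    Λ-∏ []       (c ∷ cs) O bd _ = trans (Λ-const I (counts cs) O c 1#) (sym ι-0)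
    Λ-∏ (r ∷ rs) cs       O bd rs<cs = begin
      Λ I K O (λ σ → (κ r + ∑ λ i → ι (λᶜ i r) * x i (lookup σ i)) * P σ)
        ≈⟨ Λ-cong I K O (λ σ → trans (distribʳ (P σ) (κ r) _) (+-congˡ (∑-*ʳ {m} _ (P σ)))) ⟩
      Λ I K O (λ σ → κ r * P σ + ∑ λ i → ι (λᶜ i r) * x i (lookup σ i) * P σ)
        ≈⟨ Λ-+ I K O _ _ ⟩
      Λ I K O (λ σ → κ r * P σ) + Λ I K O (λ σ → ∑ λ i → ι (λᶜ i r) * x i (lookup σ i) * P σ)
        ≈⟨ +-cong (trans (Λ-* I K O (κ r) P) (trans (*-congˡ P≈0) (zeroʳ _))) (Λ-∑ {n = m} I K O _) ⟩
      0# + ∑ (λ i → Λ I K O (λ σ → ι (λᶜ i r) * x i (lookup σ i) * P σ))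
        ≈⟨ +-identityˡ _ ⟩
      ∑ (λ i → Λ I K O (λ σ → ι (λᶜ i r) * x i (lookup σ i) * P σ))
        ≈⟨ ∑-cong (λ i → trans (Λ-cong I K O λ σ → *-assoc _ _ _) (trans (Λ-* I K O _ _)
             (*-congˡ (trans (Λ-var D x I K O sep bd i P)
               (trans (+-congʳ (trans (*-congˡ P≈0) (zeroʳ _))) (+-identityˡ _)))))) ⟩
      ∑ (λ i → ι (λᶜ i r) * (ι (+ lookup K i) * h i))
        ≈⟨ ∑-cong (λ i → solve 3 (λ a b c → a :* (b :* c) := b :* (a :* c)) refl _ _ (h i)) ⟩
      ∑ (λ i → ι (+ lookup K i) * (ι (λᶜ i r) * h i))
        ≈⟨ ∑-counts _ cs ⟩
      ∑ˡ (λ i → ι (λᶜ i r) * h i) cs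
        ≈⟨ ∑ˡ-pickSum _ (λ c cs′ → λᶜ c r ℤ.* per rs (List.map λᶜ cs′)) cs (λ c cs′ p →
             trans (*-congˡ (descend c cs′ p)) (sym (ι-* _ _))) ⟩
      ι (pickSum (λ c cs′ → λᶜ c r ℤ.* per rs (List.map λᶜ cs′)) cs)
        ≈⟨ reflexive (≡.cong ι (≡.sym (≡.trans (per-row r rs (List.map λᶜ cs))
             (pickSum-map λᶜ (λ c C → c r ℤ.* per rs C) cs)))) ⟩
      ι (per (r ∷ rs) (List.map λᶜ cs)) ∎
      where
      open ≈-Reasoning
      K = counts cs
      P = ∏ rs
      h : Fin m → Carrier
      h i = Λ I (K [ i ]%= pred) (O [ i ]%= suc) P

      P≈0 : Λ I K O P ≈ 0#
      P≈0 = trans (Λ-∏ rs cs O bd (ℕ.<⇒≤ rs<cs)) (trans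
        (reflexive (≡.cong ι (per-short rs (List.map λᶜ cs)
          (ℕ.≤-trans rs<cs (ℕ.≤-reflexive (≡.sym (List.length-map λᶜ cs)))))))
        ι-0)

      descend : ∀ c cs′ → c ∷ cs′ ↭ cs → h c ≈ ι (per rs (List.map λᶜ cs′))
      descend c cs′ p = trans
        (reflexive (≡.cong (λ K′ → Λ I K′ (O [ c ]%= suc) P) K-c≡))
        (Λ-∏ rs cs′ (O [ c ]%= suc) bd′
          (ℕ.≤-pred (ℕ.≤-trans rs<cs (ℕ.≤-reflexive (≡.sym (↭-length p))))))
        where
        K≡ : K ≡ counts cs′ [ c ]%= suc
        K≡ = ≡.sym (counts-↭ p)
        K-c≡ : K [ c ]%= pred ≡ counts cs′
        K-c≡ = ≡.trans (≡.cong (_[ c ]%= pred) K≡) (pred-suc (counts cs′) c)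
        bd′ : ∀ i → lookup (O [ c ]%= suc) i ℕ.+ lookup (counts cs′) i ≤ D
        bd′ i with i Fin.≟ c
        ... | yes ≡.refl = ℕ.≤-trans (ℕ.≤-reflexive (≡.trans
                (≡.cong (ℕ._+ lookup (counts cs′) i) (Vec.lookup∘updateAt i O))
                (≡.trans (≡.sym (ℕ.+-suc (lookup O i) _))
                  (≡.cong (lookup O i ℕ.+_) (≡.sym (≡.trans (≡.cong (λ v → lookup v i) K≡)
                    (Vec.lookup∘updateAt i (counts cs′))))))))
              (bd i)
        ... | no i≢c = ℕ.≤-trans (ℕ.≤-reflexive (≡.cong₂ ℕ._+_
                (Vec.lookup∘updateAt′ i c i≢c O)
                (≡.sym (≡.trans (≡.cong (λ v → lookup v i) K≡)
                  (Vec.lookup∘updateAt′ i c i≢c (counts cs′))))))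
              (bd i)

    private
      NZ-*ʳ : ∀ {a b} → NZ (a * b) → NZ b
      NZ-*ʳ = NZ-*ˡ ∘ NZ-resp (*-comm _ _)

      NZ-neg : ∀ {a} → NZ (- a) → NZ a
      NZ-neg = NZ-*ˡ ∘ NZ-resp (solve 1 (λ a → :- a := a :* :- (con 1ℤ)) refl _)

    -- The contrapositive of "zero at all nodes implies zero", made constructive by `NZ-+`: each
    -- difference passes its being nonzero on to one of its two terms.
    divided-NZ : ∀ I o k f → NZ (divided I o k f) → ∃[ j ] (j ≤ o ℕ.+ k × NZ (f j))
    divided-NZ I o zero    f nz = o , ℕ.m≤m+n o 0 , nz
    divided-NZ I o (suc k) f nz with divided-NZ I (suc o) k _ (NZ-*ʳ nz)
    ... | j , j≤ , nz′ with NZ-+ (NZ-*ˡ nz′)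
    ...   | inj₁ fj = j , ℕ.≤-trans j≤ (ℕ.≤-reflexive (≡.sym (ℕ.+-suc o k))) , fj
    ...   | inj₂ fo = o , ℕ.m≤m+n o (suc k) , NZ-neg fo

    Λ-NZ : ∀ {m} I (K O : Vec ℕ m) F → NZ (Λ I K O F) →
           ∃[ σ ] ((∀ i → lookup σ i ≤ lookup O i ℕ.+ lookup K i) × NZ (F σ))
    Λ-NZ I []      []      F nz = [] , (λ ()) , nz
    Λ-NZ I (k ∷ K) (o ∷ O) F nz with divided-NZ (I zero) o k _ nz
    ... | j , j≤ , nz′ with Λ-NZ (I ∘ suc) K O (λ σ → F (j ∷ σ)) nz′
    ...   | σ , σ≤ , nz″ = j ∷ σ , (λ { zero → j≤ ; (suc i) → σ≤ i }) , nz″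

    ∏-NZ : ∀ rs σ → NZ (∏ rs σ) → ∀ {r} → r ∈ rs → NZ (affine r σ)
    ∏-NZ (r ∷ rs) σ nz (here ≡.refl) = NZ-*ˡ nz
    ∏-NZ (r ∷ rs) σ nz (there r∈)    = ∏-NZ rs σ (NZ-*ʳ nz) r∈

    -- Alon's Combinatorial Nullstellensatz for a product of affine forms: the
    -- permanent is, up to factorials, the coefficient of the monomial cs.
    nullstellensatz : ∀ rs cs → length rs ≡ length cs → per rs (List.map λᶜ cs) ≢ 0ℤ →
                      (∀ i → lookup (counts cs) i ≤ D) →
                      ∃[ σ ] ((∀ i → lookup σ i ≤ D) × (∀ {r} → r ∈ rs → NZ (affine r σ)))
    nullstellensatz rs cs len nz bd
      with Λ-NZ I (counts cs) O _ (NZ-resp (sym (Λ-∏ rs cs O bd′ (ℕ.≤-reflexive len))) (NZ-ι nz))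
      where
      O = Vec.replicate m 0
      bd′ : ∀ i → lookup O i ℕ.+ lookup (counts cs) i ≤ D
      bd′ i = ≡.subst (λ z → z ℕ.+ lookup (counts cs) i ≤ D)
        (≡.sym (Vec.lookup-replicate i 0)) (bd i)
    ... | σ , σ≤ , nz′ = σ
      , (λ i → ℕ.≤-trans (σ≤ i) (≡.subst (λ z → z ℕ.+ lookup (counts cs) i ≤ D)
          (≡.sym (Vec.lookup-replicate i 0)) (bd i)))
      , λ {r} → ∏-NZ rs σ nz′ {r}

-- The constructive reals as a coefficient ring

module Reals where

  open import Algebra.Bundles using (CommutativeRing)
  open import Data.Integer.Base as ℤ using (ℤ; 0ℤ; 1ℤ)
  open import Data.Integer.Tactic.RingSolver using (solve-∀)
  import Data.Integer.Properties as ℤ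
  open import Data.Nat.Base as ℕ using (ℕ)
  import Data.Nat.Properties as ℕ
  open import Data.Product.Base using (∃-syntax; _×_; _,_)
  open import Data.Rational as ℚ using (ℚ; 0ℚ; 1ℚ; _≤_; _<_; _+_; _*_; _-_; -_; ∣_∣; 1/_)
  open import Data.Rational.Literals using (fromℤ)
  import Data.Rational.Properties as ℚ
  open import Data.Rational.Solver using (module +-*-Solver)
  import Data.Rational.Unnormalised.Base as ℚᵘ
  import Data.Rational.Unnormalised.Properties as ℚᵘ
  open import Data.Sum.Base using (_⊎_; inj₁; inj₂)
  open Coefficients using (CoefficientRing)
  open import Defs using (ℝ; seq; cauchy; 0ʳ; _+ʳ_)
  open import Relation.Binary.PropositionalEquality
    using (_≡_; _≢_; refl; sym; trans; cong; cong₂; subst)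
  open import Relation.Nullary using (¬_; yes; no; contradiction)

  Eventually : (ℕ → Set) → Set
  Eventually P = ∃[ N ] (∀ n → N ℕ.≤ n → P n)

  map₁ : ∀ {P Q : ℕ → Set} → (∀ n → P n → Q n) → Eventually P → Eventually Q
  map₁ f (N , p) = N , λ n N≤n → f n (p n N≤n)

  map₂ : ∀ {P Q R : ℕ → Set} → (∀ n → P n → Q n → R n) →
         Eventually P → Eventually Q → Eventually R
  map₂ f (M , p) (N , q) = M ℕ.⊔ N , λ n ≤n →
    f n (p n (ℕ.m⊔n≤o⇒m≤o M N ≤n)) (q n (ℕ.m⊔n≤o⇒n≤o M N ≤n))

  <⇒≱ : ∀ {p q} → p < q → ¬ q ≤ p
  <⇒≱ p<q q≤p = ℚ.<-irrefl refl (ℚ.<-≤-trans p<q q≤p)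

  -- abstract, since type checking is infeasible once the witnesses unfold.
  abstract
    scale : ∀ {ε B} → 0ℚ < ε → 0ℚ < B → ∃[ δ ] (0ℚ < δ × B * δ ≡ ε)
    scale {ε} {B} 0<ε 0<B = 1/ B * ε
      , subst (_< 1/ B * ε) (ℚ.*-zeroʳ (1/ B)) (ℚ.*-monoʳ-<-pos (1/ B) 0<ε)
      , trans (sym (ℚ.*-assoc B (1/ B) ε)) (trans (cong (_* ε) (ℚ.*-inverseʳ B)) (ℚ.*-identityˡ ε))
      where instance
        B>0 : ℚ.Positive B
        B>0 = ℚ.positive 0<B
        B≢0 : ℚ.NonZero B
        B≢0 = ℚ.pos⇒nonZero B
        1/B>0 : ℚ.Positive (1/ B)
        1/B>0 = ℚ.1/pos⇒pos B

  ∣∣*∣∣-< : ∀ a b {B δ} → ∣ a ∣ ≤ B → 0ℚ < B → ∣ b ∣ < δ → ∣ a * b ∣ < B * δ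
  ∣∣*∣∣-< a b {B} {δ} a≤B 0<B b<δ = begin-strict
    ∣ a * b ∣     ≡⟨ ℚ.∣p*q∣≡∣p∣*∣q∣ a b ⟩
    ∣ a ∣ * ∣ b ∣ ≤⟨ ℚ.*-monoʳ-≤-nonNeg ∣ b ∣ a≤B ⟩
    B * ∣ b ∣     <⟨ ℚ.*-monoʳ-<-pos B b<δ ⟩
    B * δ         ∎
    where
    open ℚ.≤-Reasoning
    instance
      _ = ℚ.positive 0<B
      _ = ℚ.∣-∣-nonNeg b

  ∣∣-triangle : ∀ a b → ∣ a ∣ ≤ ∣ a - b ∣ + ∣ b ∣
  ∣∣-triangle a b = subst (λ z → ∣ z ∣ ≤ ∣ a - b ∣ + ∣ b ∣) (cancel a b) (ℚ.∣p+q∣≤∣p∣+∣q∣ (a - b) b)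
    where
    open +-*-Solver
    cancel : ∀ a b → (a - b) + b ≡ a
    cancel = solve 2 (λ a b → (a :- b) :+ b := a) refl

  abstract
    bounded : (x : ℝ) → ∃[ B ] (0ℚ < B × Eventually λ n → ∣ seq x n ∣ ≤ B)
    bounded x with cauchy x 1ℚ (ℚ.positive⁻¹ 1ℚ)
    ... | N , close = 1ℚ + ∣ seq x N ∣
      , ℚ.<-≤-trans (ℚ.positive⁻¹ 1ℚ)
          (ℚ.≤-trans (ℚ.≤-reflexive (sym (ℚ.+-identityʳ 1ℚ))) (ℚ.+-monoʳ-≤ 1ℚ (ℚ.0≤∣p∣ (seq x N))))
      , N , λ n N≤n → ℚ.≤-trans (∣∣-triangle (seq x n) (seq x N))
          (ℚ.+-monoˡ-≤ ∣ seq x N ∣ (ℚ.<⇒≤ (close n N N≤n ℕ.≤-refl)))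

  abstract
    half : ∀ {ε} → 0ℚ < ε → ∃[ δ ] (0ℚ < δ × δ + δ ≡ ε)
    half {ε} 0<ε with scale 0<ε (ℚ.positive⁻¹ (1ℚ + 1ℚ))
    ... | δ , 0<δ , eq = δ , 0<δ , trans (double δ) eq
      where
      open +-*-Solver
      double : ∀ δ → δ + δ ≡ (1ℚ + 1ℚ) * δ
      double = solve 1 (λ δ → δ :+ δ := (con 1ℚ :+ con 1ℚ) :* δ) refl

  product-close : ∀ a b c d {B C δ δ′ ε} → 0ℚ < B → 0ℚ < C → ∣ a ∣ ≤ B → ∣ d ∣ ≤ C →
                  ∣ a - c ∣ < δ → ∣ b - d ∣ < δ′ → B * δ′ + C * δ ≡ ε →
                  ∣ a * b - c * d ∣ < ε
  product-close a b c d {B} {C} {δ} {δ′} {ε} 0<B 0<C a≤B d≤C closeᵃ closeᵇ eq = begin-strict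
    ∣ a * b - c * d ∣                     ≡⟨ cong ∣_∣ (split a b c d) ⟩
    ∣ a * (b - d) + d * (a - c) ∣         ≤⟨ ℚ.∣p+q∣≤∣p∣+∣q∣ (a * (b - d)) (d * (a - c)) ⟩
    ∣ a * (b - d) ∣ + ∣ d * (a - c) ∣     <⟨ ℚ.+-mono-< (∣∣*∣∣-< a (b - d) a≤B 0<B closeᵇ)
                                               (∣∣*∣∣-< d (a - c) d≤C 0<C closeᵃ) ⟩
    B * δ′ + C * δ                        ≡⟨ eq ⟩
    ε                                     ∎
    where
    open ℚ.≤-Reasoning
    split : ∀ a b c d → a * b - c * d ≡ a * (b - d) + d * (a - c)
    split = solve 4 (λ a b c d → a :* b :- c :* d := a :* (b :- d) :+ d :* (a :- c)) refl
      where open +-*-Solver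

  infixl 7 _*ʳ_
  _*ʳ_ : ℝ → ℝ → ℝ
  seq (x *ʳ y) n = seq x n * seq y n
  cauchy (x *ʳ y) ε 0<ε with bounded x | bounded y | half 0<ε
  ... | B , 0<B , M₁ , x≤B | C , 0<C , M₂ , y≤C | η , 0<η , η+η≡ε
    with scale 0<η 0<C | scale 0<η 0<B
  ... | δ , 0<δ , Cδ≡η | δ′ , 0<δ′ , Bδ′≡η with cauchy x δ 0<δ | cauchy y δ′ 0<δ′
  ... | N₁ , closeˣ | N₂ , closeʸ = M₁ ℕ.⊔ M₂ ℕ.⊔ (N₁ ℕ.⊔ N₂) , λ m n ≤m ≤n →
    let M = M₁ ℕ.⊔ M₂
        N = N₁ ℕ.⊔ N₂
        M≤m = ℕ.m⊔n≤o⇒m≤o M N ≤m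
        N≤m = ℕ.m⊔n≤o⇒n≤o M N ≤m
        M≤n = ℕ.m⊔n≤o⇒m≤o M N ≤n
        N≤n = ℕ.m⊔n≤o⇒n≤o M N ≤n
    in product-close (seq x m) (seq y m) (seq x n) (seq y n) 0<B 0<C
         (x≤B m (ℕ.m⊔n≤o⇒m≤o M₁ M₂ M≤m)) (y≤C n (ℕ.m⊔n≤o⇒n≤o M₁ M₂ M≤n))
         (closeˣ m n (ℕ.m⊔n≤o⇒m≤o N₁ N₂ N≤m) (ℕ.m⊔n≤o⇒m≤o N₁ N₂ N≤n))
         (closeʸ m n (ℕ.m⊔n≤o⇒n≤o N₁ N₂ N≤m) (ℕ.m⊔n≤o⇒n≤o N₁ N₂ N≤n))
         (trans (cong₂ _+_ Bδ′≡η Cδ≡η) η+η≡ε)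

  -ʳ_ : ℝ → ℝ
  seq (-ʳ x) n = - seq x n
  cauchy (-ʳ x) ε 0<ε = let N , close = cauchy x ε 0<ε in N , λ m n ≤m ≤n →
    subst (_< ε) (trans (sym (ℚ.∣-p∣≡∣p∣ (seq x m - seq x n)))
        (cong ∣_∣ (ℚ.neg-distrib-+ (seq x m) (- seq x n))))
      (close m n ≤m ≤n)

  constant : ℚ → ℝ
  seq (constant q) n = q
  cauchy (constant q) ε 0<ε = 0 , λ _ _ _ _ → subst (_< ε) (sym (cong ∣_∣ (ℚ.+-inverseʳ q))) 0<ε

  -- Finer than equality of limits, but enough for the ring laws, which hold termwise.
  infix 4 _≈_
  record _≈_ (x y : ℝ) : Set where
    constructor eventually
    field agree : Eventually λ n → seq x n ≡ seq y n
  open _≈_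

  termwise : ∀ {x y} → (∀ n → seq x n ≡ seq y n) → x ≈ y
  termwise eq = eventually (0 , λ n _ → eq n)

  ℝ-commutativeRing : CommutativeRing _ _
  ℝ-commutativeRing = record
    { Carrier = ℝ ; _≈_ = _≈_ ; _+_ = _+ʳ_ ; _*_ = _*ʳ_ ; -_ = -ʳ_
    ; 0# = 0ʳ ; 1# = constant 1ℚ
    ; isCommutativeRing = record
      { isRing = record
        { +-isAbelianGroup = record
          { isGroup = record
            { isMonoid = record
              { isSemigroup = record
                { isMagma = record
                  { isEquivalence = record
                    { refl = termwise λ _ → refl
                    ; sym = λ p → eventually (map₁ (λ _ → sym) (agree p))
                    ; trans = λ p q → eventually (map₂ (λ _ → trans) (agree p) (agree q))
                    }
                  ; ∙-cong = λ p q → eventually (map₂ (λ _ → cong₂ _+_) (agree p) (agree q))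
                  }
                ; assoc = λ x y z → termwise λ n → ℚ.+-assoc (seq x n) (seq y n) (seq z n)
                }
              ; identity = (λ x → termwise λ n → ℚ.+-identityˡ (seq x n))
                         , (λ x → termwise λ n → ℚ.+-identityʳ (seq x n))
              }
            ; inverse = (λ x → termwise λ n → ℚ.+-inverseˡ (seq x n))
                      , (λ x → termwise λ n → ℚ.+-inverseʳ (seq x n))
            ; ⁻¹-cong = λ p → eventually (map₁ (λ _ → cong (λ q → - q)) (agree p))
            }
          ; comm = λ x y → termwise λ n → ℚ.+-comm (seq x n) (seq y n)
          }
        ; *-cong = λ p q → eventually (map₂ (λ _ → cong₂ _*_) (agree p) (agree q))
        ; *-assoc = λ x y z → termwise λ n → ℚ.*-assoc (seq x n) (seq y n) (seq z n)
        ; *-identity = (λ x → termwise λ n → ℚ.*-identityˡ (seq x n))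
                     , (λ x → termwise λ n → ℚ.*-identityʳ (seq x n))
        ; distrib = (λ x y z → termwise λ n → ℚ.*-distribˡ-+ (seq x n) (seq y n) (seq z n))
                  , (λ x y z → termwise λ n → ℚ.*-distribʳ-+ (seq x n) (seq y n) (seq z n))
        }
      ; *-comm = λ x y → termwise λ n → ℚ.*-comm (seq x n) (seq y n)
      }
    }

  NonZero : ℝ → Set
  NonZero x = ∃[ ε ] (0ℚ < ε × Eventually λ n → ε ≤ ∣ seq x n ∣)

  NonZero-resp : ∀ {x y} → x ≈ y → NonZero x → NonZero y
  NonZero-resp x≈y (ε , 0<ε , ε≤) = ε , 0<ε , map₂ (λ _ eq → subst (λ z → ε ≤ ∣ z ∣) eq) (agree x≈y) ε≤

  NonZero-*ˡ : ∀ {x y} → NonZero (x *ʳ y) → NonZero x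
  NonZero-*ˡ {x} {y} (ε , 0<ε , ε≤) with bounded y
  ... | B , 0<B , y≤B with scale 0<ε 0<B
  ... | δ , 0<δ , Bδ≡ε = δ , 0<δ , map₂ (λ n ε≤xy ∣y∣≤B → ℚ.≮⇒≥ λ x<δ →
    <⇒≱ (∣∣*∣∣-< (seq y n) (seq x n) ∣y∣≤B 0<B x<δ)
      (ℚ.≤-trans (ℚ.≤-reflexive Bδ≡ε)
        (subst (λ z → ε ≤ ∣ z ∣) (ℚ.*-comm (seq x n) (seq y n)) ε≤xy))) ε≤ y≤B

  NonZero-tail : ∀ {x δ} → 0ℚ < δ → (N : ℕ) →
                 (∀ m n → N ℕ.≤ m → N ℕ.≤ n → ∣ seq x m - seq x n ∣ < δ) →
                 δ + δ ≤ ∣ seq x N ∣ → NonZero x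
  NonZero-tail {x} {δ} 0<δ N close big = δ , 0<δ , N , λ n N≤n → ℚ.≮⇒≥ λ x<δ →
    <⇒≱ (ℚ.≤-<-trans (∣∣-triangle (seq x N) (seq x n))
      (ℚ.+-mono-< (close N n ℕ.≤-refl N≤n) x<δ)) big

  -- Comparing rationals at one late index `M` settles which summand is large. With `ε = 2η = 4δ`, a
  -- term of size at least `η` whose tail varies by less than `δ` stays at least `δ` away from 0.
  NonZero-+ : ∀ {x y} → NonZero (x +ʳ y) → NonZero x ⊎ NonZero y
  NonZero-+ {x} {y} (ε , 0<ε , N , ε≤) with half 0<ε
  ... | η , 0<η , η+η≡ε with half 0<η
  ... | δ , 0<δ , δ+δ≡η with cauchy x δ 0<δ | cauchy y δ 0<δ
  ... | N₁ , closeˣ | N₂ , closeʸ = decide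
    where
    M = N ℕ.⊔ (N₁ ℕ.⊔ N₂)
    N≤M  = ℕ.m≤m⊔n N (N₁ ℕ.⊔ N₂)
    N₁≤M = ℕ.≤-trans (ℕ.m≤m⊔n N₁ N₂) (ℕ.m≤n⊔m N (N₁ ℕ.⊔ N₂))
    N₂≤M = ℕ.≤-trans (ℕ.m≤n⊔m N₁ N₂) (ℕ.m≤n⊔m N (N₁ ℕ.⊔ N₂))
    tail : ∀ {x N′} → N′ ℕ.≤ M → (∀ m n → N′ ℕ.≤ m → N′ ℕ.≤ n → ∣ seq x m - seq x n ∣ < δ) →
           η ≤ ∣ seq x M ∣ → NonZero x
    tail {x} N′≤M close η≤ = NonZero-tail {x} 0<δ M
      (λ m n M≤m M≤n → close m n (ℕ.≤-trans N′≤M M≤m) (ℕ.≤-trans N′≤M M≤n))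
      (ℚ.≤-trans (ℚ.≤-reflexive δ+δ≡η) η≤)
    decide : NonZero x ⊎ NonZero y
    decide with η ℚ.≤? ∣ seq x M ∣ | η ℚ.≤? ∣ seq y M ∣
    ... | yes η≤ | _      = inj₁ (tail {x} N₁≤M closeˣ η≤)
    ... | no _   | yes η≤ = inj₂ (tail {y} N₂≤M closeʸ η≤)
    ... | no η≰x | no η≰y = contradiction (ε≤ M N≤M) (<⇒≱ (ℚ.≤-<-trans
      (ℚ.∣p+q∣≤∣p∣+∣q∣ (seq x M) (seq y M))
      (ℚ.<-≤-trans (ℚ.+-mono-< (ℚ.≰⇒> η≰x) (ℚ.≰⇒> η≰y)) (ℚ.≤-reflexive η+η≡ε))))

  reciprocal : ℚ → ℚ
  reciprocal q with q ℚ.≟ 0ℚ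
  ... | yes _  = 0ℚ
  ... | no q≢0 = (1/ q) ⦃ ℚ.≢-nonZero q≢0 ⦄

  *-reciprocal : ∀ {q} → q ≢ 0ℚ → q * reciprocal q ≡ 1ℚ
  *-reciprocal {q} q≢0 with q ℚ.≟ 0ℚ
  ... | yes q≡0 = contradiction q≡0 q≢0
  ... | no q≢0′ = ℚ.*-inverseʳ q ⦃ ℚ.≢-nonZero q≢0′ ⦄

  away : ∀ {ε q} → 0ℚ < ε → ε ≤ ∣ q ∣ → q ≢ 0ℚ
  away 0<ε ε≤ refl = <⇒≱ 0<ε ε≤

  ∣reciprocal∣-≤ : ∀ {ε η q} → 0ℚ < ε → ε ≤ ∣ q ∣ → ε * η ≡ 1ℚ → ∣ reciprocal q ∣ ≤ η
  ∣reciprocal∣-≤ {ε} {η} {q} 0<ε ε≤ εη≡1 = ℚ.*-cancelˡ-≤-pos ε (begin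
    ε * ∣ reciprocal q ∣     ≤⟨ ℚ.*-monoʳ-≤-nonNeg ∣ reciprocal q ∣ ε≤ ⟩
    ∣ q ∣ * ∣ reciprocal q ∣ ≡⟨ ℚ.∣p*q∣≡∣p∣*∣q∣ q (reciprocal q) ⟨
    ∣ q * reciprocal q ∣     ≡⟨ cong ∣_∣ (*-reciprocal (away 0<ε ε≤)) ⟩
    1ℚ                       ≡⟨ εη≡1 ⟨
    ε * η                    ∎)
    where
    open ℚ.≤-Reasoning
    instance
      _ = ℚ.positive 0<ε
      _ = ℚ.∣-∣-nonNeg (reciprocal q)

  inverse : (x : ℝ) → NonZero x → ℝ
  seq (inverse x _) n = reciprocal (seq x n)
  cauchy (inverse x (ε , 0<ε , M , ε≤)) ξ 0<ξ
    -- `η = 1/ε` bounds the reciprocals. The difference of two of them is their product times a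
    -- difference of terms of `x`, so closeness `δ′ = ξ/η²` is requested of `x`.
    with scale (ℚ.positive⁻¹ 1ℚ) 0<ε
  ... | η , 0<η , εη≡1 with scale 0<ξ 0<η
  ... | δ , 0<δ , ηδ≡ξ with scale 0<δ 0<η
  ... | δ′ , 0<δ′ , ηδ′≡δ with cauchy x δ′ 0<δ′
  ... | N , close = M ℕ.⊔ N , λ m n ≤m ≤n →
    let εₘ = ε≤ m (ℕ.m⊔n≤o⇒m≤o M N ≤m)
        εₙ = ε≤ n (ℕ.m⊔n≤o⇒m≤o M N ≤n)
        a = seq x m
        b = seq x n
    in begin-strict
      ∣ reciprocal a - reciprocal b ∣
        ≡⟨ cong ∣_∣ (difference a b (*-reciprocal (away 0<ε εₘ)) (*-reciprocal (away 0<ε εₙ))) ⟩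
      ∣ reciprocal a * (reciprocal b * (b - a)) ∣
        <⟨ ∣∣*∣∣-< (reciprocal a) (reciprocal b * (b - a)) (∣reciprocal∣-≤ 0<ε εₘ εη≡1) 0<η
             (∣∣*∣∣-< (reciprocal b) (b - a) (∣reciprocal∣-≤ 0<ε εₙ εη≡1) 0<η
               (close n m (ℕ.m⊔n≤o⇒n≤o M N ≤n) (ℕ.m⊔n≤o⇒n≤o M N ≤m))) ⟩
      η * (η * δ′) ≡⟨ trans (cong (η *_) ηδ′≡δ) ηδ≡ξ ⟩
      ξ ∎
    where
    open ℚ.≤-Reasoning
    difference : ∀ a b {a′ b′} → a * a′ ≡ 1ℚ → b * b′ ≡ 1ℚ → a′ - b′ ≡ a′ * (b′ * (b - a))
    difference a b {a′} {b′} aa′ bb′ = trans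
      (sym (cong₂ (λ s t → a′ * s - b′ * t) bb′ aa′ ⟨ trans ⟩
        cong₂ _-_ (ℚ.*-identityʳ a′) (ℚ.*-identityʳ b′)))
      (solve 4 (λ a b a′ b′ → a′ :* (b :* b′) :- b′ :* (a :* a′) := a′ :* (b′ :* (b :- a))) refl
        a b a′ b′)
      where
      open +-*-Solver
      open import Function.Base using (_⟨_⟩_)

  -- `reciprocal` returns 0 at 0, so the product is 1 only from the index on where `x` stays away
  -- from 0. This is why `_≈_` asks for eventual agreement.
  *-inverse : ∀ x (nz : NonZero x) → x *ʳ inverse x nz ≈ constant 1ℚ
  *-inverse x (ε , 0<ε , ε≤) =
    eventually (map₁ (λ _ ε≤ → *-reciprocal (away 0<ε ε≤)) ε≤)

  fromℤ-+ : ∀ a b → fromℤ (a ℤ.+ b) ≡ fromℤ a + fromℤ b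
  fromℤ-+ a b = ℚ.toℚᵘ-injective (ℚᵘ.≃-trans (ℚᵘ.*≡* (eq a b))
    (ℚᵘ.≃-sym (ℚ.toℚᵘ-homo-+ (fromℤ a) (fromℤ b))))
    where
    eq : ∀ a b → (a ℤ.+ b) ℤ.* 1ℤ ≡ (a ℤ.* 1ℤ ℤ.+ b ℤ.* 1ℤ) ℤ.* 1ℤ
    eq = solve-∀

  fromℤ-* : ∀ a b → fromℤ (a ℤ.* b) ≡ fromℤ a * fromℤ b
  fromℤ-* a b = ℚ.toℚᵘ-injective (ℚᵘ.≃-trans (ℚᵘ.*≡* refl)
    (ℚᵘ.≃-sym (ℚ.toℚᵘ-homo-* (fromℤ a) (fromℤ b))))

  NonZero-constant : ∀ {q} → q ≢ 0ℚ → NonZero (constant q)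
  NonZero-constant {q} q≢0 = ∣ q ∣
    , ℚ.≰⇒> (λ ∣q∣≤0 → q≢0 (ℚ.∣p∣≡0⇒p≡0 q (ℚ.≤-antisym ∣q∣≤0 (ℚ.0≤∣p∣ q))))
    , 0 , λ _ _ → ℚ.≤-refl

  fromℤ-≢0 : ∀ {z} → z ≢ 0ℤ → fromℤ z ≢ 0ℚ
  fromℤ-≢0 z≢0 eq = z≢0 (cong ℚ.numerator eq)

  ℝ-coefficientRing : CoefficientRing _ _ _
  ℝ-coefficientRing = record
    { commutativeRing = ℝ-commutativeRing
    ; ι               = λ z → constant (fromℤ z)
    ; ι-0             = termwise λ _ → refl
    ; ι-1             = termwise λ _ → refl
    ; ι-+             = λ a b → termwise λ _ → fromℤ-+ a b
    ; ι-*             = λ a b → termwise λ _ → fromℤ-* a b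
    ; NZ              = NonZero
    ; NZ-resp         = λ {a} {b} → NonZero-resp {a} {b}
    ; NZ-+            = λ {a} {b} → NonZero-+ {a} {b}
    ; NZ-*ˡ           = λ {a} {b} → NonZero-*ˡ {a} {b}
    ; NZ-ι            = λ z≢0 → NonZero-constant (fromℤ-≢0 z≢0)
    ; invert          = λ {a} nz → inverse a nz , *-inverse a nz
    }

-- Edges, incidence and live rows

module Edges where

  open import Data.Bool.Base using (T)
  open import Data.Bool.Properties using (T?)
  open import Data.Fin.Base as Fin using (Fin)
  import Data.Fin.Properties as Fin
  open import Data.Fin.Subset using (Subset; inside; outside; _─_; ⁅_⁆) renaming (_∈_ to _∈ˢ_; _∉_ to _∉ˢ_; _-_ to _∖_)
  open import Data.Fin.Subset.Properties using (_∈?_; x∈p∧x≢y⇒x∈p-y; p─q⊆p; x∈⁅x⁆)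
  open import Data.Integer.Base using (ℤ; +_; 0ℤ; 1ℤ; -1ℤ; _+_; _*_; _-_; -_)
  import Data.Integer.Properties as ℤ
  open import Data.Integer.Tactic.RingSolver using (solve-∀)
  open import Data.List.Base using (List; []; _∷_; mapMaybe; filter; allFin; cartesianProduct)
  open import Data.List.Membership.Propositional using (_∈_; _∉_)
  open import Data.List.Membership.Propositional.Properties
    using (∈-allFin; ∈-cartesianProduct⁺)
  open import Data.List.Relation.Unary.All using (All; []; _∷_)
  open import Data.List.Relation.Unary.AllPairs using ([]; _∷_)
  open import Data.List.Relation.Unary.Any using (here; there)
  open import Data.List.Relation.Unary.Unique.Propositional using (Unique)
  import Data.List.Relation.Unary.Unique.Propositional.Properties as Unique
  open import Data.Maybe.Base using (Maybe; just; nothing)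
  open import Data.Product.Base using (∃-syntax; _×_; _,_)
  open import Data.Sum.Base using (_⊎_; inj₁; inj₂; [_,_]′)
  open import Data.Vec.Base using (_∷_; here; there)
  open import Function.Base using (_∘_)
  open import Relation.Binary using (tri<; tri≈; tri>; DecidableEquality)
  open import Relation.Binary.PropositionalEquality
    using (_≡_; _≢_; refl; sym; trans; cong; cong₂; subst)
  open import Relation.Nullary using (¬_; Dec; yes; no; contradiction)
  open import Relation.Nullary.Decidable using (recompute; _×-dec_; ¬?; map′)
  open import Defs
  open Permanent using (sumOver; Vector; combine)

  private variable
    A B : Set

  Unique-mapMaybe : (f : A → Maybe B) → (∀ {x y z} → f x ≡ just z → f y ≡ just z → x ≡ y) →
                    ∀ xs → Unique xs → Unique (mapMaybe f xs)
  Unique-mapMaybe f inj []       _          = []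
  Unique-mapMaybe f inj (x ∷ xs) (x∉ ∷ uniq) with f x in eq
  ... | nothing = Unique-mapMaybe f inj xs uniq
  ... | just z  = fresh xs x∉ ∷ Unique-mapMaybe f inj xs uniq
    where
    fresh : ∀ ys → All (x ≢_) ys → All (z ≢_) (mapMaybe f ys)
    fresh []       _           = []
    fresh (y ∷ ys) (x≢y ∷ x≢) with f y in eq′
    ... | nothing = fresh ys x≢
    ... | just z′ = (λ { refl → x≢y (inj eq eq′) }) ∷ fresh ys x≢

  ∈-mapMaybe : (f : A → Maybe B) {x : A} {y : B} {xs : List A} →
               x ∈ xs → f x ≡ just y → y ∈ mapMaybe f xs
  ∈-mapMaybe f {x} (here refl) eq with f x | eq
  ... | just _ | refl = here refl
  ∈-mapMaybe f {xs = x′ ∷ _} (there x∈) eq with f x′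
  ... | nothing = ∈-mapMaybe f x∈ eq
  ... | just _  = there (∈-mapMaybe f x∈ eq)

  ∈-─⇒∉ : ∀ {n} {p q : Subset n} {x} → x ∈ˢ p ─ q → x ∉ˢ q
  ∈-─⇒∉ {p = _ ∷ p} {_ ∷ q} (there x∈) (there x∈q) = ∈-─⇒∉ {p = p} {q} x∈ x∈q
  ∈-─⇒∉ {p = inside ∷ p} {inside ∷ q} () here
  ∈-─⇒∉ {p = outside ∷ p} {inside ∷ q} () here

  module _ {n} (G : Graph n) where

    open Edge using (lo; hi)

    Inc : Fin n → Edge G → Set
    Inc = Incident G

    inc? : ∀ v e → Dec (Inc v e)
    inc? = incident? G

    Adj-sym : ∀ {u v} → Adj G u v → Adj G v u
    Adj-sym {u} {v} = subst T (adj-sym G u v)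

    Adj-irrefl : ∀ {u} → ¬ Adj G u u
    Adj-irrefl {u} = subst T (adj-irrefl G u)

    Adj⇒≢ : ∀ {u v} → Adj G u v → u ≢ v
    Adj⇒≢ uv refl = Adj-irrefl uv

    adj? : ∀ u v → Dec (Adj G u v)
    adj? u v = T? (adj G u v)

    -- The proof stored in an edge is irrelevant and is recovered by deciding the relation.
    lo-hi : ∀ (e : Edge G) → lo e Fin.< hi e
    lo-hi (edge l h l<h _) = recompute (l Fin.<? h) l<h

    lo≢hi : ∀ (e : Edge G) → lo e ≢ hi e
    lo≢hi e eq = Fin.<-irrefl eq (lo-hi e)

    adjacent : ∀ (e : Edge G) → Adj G (lo e) (hi e)
    adjacent (edge l h _ lh) = recompute (adj? l h) lh

    edge-≡ : ∀ {e f : Edge G} → lo e ≡ lo f → hi e ≡ hi f → e ≡ f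
    edge-≡ refl refl = refl

    infix 4 _≟_
    _≟_ : DecidableEquality (Edge G)
    e ≟ f = map′ (λ (p , q) → edge-≡ p q) (λ { refl → refl , refl })
      (lo e Fin.≟ lo f ×-dec hi e Fin.≟ hi f)

    edge?-lo-hi : ∀ (e : Edge G) → edge? G (lo e , hi e) ≡ just e
    edge?-lo-hi e with lo e Fin.<? hi e | T? (adj G (lo e) (hi e))
    ... | yes _ | yes _ = refl
    ... | yes _ | no ¬a = contradiction (adjacent e) ¬a
    ... | no ¬< | _     = contradiction (lo-hi e) ¬<

    edge?-ends : ∀ u v {e : Edge G} → edge? G (u , v) ≡ just e → (u , v) ≡ (lo e , hi e)
    edge?-ends u v eq with u Fin.<? v | T? (adj G u v)
    edge?-ends u v refl | yes _ | yes _ = refl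

    edges-complete : ∀ (e : Edge G) → e ∈ edges G
    edges-complete e = ∈-mapMaybe (edge? G)
      (∈-cartesianProduct⁺ (∈-allFin (lo e)) (∈-allFin (hi e))) (edge?-lo-hi e)

    edges-unique : Unique (edges G)
    edges-unique = Unique-mapMaybe (edge? G)
      (λ {(u , v)} {(u′ , v′)} p q → trans (edge?-ends u v p) (sym (edge?-ends u′ v′ q)))
      (cartesianProduct (allFin n) (allFin n))
      (Unique.cartesianProduct⁺ (Unique.allFin⁺ n) (Unique.allFin⁺ n))

    join : ∀ {a b} → Adj G a b → ∃[ e ] (Inc a e × Inc b e)
    join {a} {b} ab with Fin.<-cmp a b
    ... | tri< a<b _ _ = edge a b a<b ab , inj₁ refl , inj₂ refl
    ... | tri≈ _ a≡b _ = contradiction a≡b (Adj⇒≢ ab)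
    ... | tri> _ _ b<a = edge b a b<a (Adj-sym ab) , inj₂ refl , inj₁ refl

    ends : ∀ {a b} e → a ≢ b → Inc a e → Inc b e →
           (a ≡ lo e × b ≡ hi e) ⊎ (a ≡ hi e × b ≡ lo e)
    ends e a≢b (inj₁ p) (inj₁ q) = contradiction (trans p (sym q)) a≢b
    ends e a≢b (inj₁ p) (inj₂ q) = inj₁ (p , q)
    ends e a≢b (inj₂ p) (inj₁ q) = inj₂ (p , q)
    ends e a≢b (inj₂ p) (inj₂ q) = contradiction (trans p (sym q)) a≢b

    two-ends : ∀ {a b c} e → a ≢ b → Inc a e → Inc b e → Inc c e → c ≡ a ⊎ c ≡ b
    two-ends e a≢b ae be ce with ends e a≢b ae be | ce
    ... | inj₁ (p , q) | inj₁ r = inj₁ (trans r (sym p))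
    ... | inj₁ (p , q) | inj₂ r = inj₂ (trans r (sym q))
    ... | inj₂ (p , q) | inj₁ r = inj₂ (trans r (sym q))
    ... | inj₂ (p , q) | inj₂ r = inj₁ (trans r (sym p))

    same-ends : ∀ {a b e f} → a ≢ b → Inc a e → Inc b e → Inc a f → Inc b f → e ≡ f
    same-ends {e = e} {f} a≢b ae be af bf with ends e a≢b ae be | ends f a≢b af bf
    ... | inj₁ (p , q) | inj₁ (r , s) = edge-≡ (trans (sym p) r) (trans (sym q) s)
    ... | inj₂ (p , q) | inj₂ (r , s) = edge-≡ (trans (sym q) s) (trans (sym p) r)
    ... | inj₁ (refl , refl) | inj₂ (r , s) = contradiction (lo-hi e)
      (Fin.<-asym (subst (Fin._< lo e) (sym s) (subst (lo f Fin.<_) (sym r) (lo-hi f))))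
    ... | inj₂ (refl , refl) | inj₁ (r , s) = contradiction (lo-hi e)
      (Fin.<-asym (subst (Fin._< lo e) (sym r) (subst (lo f Fin.<_) (sym s) (lo-hi f))))

    other-end : ∀ {a} e → Inc a e → ∃[ b ] (a ≢ b × Inc b e)
    other-end e (inj₁ refl) = hi e , lo≢hi e , inj₂ refl
    other-end e (inj₂ refl) = lo e , lo≢hi e ∘ sym , inj₁ refl

    ends-adjacent : ∀ {a b} e → a ≢ b → Inc a e → Inc b e → Adj G a b
    ends-adjacent e a≢b ae be with ends e a≢b ae be
    ... | inj₁ (refl , refl) = adjacent e
    ... | inj₂ (refl , refl) = Adj-sym (adjacent e)

    incidence : Edge G → Fin n → ℤ
    incidence e p with inc? p e
    ... | yes _ = 1ℤ
    ... | no  _ = 0ℤ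

    incidence-1 : ∀ {e p} → Inc p e → incidence e p ≡ 1ℤ
    incidence-1 {e} {p} pe with inc? p e
    ... | yes _  = refl
    ... | no ¬pe = contradiction pe ¬pe

    incidence-0 : ∀ {e p} → ¬ Inc p e → incidence e p ≡ 0ℤ
    incidence-0 {e} {p} ¬pe with inc? p e
    ... | yes pe = contradiction pe ¬pe
    ... | no _   = refl

    diff : (Fin n → ℤ) → Edge G → ℤ
    diff φ r = φ (lo r) - φ (hi r)

    -- Row r of the matrix is the form "sum at lo r minus sum at hi r"; this is
    -- the coefficient of the weight of e in it.
    column : Edge G → Edge G → ℤ
    column e = diff (incidence e)

    -- The vertex sums of `v` read as a weighting of the edges. The entries of the combined column
    -- are its differences along the rows, so cancellation can be studied on vertices.
    potential : Vector (Edge G) → Fin n → ℤ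
    potential v p = sumOver (λ (z , e) → z * incidence e p) v

    combine-column : ∀ v r → combine column v r ≡ diff (potential v) r
    combine-column []            r = refl
    combine-column ((z , e) ∷ v) r = trans (cong (_+_ (z * column e r)) (combine-column v r))
      (regroup z (incidence e (lo r)) (incidence e (hi r)) (potential v (lo r)) (potential v (hi r)))
      where
      regroup : ∀ z a b s t → z * (a - b) + (s - t) ≡ (z * a + s) - (z * b + t)
      regroup = solve-∀

    diff-cong : ∀ {φ ψ} r → (∀ {p} → Inc p r → φ p ≡ ψ p) → diff φ r ≡ diff ψ r
    diff-cong r eq = cong₂ _-_ (eq (inj₁ refl)) (eq (inj₂ refl))

    diff-0 : ∀ {φ} r → (∀ {p} → Inc p r → φ p ≡ 0ℤ) → diff φ r ≡ 0ℤ
    diff-0 r eq = cong₂ _-_ (eq (inj₁ refl)) (eq (inj₂ refl))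

    -- The sign `s` records whether `a` is `lo r` or `hi r`; as a unit it does not affect whether an
    -- entry is zero.
    diff-oriented : ∀ {a b} r → a ≢ b → Inc a r → Inc b r →
                    ∃[ s ] ((s ≡ 1ℤ ⊎ s ≡ -1ℤ) × (∀ φ → diff φ r ≡ s * (φ a - φ b)))
    diff-oriented {a} {b} r a≢b ar br with ends r a≢b ar br
    ... | inj₁ (refl , refl) = 1ℤ , inj₁ refl , λ φ → sym (ℤ.*-identityˡ (diff φ r))
    ... | inj₂ (refl , refl) = -1ℤ , inj₂ refl , λ φ → flip-sign (φ (lo r)) (φ (hi r))
      where
      flip-sign : ∀ x y → x - y ≡ -1ℤ * (y - x)
      flip-sign = solve-∀

    Within : Subset n → Edge G → Set
    Within S e = lo e ∈ˢ S × hi e ∈ˢ S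

    within? : ∀ S e → Dec (Within S e)
    within? S e = lo e ∈? S ×-dec hi e ∈? S

    within-ends : ∀ {S e p} → Within S e → Inc p e → p ∈ˢ S
    within-ends (lo∈ , hi∈) (inj₁ refl) = lo∈
    within-ends (lo∈ , hi∈) (inj₂ refl) = hi∈

    within-intro : ∀ {S e} → (∀ {p} → Inc p e → p ∈ˢ S) → Within S e
    within-intro f = f (inj₁ refl) , f (inj₂ refl)

    within-pair : ∀ {S e a b} → a ≢ b → Inc a e → Inc b e → a ∈ˢ S → b ∈ˢ S → Within S e
    within-pair {S} {e} a≢b ae be a∈ b∈ = within-intro {S} {e} λ pe →
      [ (λ { refl → a∈ }) , (λ { refl → b∈ }) ]′ (two-ends e a≢b ae be pe)

    -- e lies in the subgraph induced by S, and not as a component K₂ of it.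
    Live : Subset n → Edge G → Set
    Live S e = Within S e × ∃[ c ] (c ∈ˢ S × ¬ Inc c e × ∃[ p ] (Inc p e × Adj G c p))

    live? : ∀ S e → Dec (Live S e)
    live? S e = within? S e ×-dec Fin.any? λ c → c ∈? S ×-dec ¬? (inc? c e) ×-dec
      Fin.any? λ p → inc? p e ×-dec adj? c p

    rows : Subset n → List (Edge G)
    rows S = filter (live? S) (edges G)

    Live-mono : ∀ {S S′ e} → (∀ {p} → p ∈ˢ S′ → p ∈ˢ S) → Live S′ e → Live S e
    Live-mono sub ((lo∈ , hi∈) , c , c∈ , rest) = (sub lo∈ , sub hi∈) , c , sub c∈ , rest

    -- A different edge through an end of `r` would have its other end as a witness that `r` is
    -- live.
    isolated-unique : ∀ {S r r′ a} → Within S r → ¬ Live S r → Within S r′ → Inc a r → Inc a r′ → r ≡ r′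
    isolated-unique {S} {r} {r′} in-r dead in-r′ ar ar′ with other-end r′ ar′
    ... | b , a≢b , br′ with inc? b r
    ...   | yes br = same-ends a≢b ar br ar′ br′
    ...   | no ¬br = contradiction
      (in-r , b , within-ends {S} {r′} in-r′ br′ , ¬br , _ , ar , Adj-sym (ends-adjacent r′ a≢b ar′ br′)) dead

    ∈-∖∖⁻ : ∀ {S : Subset n} {u v p} → p ∈ˢ S ∖ u ∖ v → p ∈ˢ S × p ≢ u × p ≢ v
    ∈-∖∖⁻ {S} {u} {v} p∈ = p─q⊆p S ⁅ u ⁆ p∈S∖u
      , (λ { refl → ∈-─⇒∉ {p = S} p∈S∖u (x∈⁅x⁆ u) })
      , (λ { refl → ∈-─⇒∉ {p = S ∖ u} p∈ (x∈⁅x⁆ v) })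
      where
      p∈S∖u : _ ∈ˢ S ∖ u
      p∈S∖u = p─q⊆p (S ∖ u) ⁅ v ⁆ p∈

    ∈-∖∖⁺ : ∀ {S : Subset n} {u v p} → p ∈ˢ S → p ≢ u → p ≢ v → p ∈ˢ S ∖ u ∖ v
    ∈-∖∖⁺ p∈ p≢u p≢v = x∈p∧x≢y⇒x∈p-y (x∈p∧x≢y⇒x∈p-y p∈ p≢u) p≢v

-- Good systems of columns and the removal of two vertices

module Elimination where

  open import Data.Fin.Base as Fin using (Fin)
  import Data.Fin.Properties as Fin
  open import Data.Fin.Subset using (Subset) renaming (_∈_ to _∈ˢ_; _-_ to _∖_)
  open import Data.Integer.Base using (ℤ; +_; 0ℤ; 1ℤ; -1ℤ; _+_; _*_; _-_; -_)
  import Data.Integer.Properties as ℤ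
  open import Data.List.Base as List using (List; []; _∷_; _++_; map; filter; length)
  import Data.List.Properties as List
  open import Data.List.Membership.Propositional using (_∈_; _∉_)
  open import Data.List.Membership.Propositional.Properties
    using (∈-filter⁺; ∈-filter⁻; ∈-++⁺ˡ; ∈-++⁺ʳ; ∈-++⁻; ∈-map⁻)
  open import Data.List.Membership.Propositional.Properties.WithK using (unique∧set⇒bag)
  open import Data.List.Relation.Binary.BagAndSetEquality using (∼bag⇒↭)
  open import Data.List.Relation.Binary.Permutation.Propositional using (_↭_)
  open import Data.List.Relation.Binary.Permutation.Propositional.Properties using (↭-length)
  open import Data.List.Relation.Unary.All using (All; []; _∷_)
  import Data.List.Relation.Unary.All as All
  import Data.List.Relation.Unary.All.Properties as All
  open import Data.List.Relation.Unary.AllPairs using ([]; _∷_)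
  open import Data.List.Relation.Unary.Any using (here; there; any?)
  open import Data.List.Relation.Unary.Unique.Propositional using (Unique)
  import Data.List.Relation.Unary.Unique.Propositional.Properties as Unique
  open import Data.Nat.Base as ℕ using (ℕ; suc; _≤_; z≤n; s≤s)
  import Data.Nat.Properties as ℕ
  open import Data.Product.Base using (∃-syntax; _×_; _,_; proj₁; proj₂)
  open import Data.Sum.Base using (_⊎_; inj₁; inj₂; [_,_]′)
  open import Function.Base using (_∘_)
  open import Function.Bundles using (mk⇔)
  open import Relation.Binary.PropositionalEquality
    using (_≡_; _≢_; refl; sym; trans; cong; cong₂; subst)
  open import Relation.Nullary using (¬_; Dec; yes; no; contradiction)
  open import Relation.Nullary.Decidable using (_×-dec_; ¬?)
  open import Relation.Unary using (Decidable)
  open import Defs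
  open Edges
  open Permanent

  unique-↭ : {A : Set} {xs ys : List A} → Unique xs → Unique ys →
             (∀ {x} → x ∈ xs → x ∈ ys) → (∀ {x} → x ∈ ys → x ∈ xs) → xs ↭ ys
  unique-↭ uxs uys to from = ∼bag⇒↭ (unique∧set⇒bag uxs uys (mk⇔ to from))

  firstOr : {A : Set} {P : A → Set} → Decidable P → A → List A → A
  firstOr P? d []       = d
  firstOr P? d (x ∷ xs) with P? x
  ... | yes _ = x
  ... | no  _ = firstOr P? d xs

  firstOr-satisfies : {A : Set} {P : A → Set} (P? : Decidable P) (d : A) {x : A} (xs : List A) →
                      x ∈ xs → P x → P (firstOr P? d xs)
  firstOr-satisfies P? d (y ∷ xs) x∈ px with P? y
  ... | yes py = py
  firstOr-satisfies P? d (y ∷ xs) (here refl) px | no ¬py = contradiction px ¬py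
  firstOr-satisfies P? d (y ∷ xs) (there x∈)  px | no ¬py = firstOr-satisfies P? d xs x∈ px

  module _ {A : Set} {P : A → Set} (P? : Decidable P) where

    count : List A → ℕ
    count xs = length (filter P? xs)

    count-++ : ∀ xs ys → count (xs ++ ys) ≡ count xs ℕ.+ count ys
    count-++ xs ys = trans (cong length (List.filter-++ P? xs ys)) (List.length-++ (filter P? xs))

    count-none : ∀ xs → (∀ {x} → x ∈ xs → ¬ P x) → count xs ≡ 0
    count-none xs none = cong length (List.filter-none P? (All.tabulate none))

    count-≤1 : ∀ {xs} → Unique xs → (∀ {x y} → x ∈ xs → y ∈ xs → P x → P y → x ≡ y) → count xs ≤ 1
    count-≤1 []                     same = z≤n
    count-≤1 {x ∷ xs} (x∉ ∷ uniq) same with P? x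
    ... | yes px = s≤s (ℕ.≤-reflexive (count-none xs λ y∈ py →
                     All.lookup x∉ y∈ (same (here refl) (there y∈) px py)))
    ... | no _   = count-≤1 uniq λ x∈ y∈ → same (there x∈) (there y∈)

  module _ {n} (G : Graph n) where

    private
      E = Edge G

    _∈supp?_ : (x : E) (v : Vector E) → Dec (x ∈ Support v)
    x ∈supp? v = any? (_≟_ G x) (Support v)

    uses : E → List (Vector E) → ℕ
    uses x = count (x ∈supp?_)

    single : E → Vector E
    single e = (1ℤ , e) ∷ []

    difference : E → E → Vector E
    difference e f = (1ℤ , e) ∷ (-1ℤ , f) ∷ []

    potential-single : ∀ e p → potential G (single e) p ≡ incidence G e p
    potential-single e p = trans (ℤ.+-identityʳ _) (ℤ.*-identityˡ (incidence G e p))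

    combine-oriented : ∀ x {y a b i j} (a≢b : a ≢ b) (ay : Inc G a y) (by : Inc G b y) →
      potential G x a ≡ i → potential G x b ≡ j →
      combine (column G) x y ≡ proj₁ (diff-oriented G y a≢b ay by) * (i - j)
    combine-oriented x {y} a≢b ay by i j = trans (combine-column G x y)
      (trans (proj₂ (proj₂ (diff-oriented G y a≢b ay by)) (potential G x))
        (cong (proj₁ (diff-oriented G y a≢b ay by) *_) (cong₂ _-_ i j)))

    columns : List (Vector E) → List (E → ℤ)
    columns = map (combine (column G))

    -- `sparse` counts vectors by their supports, since the expansion of the permanent picks one
    -- edge from each support. `internal` keeps the columns inside `S`, so that their uses never add
    -- to those of edges at vertices removed before. Only live edges are rows: an isolated edge has
    -- a zero row on all edges within `S`.
    record Good (D : ℕ) (S : Subset n) : Set where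
      field
        vectors  : List (Vector E)
        square   : length vectors ≡ length (rows G S)
        regular  : per (rows G S) (columns vectors) ≢ 0ℤ
        sparse   : ∀ x → uses x vectors ≤ D
        internal : ∀ {v x} → v ∈ vectors → x ∈ Support v → Live G S x

    ∈-rows⁺ : ∀ {S e} → Live G S e → e ∈ rows G S
    ∈-rows⁺ {S} {e} = ∈-filter⁺ (live? G S) (edges-complete G e)

    ∈-rows⁻ : ∀ {S e} → e ∈ rows G S → Live G S e
    ∈-rows⁻ {S} e∈ = proj₂ (∈-filter⁻ (live? G S) {xs = edges G} e∈)

    rows-unique : ∀ S → Unique (rows G S)
    rows-unique S = Unique.filter⁺ (live? G S) (edges-unique G)

    good-[] : ∀ {D S} → rows G S ≡ [] → Good D S
    good-[] eq = record
      { vectors  = []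
      ; square   = cong length (sym eq)
      ; regular  = λ per≡0 → 1≢0 (trans (sym (cong (λ rs → per rs []) eq)) per≡0)
      ; sparse   = λ _ → z≤n
      ; internal = λ ()
      }
      where
      1≢0 : 1ℤ ≢ 0ℤ
      1≢0 ()

    -- The columns `C` vanish on the rows of `S′`, so the matrix is block triangular and the
    -- permanents multiply. An edge within `S′` is used only by the smaller system and any other
    -- edge only by `C`; hence both sides may exhaust the bound `D`.
    extend : ∀ {D S S′} (A : List E) (C : List (Vector E)) →
             (∀ {p} → p ∈ˢ S′ → p ∈ˢ S) → rows G S ↭ A ++ rows G S′ →
             length C ≡ length A → per A (columns C) ≢ 0ℤ →
             (∀ {v r} → v ∈ C → r ∈ rows G S′ → combine (column G) v r ≡ 0ℤ) →
             (∀ {v x} → v ∈ C → x ∈ Support v → Live G S x × ¬ Within G S′ x) →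
             (∀ x → uses x C ≤ D) → Good D S′ → Good D S
    extend {D} {S} {S′} A C sub split len nz vanish new few good = record
      { vectors  = C ++ vectors
      ; square   = trans (List.length-++ C) (trans (cong₂ ℕ._+_ len square)
          (sym (trans (↭-length split) (List.length-++ A))))
      ; regular  = λ per≡0 → [ nz , regular ]′ (ℤ.i*j≡0⇒i≡0∨j≡0 (per A (columns C))
          (trans (sym (trans (per-↭ split (columns (C ++ vectors)))
            (trans (cong (per (A ++ rows G S′)) (List.map-++ _ C vectors))
              (per-block A (rows G S′) (columns C) (columns vectors)
                (trans (List.length-map _ C) len)
                (All.map⁺ (All.tabulate λ v∈ {r} r∈ → vanish v∈ r∈))))))
            per≡0))
      ; sparse   = λ x → ℕ.≤-trans (ℕ.≤-reflexive (count-++ (x ∈supp?_) C vectors)) (bound x)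
      ; internal = λ {v} {x} v∈ x∈ → [ (λ v∈C → proj₁ (new v∈C x∈))
          , (λ v∈′ → Live-mono G {S} {S′} {x} sub (internal v∈′ x∈)) ]′ (∈-++⁻ C v∈)
      }
      where
      open Good good
      bound : ∀ x → uses x C ℕ.+ uses x vectors ≤ D
      bound x with within? G S′ x
      ... | yes in′ = ℕ.≤-trans (ℕ.≤-reflexive (cong (ℕ._+ uses x vectors)
            (count-none (x ∈supp?_) C λ v∈ x∈ → proj₂ (new v∈ x∈) in′))) (sparse x)
      ... | no ¬in′ = ℕ.≤-trans (ℕ.≤-reflexive (trans (cong (uses x C ℕ.+_)
            (count-none (x ∈supp?_) vectors λ v∈ x∈ → ¬in′ (proj₁ (internal v∈ x∈))))
            (ℕ.+-identityʳ (uses x C)))) (few x)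

    -- Removing u and v from S.  The rows of S at u or v get the columns C, which
    -- see only u and v; an edge r isolated by the removal gets the column of an
    -- edge g r joining it to u or v.
    module RemovePair {S : Subset n} {u v} (u≢v : u ≢ v) (u∈ : u ∈ˢ S) (v∈ : v ∈ˢ S) where

      S⁻ : Subset n
      S⁻ = S ∖ u ∖ v

      AtPair : E → Set
      AtPair r = Inc G u r ⊎ Inc G v r

      Isolated : E → Set
      Isolated r = Live G S r × Within G S⁻ r × ¬ Live G S⁻ r

      isolated? : Decidable Isolated
      isolated? r = live? G S r ×-dec within? G S⁻ r ×-dec ¬? (live? G S⁻ r)

      isolated : List E
      isolated = filter isolated? (edges G)

      ∈-isolated⁻ : ∀ {r} → r ∈ isolated → Isolated r
      ∈-isolated⁻ r∈ = proj₂ (∈-filter⁻ isolated? {xs = edges G} r∈)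

      isolated-unique′ : Unique isolated
      isolated-unique′ = Unique.filter⁺ isolated? (edges-unique G)

      away : ∀ {r p} → Within G S⁻ r → Inc G p r → p ∈ˢ S × p ≢ u × p ≢ v
      away {r} in⁻ pr = ∈-∖∖⁻ G {S} (within-ends G {S⁻} {r} in⁻ pr)

      not-at-pair : ∀ {r} → Within G S⁻ r → ¬ AtPair r
      not-at-pair {r} in⁻ (inj₁ ur) = proj₁ (proj₂ (away {r} in⁻ ur)) refl
      not-at-pair {r} in⁻ (inj₂ vr) = proj₂ (proj₂ (away {r} in⁻ vr)) refl

      within-or-at-pair : ∀ {r} → Within G S r → AtPair r ⊎ Within G S⁻ r
      within-or-at-pair {r} in-r with inc? G u r | inc? G v r
      ... | yes ur | _      = inj₁ (inj₁ ur)
      ... | no _   | yes vr = inj₁ (inj₂ vr)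
      ... | no ¬ur | no ¬vr = inj₂ (within-intro G {S⁻} {r} λ pr →
        ∈-∖∖⁺ G {S} (within-ends G {S} {r} in-r pr) (λ { refl → ¬ur pr }) (λ { refl → ¬vr pr }))

      Attaches : E → E → Set
      Attaches r x = AtPair x × ∃[ a ] (Inc G a x × Inc G a r)

      -- The vertex that makes `r` live in `S` would still do so in `S⁻`, unless it is `u` or `v`.
      isolated-neighbour : ∀ {r} → Isolated r →
        ∃[ q ] ∃[ p ] ((q ≡ u ⊎ q ≡ v) × Inc G p r × Adj G q p)
      isolated-neighbour {r} ((_ , q , q∈ , ¬qr , p , pr , qp) , in⁻ , dead) with q Fin.≟ u | q Fin.≟ v
      ... | yes q≡u | _       = q , p , inj₁ q≡u , pr , qp
      ... | no _    | yes q≡v = q , p , inj₂ q≡v , pr , qp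
      ... | no q≢u  | no q≢v  = contradiction (in⁻ , q , ∈-∖∖⁺ G q∈ q≢u q≢v , ¬qr , p , pr , qp) dead

      -- Only one end of `x` can lie in `S⁻`, and isolated edges that share a vertex coincide. Hence
      -- distinct isolated rows are served by distinct edges.
      attach-once : ∀ {r r′ x} → Isolated r → Isolated r′ → Attaches r x → Attaches r′ x → r ≡ r′
      attach-once {r} {r′} {x} (_ , in⁻ , dead) (_ , in⁻′ , _) (at , a , ax , ar) (_ , b , bx , br′) =
        isolated-unique G {S⁻} {r} {r′} in⁻ dead in⁻′ ar (subst (λ p → Inc G p r′) (sym a≡b) br′)
        where
        centre : AtPair x → ∃[ q ] (Inc G q x × a ≢ q × b ≢ q)
        centre (inj₁ ux) = u , ux , proj₁ (proj₂ (away {r} in⁻ ar)) , proj₁ (proj₂ (away {r′} in⁻′ br′))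
        centre (inj₂ vx) = v , vx , proj₂ (proj₂ (away {r} in⁻ ar)) , proj₂ (proj₂ (away {r′} in⁻′ br′))
        a≡b : a ≡ b
        a≡b with centre at
        ... | q , qx , a≢q , b≢q with two-ends G x (a≢q ∘ sym) qx ax bx
        ...   | inj₁ b≡q = contradiction b≡q b≢q
        ...   | inj₂ b≡a = sym b≡a

      Dipole : (Fin n → ℤ) → Set
      Dipole φ = ∀ {p} → p ≢ u → p ≢ v → φ p ≡ 0ℤ

      uses-attach : ∀ (g : E → E) → (∀ {r} → r ∈ isolated → Attaches r (g r)) →
                    ∀ x → uses x (map (single ∘ g) isolated) ≤ 1
      uses-attach g att x = ℕ.≤-trans
        (ℕ.≤-reflexive (count-map (x ∈supp?_) isolated))
        (count-≤1 (λ r → x ∈supp? single (g r)) isolated-unique′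
          λ { {r} {r′} r∈ r′∈ (here x≡) (here x≡′) → attach-once {r} {r′} {x} (∈-isolated⁻ r∈) (∈-isolated⁻ r′∈)
            (subst (Attaches r) (sym x≡) (att r∈)) (subst (Attaches r′) (sym x≡′) (att r′∈)) })
        where
        count-map : ∀ {P : Vector E → Set} (P? : Decidable P) rs →
                    count P? (map (single ∘ g) rs) ≡ count (P? ∘ single ∘ g) rs
        count-map P? []       = refl
        count-map P? (r ∷ rs) with P? (single (g r))
        ... | yes _ = cong suc (count-map P? rs)
        ... | no _  = count-map P? rs

      -- There is a second block structure among the rows served here: the dipoles `C` vanish on the
      -- isolated rows, where the columns of `g` form a diagonal matrix. Both kinds of columns
      -- consist of edges at `u` or `v` and therefore share one bound.
      remove : ∀ {D} (R : List E) (C : List (Vector E)) (g : E → E) → Unique R →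
               (∀ {r} → r ∈ R → Live G S r × AtPair r) → (∀ {r} → Within G S r → AtPair r → r ∈ R) →
               length C ≡ length R → per R (columns C) ≢ 0ℤ →
               (∀ {w} → w ∈ C → Dipole (potential G w)) →
               (∀ {w x} → w ∈ C → x ∈ Support w → Live G S x × AtPair x) →
               (∀ {r} → r ∈ isolated → Live G S (g r) × Attaches r (g r)) →
               (∀ x → uses x C ℕ.+ uses x (map (single ∘ g) isolated) ≤ D) →
               Good D S⁻ → Good D S
      remove R C g R-unique R-sound R-complete len nz dipole C-support attach few good =
        extend (R ++ isolated) (C ++ C′) (λ p∈ → proj₁ (∈-∖∖⁻ G {S} {u} {v} p∈)) split
          (trans (List.length-++ C) (trans (cong₂ ℕ._+_ len (List.length-map _ isolated))
            (sym (List.length-++ R))))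
          regular vanish new
          (λ x → ℕ.≤-trans (ℕ.≤-reflexive (count-++ (x ∈supp?_) C C′)) (few x)) good
        where
        C′ : List (Vector E)
        C′ = map (single ∘ g) isolated

        g-col : E → E → ℤ
        g-col r = combine (column G) (single (g r))

        -- g r meets S⁻ only in an end of r.
        g-foreign : ∀ {r r′} → r ∈ isolated → Within G S⁻ r′ → r ≢ r′ → g-col r r′ ≡ 0ℤ
        g-foreign {r} {r′} r∈ in⁻′ r≢r′ with attach r∈ | ∈-isolated⁻ r∈
        ... | _ , at , a , ax , ar | _ , in⁻ , dead = trans (combine-column G (single (g r)) r′)
          (diff-0 G r′ λ {p} pr′ → trans (potential-single (g r) p) (incidence-0 G λ px →
            r≢r′ (isolated-unique G {S⁻} {r} {r′} in⁻ dead in⁻′ ar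
              (subst (λ p → Inc G p r′) (p≡a at px pr′) pr′))))
          where
          p≡a : ∀ {p} → AtPair (g r) → Inc G p (g r) → Inc G p r′ → p ≡ a
          p≡a (inj₁ ux) px pr′ with two-ends G (g r) (proj₁ (proj₂ (away {r} in⁻ ar))) ax ux px
          ... | inj₁ p≡a = p≡a
          ... | inj₂ p≡u = contradiction p≡u (proj₁ (proj₂ (away {r′} in⁻′ pr′)))
          p≡a (inj₂ vx) px pr′ with two-ends G (g r) (proj₂ (proj₂ (away {r} in⁻ ar))) ax vx px
          ... | inj₁ p≡a = p≡a
          ... | inj₂ p≡v = contradiction p≡v (proj₂ (proj₂ (away {r′} in⁻′ pr′)))

        -- Exactly one end of `r` lies on `g r`, so the entry is a sign.
        g-own : ∀ {r} → r ∈ isolated → g-col r r ≢ 0ℤ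
        g-own {r} r∈ eq with attach r∈ | ∈-isolated⁻ r∈
        ... | _ , at , a , ax , ar | _ , in⁻ , dead with other-end G r ar
        ...   | b , a≢b , br with diff-oriented G r a≢b ar br
        ...     | s , s≡±1 , diff≡ = s≢0 s≡±1 (trans (sym one) (trans (sym (combine-column G (single (g r)) r)) eq))
          where
          b∉ : AtPair (g r) → ¬ Inc G b (g r)
          b∉ (inj₁ ux) bx = [ (λ u≡a → proj₁ (proj₂ (away {r} in⁻ ar)) (sym u≡a))
                          , (λ u≡b → proj₁ (proj₂ (away {r} in⁻ br)) (sym u≡b)) ]′ (two-ends G (g r) a≢b ax bx ux)
          b∉ (inj₂ vx) bx = [ (λ v≡a → proj₂ (proj₂ (away {r} in⁻ ar)) (sym v≡a))
                          , (λ v≡b → proj₂ (proj₂ (away {r} in⁻ br)) (sym v≡b)) ]′ (two-ends G (g r) a≢b ax bx vx)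
          one : diff G (potential G (single (g r))) r ≡ s * 1ℤ
          one = trans (diff≡ (potential G (single (g r)))) (cong (s *_) (cong₂ _-_
            (trans (potential-single (g r) a) (incidence-1 G ax)) (trans (potential-single (g r) b) (incidence-0 G (b∉ at)))))
          s≢0 : ∀ {s} → s ≡ 1ℤ ⊎ s ≡ -1ℤ → s * 1ℤ ≢ 0ℤ
          s≢0 (inj₁ refl) ()
          s≢0 (inj₂ refl) ()

        C-vanish : ∀ {w r} → w ∈ C → Within G S⁻ r → combine (column G) w r ≡ 0ℤ
        C-vanish {w} {r} w∈ in⁻ = trans (combine-column G w r) (diff-0 G r λ pr →
          let _ , p≢u , p≢v = away {r} in⁻ pr in dipole w∈ p≢u p≢v)

        regular : per (R ++ isolated) (columns (C ++ C′)) ≢ 0ℤ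
        regular per≡0 = [ nz , per-diagonal g-col isolated isolated-unique′
            (λ r∈ r′∈ → g-foreign r∈ (proj₁ (proj₂ (∈-isolated⁻ r′∈)))) g-own ]′
          (ℤ.i*j≡0⇒i≡0∨j≡0 (per R (columns C))
            (trans (sym (trans (cong (per (R ++ isolated)) (trans (List.map-++ _ C C′)
                (cong (columns C ++_) (sym (List.map-∘ isolated)))))
              (per-block R isolated (columns C) (map g-col isolated)
                (trans (List.length-map _ C) len)
                (All.map⁺ (All.tabulate λ w∈ {r} r∈ → C-vanish {r = r} w∈ (proj₁ (proj₂ (∈-isolated⁻ r∈))))))))
              per≡0))

        vanish : ∀ {w r} → w ∈ C ++ C′ → r ∈ rows G S⁻ → combine (column G) w r ≡ 0ℤ
        vanish {w} {r} w∈ r∈ with ∈-++⁻ C w∈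
        ... | inj₁ w∈C  = C-vanish {r = r} w∈C (proj₁ (∈-rows⁻ r∈))
        ... | inj₂ w∈C′ with ∈-map⁻ (single ∘ g) w∈C′
        ...   | r₀ , r₀∈ , refl = g-foreign {r₀} {r} r₀∈ (proj₁ (∈-rows⁻ r∈))
                λ { refl → proj₂ (proj₂ (∈-isolated⁻ r₀∈)) (∈-rows⁻ r∈) }

        new : ∀ {w x} → w ∈ C ++ C′ → x ∈ Support w → Live G S x × ¬ Within G S⁻ x
        new {w} {x} w∈ x∈ with ∈-++⁻ C w∈
        ... | inj₁ w∈C  = let l , at = C-support w∈C x∈ in l , λ in⁻ → not-at-pair {x} in⁻ at
        ... | inj₂ w∈C′ with ∈-map⁻ (single ∘ g) w∈C′ | x∈
        ...   | r₀ , r₀∈ , refl | here refl = let l , at , _ = attach r₀∈ in l , λ in⁻ → not-at-pair {x} in⁻ at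

        split : rows G S ↭ (R ++ isolated) ++ rows G S⁻
        split = unique-↭ (rows-unique S)
          (Unique.++⁺ (Unique.++⁺ R-unique isolated-unique′ disjoint₁) (rows-unique S⁻) disjoint₂) to from
          where
          disjoint₁ : ∀ {r} → ¬ (r ∈ R × r ∈ isolated)
          disjoint₁ {r} (r∈R , r∈I) = not-at-pair {r} (proj₁ (proj₂ (∈-isolated⁻ r∈I))) (proj₂ (R-sound r∈R))
          disjoint₂ : ∀ {r} → ¬ (r ∈ R ++ isolated × r ∈ rows G S⁻)
          disjoint₂ {r} (r∈ , r∈⁻) with ∈-++⁻ R r∈
          ... | inj₁ r∈R = not-at-pair {r} (proj₁ (∈-rows⁻ r∈⁻)) (proj₂ (R-sound r∈R))
          ... | inj₂ r∈I = proj₂ (proj₂ (∈-isolated⁻ r∈I)) (∈-rows⁻ r∈⁻)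
          to : ∀ {r} → r ∈ rows G S → r ∈ (R ++ isolated) ++ rows G S⁻
          to {r} r∈ with ∈-rows⁻ r∈
          ... | l with within-or-at-pair {r} (proj₁ l) | live? G S⁻ r
          ...   | inj₁ at  | _      = ∈-++⁺ˡ (∈-++⁺ˡ (R-complete (proj₁ l) at))
          ...   | inj₂ in⁻ | yes l⁻ = ∈-++⁺ʳ (R ++ isolated) (∈-rows⁺ l⁻)
          ...   | inj₂ in⁻ | no ¬l⁻ = ∈-++⁺ˡ (∈-++⁺ʳ R (∈-filter⁺ isolated? (edges-complete G r) (l , in⁻ , ¬l⁻)))
          from : ∀ {r} → r ∈ (R ++ isolated) ++ rows G S⁻ → r ∈ rows G S
          from {r} r∈ with ∈-++⁻ (R ++ isolated) r∈
          ... | inj₂ r∈⁻ = ∈-rows⁺ (Live-mono G {S} {S⁻} {r} (λ p∈ → proj₁ (∈-∖∖⁻ G {S} {u} {v} p∈)) (∈-rows⁻ r∈⁻))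
          ... | inj₁ r∈′ with ∈-++⁻ R r∈′
          ...   | inj₁ r∈R = ∈-rows⁺ (proj₁ (R-sound r∈R))
          ...   | inj₂ r∈I = ∈-rows⁺ (proj₁ (∈-isolated⁻ r∈I))

-- Removing a pair at distance 2

module DistantPair where

  open import Data.Empty using (⊥)
  open import Data.Fin.Base as Fin using (Fin)
  import Data.Fin.Properties as Fin
  open import Data.Fin.Subset using (Subset) renaming (_∈_ to _∈ˢ_; _-_ to _∖_)
  open import Data.Fin.Subset.Properties using (_∈?_)
  open import Data.Integer.Base using (ℤ; +_; 0ℤ; 1ℤ; -1ℤ; _+_; _*_; _-_; -_)
  import Data.Integer.Properties as ℤ
  open import Data.List.Base as List using (List; []; _∷_; _++_; map; filter; length; replicate; allFin)
  import Data.List.Properties as List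
  open import Data.List.Membership.Propositional using (_∈_; _∉_; find; lose)
  open import Data.List.Membership.Propositional.Properties
    using (∈-filter⁺; ∈-filter⁻; ∈-++⁺ˡ; ∈-++⁺ʳ; ∈-++⁻; ∈-map⁺; ∈-map⁻; ∈-∃++; ∈-allFin)
  open import Data.List.Relation.Binary.Permutation.Propositional using (_↭_)
  open import Data.List.Relation.Unary.All using (All; []; _∷_; all?)
  import Data.List.Relation.Unary.All as All
  import Data.List.Relation.Unary.All.Properties as All
  open import Data.List.Relation.Unary.AllPairs using ([]; _∷_)
  open import Data.List.Relation.Unary.Any using (here; there; any?; satisfied)
  open import Data.List.Relation.Unary.Unique.Propositional using (Unique)
  import Data.List.Relation.Unary.Unique.Propositional.Properties as Unique
  open import Data.Nat.Base as ℕ using (ℕ; suc; _≤_; _<_; z≤n; s≤s; _!)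
  import Data.Nat.Properties as ℕ
  open import Data.Product.Base using (∃-syntax; _×_; _,_; proj₁; proj₂)
  open import Data.Sum.Base using (_⊎_; inj₁; inj₂; [_,_]′)
  open import Function.Base using (_∘_)
  open import Relation.Binary.PropositionalEquality
    using (_≡_; _≢_; refl; sym; trans; cong; cong₂; subst)
  open import Relation.Nullary using (¬_; Dec; yes; no; contradiction)
  open import Relation.Nullary.Decidable using (_×-dec_; _⊎-dec_; ¬?)
  open import Relation.Unary using (Decidable)
  open import Defs
  open Edges
  open Permanent
  open Elimination

  unique⊆-length : {A : Set} {xs ys : List A} → Unique xs → (∀ {x} → x ∈ xs → x ∈ ys) →
                   length xs ≤ length ys
  unique⊆-length {xs = []}     []           sub = z≤n
  unique⊆-length {xs = x ∷ xs} (x∉ ∷ uniq) sub with ∈-∃++ (sub (here refl))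
  ... | ys₁ , ys₂ , refl = ℕ.≤-trans (s≤s (unique⊆-length uniq sub′))
    (ℕ.≤-reflexive (trans (cong suc (List.length-++ ys₁))
      (trans (sym (ℕ.+-suc (length ys₁) (length ys₂))) (sym (List.length-++ ys₁)))))
    where
    sub′ : ∀ {y} → y ∈ xs → y ∈ ys₁ ++ ys₂
    sub′ y∈ with ∈-++⁻ ys₁ (sub (there y∈))
    ... | inj₁ y∈₁          = ∈-++⁺ˡ y∈₁
    ... | inj₂ (here refl)  = contradiction refl (All.lookup x∉ y∈)
    ... | inj₂ (there y∈₂)  = ∈-++⁺ʳ ys₁ y∈₂

  ∈⇒1≤length : {A : Set} {x : A} {xs : List A} → x ∈ xs → 1 ≤ length xs
  ∈⇒1≤length (here _)  = s≤s z≤n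
  ∈⇒1≤length (there _) = s≤s z≤n

  length≤1 : {A : Set} {xs : List A} {x y : A} → length xs ≤ 1 → x ∈ xs → y ∈ xs → x ≡ y
  length≤1 {xs = _ ∷ []} _ (here refl) (here refl) = refl
  length≤1 {xs = _ ∷ _ ∷ _} (s≤s ()) _ _

  !-≢0 : ∀ k → + (k !) ≢ 0ℤ
  !-≢0 k eq = ℕ.<⇒≢ (ℕ.1≤n! k) (sym (ℤ.+-injective eq))

  module _ {n} (G : Graph n) where

    private
      E = Edge G

    neighbours : Subset n → Fin n → List (Fin n)
    neighbours S p = filter (adj? G p) (elements S)

    deg : Subset n → Fin n → ℕ
    deg S p = length (neighbours S p)

    ∈-elements⁺ : ∀ {S : Subset n} {p} → p ∈ˢ S → p ∈ elements S
    ∈-elements⁺ {S} {p} p∈ = ∈-filter⁺ (_∈? S) (∈-allFin p) p∈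

    ∈-elements⁻ : ∀ {S : Subset n} {p} → p ∈ elements S → p ∈ˢ S
    ∈-elements⁻ {S} p∈ = proj₂ (∈-filter⁻ (_∈? S) {xs = allFin n} p∈)

    ∈-neighbours⁺ : ∀ {S : Subset n} {p q} → q ∈ˢ S → Adj G p q → q ∈ neighbours S p
    ∈-neighbours⁺ {S} {p} q∈ pq = ∈-filter⁺ (adj? G p) (∈-elements⁺ q∈) pq

    ∈-neighbours⁻ : ∀ {S : Subset n} {p q} → q ∈ neighbours S p → q ∈ˢ S × Adj G p q
    ∈-neighbours⁻ {S} {p} q∈ with ∈-filter⁻ (adj? G p) {xs = elements S} q∈
    ... | q∈S , pq = ∈-elements⁻ q∈S , pq

    -- The edge between a and b; d is a junk value for the case that there is none.
    between : E → Fin n → Fin n → E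
    between d a b = firstOr (λ e → inc? G a e ×-dec inc? G b e) d (edges G)

    between-ends : ∀ d {a b} → Adj G a b → Inc G a (between d a b) × Inc G b (between d a b)
    between-ends d {a} {b} ab = let e , ae , be = join G ab in
      firstOr-satisfies (λ e → inc? G a e ×-dec inc? G b e) d (edges G) (edges-complete G e) (ae , be)

    pairRows : Subset n → Fin n → Fin n → List E
    pairRows S u v = filter (λ r → within? G S r ×-dec (inc? G u r ⊎-dec inc? G v r)) (edges G)

    pairRows-unique : ∀ S u v → Unique (pairRows S u v)
    pairRows-unique S u v = Unique.filter⁺ _ (edges-unique G)

    ∈-pairRows⁺ : ∀ {S u v r} → Within G S r → Inc G u r ⊎ Inc G v r → r ∈ pairRows S u v
    ∈-pairRows⁺ {r = r} in-r at = ∈-filter⁺ _ (edges-complete G r) (in-r , at)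

    ∈-pairRows⁻ : ∀ {S u v r} → r ∈ pairRows S u v → Within G S r × (Inc G u r ⊎ Inc G v r)
    ∈-pairRows⁻ r∈ = proj₂ (∈-filter⁻ _ {xs = edges G} r∈)

    -- Every row at `u` or `v` is determined by that vertex and the neighbour at its other end, so
    -- the rows embed into the images of the two neighbour lists.
    pairRows-length : ∀ S u v → length (pairRows S u v) ≤ deg S u ℕ.+ deg S v
    pairRows-length S u v = bound (pairRows S u v) (pairRows-unique S u v) (∈-pairRows⁻ {S} {u} {v})
      where
      bound : ∀ xs → Unique xs → (∀ {r} → r ∈ xs → Within G S r × (Inc G u r ⊎ Inc G v r)) →
              length xs ≤ deg S u ℕ.+ deg S v
      bound []            _    _ = z≤n
      -- The first row serves as the default value of `between`; without rows the bound is trivial.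
      bound xs@(d ∷ _) uniq sound = ℕ.≤-trans (unique⊆-length uniq sub) (ℕ.≤-reflexive
        (trans (List.length-++ (map (between d u) (neighbours S u)))
          (cong₂ ℕ._+_ (List.length-map _ (neighbours S u)) (List.length-map _ (neighbours S v)))))
        where
        from : ∀ {r a} → Within G S r → Inc G a r → r ∈ map (between d a) (neighbours S a)
        from {r} {a} in-r ar with other-end G r ar
        ... | b , a≢b , br = subst (_∈ map (between d a) (neighbours S a))
          (let ab , bb = between-ends d (ends-adjacent G r a≢b ar br) in same-ends G a≢b ab bb ar br)
          (∈-map⁺ (between d a) (∈-neighbours⁺ (within-ends G {S} {r} in-r br) (ends-adjacent G r a≢b ar br)))
        sub : ∀ {r} → r ∈ xs → r ∈ map (between d u) (neighbours S u) ++ map (between d v) (neighbours S v)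
        sub {r} r∈ with sound r∈
        ... | in-r , inj₁ ur = ∈-++⁺ˡ (from {r} in-r ur)
        ... | in-r , inj₂ vr = ∈-++⁺ʳ (map (between d u) (neighbours S u)) (from {r} in-r vr)

    module Dipoles {u v w : Fin n} {e f : E} (u≢v : u ≢ v) (wu : Adj G w u) (wv : Adj G w v)
                   (we : Inc G w e) (ue : Inc G u e) (wf : Inc G w f) (vf : Inc G v f) where

      private
        w≢u = Adj⇒≢ G wu
        w≢v = Adj⇒≢ G wv

        pot : ∀ {p a b} → incidence G e p ≡ a → incidence G f p ≡ b →
              potential G (difference G e f) p ≡ 1ℤ * a + (-1ℤ * b + 0ℤ)
        pot p q = cong₂ (λ a b → 1ℤ * a + (-1ℤ * b + 0ℤ)) p q

      u∉f : ¬ Inc G u f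
      u∉f uf = [ w≢u ∘ sym , u≢v ]′ (two-ends G f w≢v wf vf uf)

      v∉e : ¬ Inc G v e
      v∉e ve = [ w≢v ∘ sym , u≢v ∘ sym ]′ (two-ends G e w≢u we ue ve)

      e≢f : e ≢ f
      e≢f refl = u∉f ue

      at-u : potential G (difference G e f) u ≡ 1ℤ
      at-u = pot (incidence-1 G ue) (incidence-0 G u∉f)

      at-v : potential G (difference G e f) v ≡ -1ℤ
      at-v = pot (incidence-0 G v∉e) (incidence-1 G vf)

      elsewhere : ∀ {p} → p ≢ u → p ≢ v → potential G (difference G e f) p ≡ 0ℤ
      elsewhere {p} p≢u p≢v with p Fin.≟ w
      ... | yes refl = pot (incidence-1 G we) (incidence-1 G wf)
      ... | no p≢w   = pot
        (incidence-0 G λ pe → [ p≢w , p≢u ]′ (two-ends G e w≢u we ue pe))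
        (incidence-0 G λ pf → [ p≢w , p≢v ]′ (two-ends G f w≢v wf vf pf))

      -- The contributions of `e` and `f` cancel at `w`, which leaves the potential 1 at `u`, -1 at
      -- `v` and 0 elsewhere. A row joining `u` and `v` has entry ±2, any other row at one of them
      -- ±1.
      column-≢0 : ∀ {r} → Inc G u r ⊎ Inc G v r → combine (column G) (difference G e f) r ≢ 0ℤ
      column-≢0 {r} at eq = nonzero at (trans (sym (combine-column G (difference G e f) r)) eq)
        where
        φ = potential G (difference G e f)
        sign-≢0 : ∀ {s x} → s ≡ 1ℤ ⊎ s ≡ -1ℤ → x ≢ 0ℤ → s * x ≢ 0ℤ
        sign-≢0 {s} (inj₁ refl) x≢0 eq = [ (λ ()) , x≢0 ]′ (ℤ.i*j≡0⇒i≡0∨j≡0 s eq)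
        sign-≢0 {s} (inj₂ refl) x≢0 eq = [ (λ ()) , x≢0 ]′ (ℤ.i*j≡0⇒i≡0∨j≡0 s eq)
        nonzero : Inc G u r ⊎ Inc G v r → diff G φ r ≢ 0ℤ
        nonzero (inj₁ ur) eq with other-end G r ur
        ... | q , u≢q , qr with diff-oriented G r u≢q ur qr | q Fin.≟ v
        ...   | s , s≡ , d | yes refl = sign-≢0 s≡ (λ ()) (trans (sym (trans (d φ)
                  (cong (s *_) (cong₂ _-_ at-u at-v)))) eq)
        ...   | s , s≡ , d | no q≢v   = sign-≢0 s≡ (λ ()) (trans (sym (trans (d φ)
                  (cong (s *_) (cong₂ _-_ at-u (elsewhere (u≢q ∘ sym) q≢v))))) eq)
        nonzero (inj₂ vr) eq with other-end G r vr
        ... | q , v≢q , qr with diff-oriented G r v≢q vr qr | q Fin.≟ u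
        ...   | s , s≡ , d | yes refl = sign-≢0 s≡ (λ ()) (trans (sym (trans (d φ)
                  (cong (s *_) (cong₂ _-_ at-v at-u)))) eq)
        ...   | s , s≡ , d | no q≢u   = sign-≢0 s≡ (λ ()) (trans (sym (trans (d φ)
                  (cong (s *_) (cong₂ _-_ at-v (elsewhere q≢u (v≢q ∘ sym)))))) eq)

    record FarPair (S : Subset n) (u v w : Fin n) : Set where
      constructor far
      field
        distinct    : u ≢ v
        nonadjacent : ¬ Adj G u v
        u∈ : u ∈ˢ S
        v∈ : v ∈ˢ S
        w∈ : w ∈ˢ S
        wu : Adj G w u
        wv : Adj G w v

    FarPair-sym : ∀ {S u v w} → FarPair S u v w → FarPair S v u w
    FarPair-sym (far d na u∈ v∈ w∈ wu wv) = far (d ∘ sym) (na ∘ Adj-sym G) v∈ u∈ w∈ wv wu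

    -- The path `u w v` provides the witness: `v` if `r` is the edge `uw`, and `w` otherwise.
    far-live : ∀ {S u v w r} → FarPair S u v w → Within G S r → Inc G u r → Live G S r
    far-live {S} {u} {v} {w} {r} (far u≢v ¬uv u∈ v∈ w∈ wu wv) in-r ur with other-end G r ur
    ... | a , u≢a , ar with a Fin.≟ w
    ...   | yes refl = in-r , v , v∈
            , (λ vr → [ u≢v ∘ sym , Adj⇒≢ G wv ∘ sym ]′ (two-ends G r u≢a ur ar vr))
            , w , ar , Adj-sym G wv
    ...   | no a≢w   = in-r , w , w∈
            , (λ wr → [ Adj⇒≢ G wu , a≢w ∘ sym ]′ (two-ends G r u≢a ur ar wr))
            , u , ur , wu

    -- The zeros `c x` and `d y` leave only the two terms in which `d` takes the row `x`, and both
    -- equal `s₁ * s₂ * s₃`. The eight choices of signs are closed by computation.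
    star-permanent : ∀ {s₁ s₂ s₃} → (s₁ ≡ 1ℤ ⊎ s₁ ≡ -1ℤ) → (s₂ ≡ 1ℤ ⊎ s₂ ≡ -1ℤ) → (s₃ ≡ 1ℤ ⊎ s₃ ≡ -1ℤ) →
      (c d : E → ℤ) {x y z : E} → c x ≡ 0ℤ → c y ≡ s₂ * -1ℤ → c z ≡ s₃ * 1ℤ →
      d x ≡ s₁ * -1ℤ → d y ≡ 0ℤ → d z ≡ s₃ * 1ℤ →
      per (x ∷ y ∷ z ∷ []) (c ∷ c ∷ d ∷ []) ≢ 0ℤ
    star-permanent p q r c d cx cy cz dx dy dz = nonzero p q r cx cy cz dx dy dz
      where
      nonzero : ∀ {s₁ s₂ s₃ c₁ c₂ c₃ d₁ d₂ d₃} →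
        (s₁ ≡ 1ℤ ⊎ s₁ ≡ -1ℤ) → (s₂ ≡ 1ℤ ⊎ s₂ ≡ -1ℤ) → (s₃ ≡ 1ℤ ⊎ s₃ ≡ -1ℤ) →
        c₁ ≡ 0ℤ → c₂ ≡ s₂ * -1ℤ → c₃ ≡ s₃ * 1ℤ → d₁ ≡ s₁ * -1ℤ → d₂ ≡ 0ℤ → d₃ ≡ s₃ * 1ℤ →
        c₁ * (c₂ * (d₃ * 1ℤ + 0ℤ) + (c₃ * (d₂ * 1ℤ + 0ℤ) + 0ℤ)) +
          (c₂ * (c₁ * (d₃ * 1ℤ + 0ℤ) + (c₃ * (d₁ * 1ℤ + 0ℤ) + 0ℤ)) +
          (c₃ * (c₁ * (d₂ * 1ℤ + 0ℤ) + (c₂ * (d₁ * 1ℤ + 0ℤ) + 0ℤ)) + 0ℤ)) ≢ 0ℤ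
      nonzero (inj₁ refl) (inj₁ refl) (inj₁ refl) refl refl refl refl refl refl ()
      nonzero (inj₁ refl) (inj₁ refl) (inj₂ refl) refl refl refl refl refl refl ()
      nonzero (inj₁ refl) (inj₂ refl) (inj₁ refl) refl refl refl refl refl refl ()
      nonzero (inj₁ refl) (inj₂ refl) (inj₂ refl) refl refl refl refl refl refl ()
      nonzero (inj₂ refl) (inj₁ refl) (inj₁ refl) refl refl refl refl refl refl ()
      nonzero (inj₂ refl) (inj₁ refl) (inj₂ refl) refl refl refl refl refl refl ()
      nonzero (inj₂ refl) (inj₂ refl) (inj₁ refl) refl refl refl refl refl refl ()
      nonzero (inj₂ refl) (inj₂ refl) (inj₂ refl) refl refl refl refl refl refl ()

    module _ {D S u v w} (pair : FarPair S u v w) (deg≤D : deg S u ℕ.+ deg S v ≤ D) where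

      open FarPair pair
      open RemovePair G {S} distinct u∈ v∈

      private
        w≢u = Adj⇒≢ G wu
        w≢v = Adj⇒≢ G wv
        e   = proj₁ (join G wu)
        we  = proj₁ (proj₂ (join G wu))
        ue  = proj₂ (proj₂ (join G wu))
        f   = proj₁ (join G wv)
        wf  = proj₁ (proj₂ (join G wv))
        vf  = proj₂ (proj₂ (join G wv))
        R   = pairRows S u v

        e-within : Within G S e
        e-within = within-pair G {S} {e} w≢u we ue w∈ u∈

        f-within : Within G S f
        f-within = within-pair G {S} {f} w≢v wf vf w∈ v∈

        e-live : Live G S e
        e-live = far-live {r = e} pair e-within ue

        f-live : Live G S f
        f-live = far-live {r = f} (FarPair-sym pair) f-within vf

      open Dipoles {e = e} {f} distinct wu wv we ue wf vf

      -- A column for the isolated edge r other than those of e and f, which are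
      -- needed for the rows at u and v.
      Candidate : E → E → Set
      Candidate r x = Live G S x × Attaches r x × x ≢ e × x ≢ f

      candidate? : ∀ r → Decidable (Candidate r)
      candidate? r x = live? G S x
        ×-dec ((inc? G u x ⊎-dec inc? G v x) ×-dec Fin.any? λ a → inc? G a x ×-dec inc? G a r)
        ×-dec ¬? (_≟_ G x e) ×-dec ¬? (_≟_ G x f)

      private
        at-pair-live : ∀ {r} → Within G S r → AtPair r → Live G S r
        at-pair-live {r} in-r (inj₁ ur) = far-live {r = r} pair in-r ur
        at-pair-live {r} in-r (inj₂ vr) = far-live {r = r} (FarPair-sym pair) in-r vr

        -- The edge `qp` has the end `p`, which differs from `w`, `u` and `v`, so it is neither `e`
        -- nor `f`.
        candidate : ∀ {q p r} → Within G S⁻ r → q ≡ u ⊎ q ≡ v → Inc G p r → Adj G q p → p ≢ w →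
                    ∃[ x ] Candidate r x
        candidate {q} {p} {r} in⁻ q≡ pr qp p≢w with join G qp | away {r} in⁻ pr | q≡
        ... | x , qx , px | p∈ , p≢u , p≢v | inj₁ refl = x
          , at-pair-live {x} (within-pair G {S} {x} (Adj⇒≢ G qp) qx px u∈ p∈) (inj₁ qx)
          , (inj₁ qx , p , px , pr)
          , (λ { refl → [ p≢w , p≢u ]′ (two-ends G e w≢u we ue px) })
          , (λ { refl → [ p≢w , p≢v ]′ (two-ends G f w≢v wf vf px) })
        ... | x , qx , px | p∈ , p≢u , p≢v | inj₂ refl = x
          , at-pair-live {x} (within-pair G {S} {x} (Adj⇒≢ G qp) qx px v∈ p∈) (inj₂ qx)
          , (inj₂ qx , p , px , pr)
          , (λ { refl → [ p≢w , p≢u ]′ (two-ends G e w≢u we ue px) })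
          , (λ { refl → [ p≢w , p≢v ]′ (two-ends G f w≢v wf vf px) })

      -- One and the same column serves all rows at `u` and `v`. It has no zero entry there, so the
      -- permanent is a factorial times a nonzero product. Thus `e` and `f` are used once per row,
      -- and the degree sum bounds the number of rows.
      remove-far : (∀ {r} → r ∈ isolated → ∃[ x ] Candidate r x) → Good G D S⁻ → Good G D S
      remove-far cand = remove R C g (pairRows-unique S u v)
        (λ {r} r∈ → let in-r , at = ∈-pairRows⁻ {S} {u} {v} r∈ in at-pair-live {r} in-r at , at)
        (λ {r} in-r at → ∈-pairRows⁺ {S} {u} {v} {r} in-r at)
        (List.length-replicate (length R)) nonzero
        (λ {x} x∈ {p} → subst (λ y → p ≢ u → p ≢ v → potential G y p ≡ 0ℤ)
          (sym (∈-replicate x∈)) elsewhere)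
        (λ {x} {y} x∈ y∈ → support (subst (λ z → y ∈ Support z) (∈-replicate x∈) y∈))
        (λ {r} r∈ → let l , at , _ = g-candidate r∈ in l , at)
        few
        where
        C : List (Vector E)
        C = replicate (length R) (difference G e f)

        g : E → E
        g r = firstOr (candidate? r) e (edges G)

        g-candidate : ∀ {r} → r ∈ isolated → Candidate r (g r)
        g-candidate {r} r∈ = let x , cx = cand r∈ in
          firstOr-satisfies (candidate? r) e (edges G) (edges-complete G x) cx

        ∈-replicate : ∀ {A : Set} {m} {x y : A} → y ∈ replicate m x → y ≡ x
        ∈-replicate {m = suc m} (here refl) = refl
        ∈-replicate {m = suc m} (there y∈)  = ∈-replicate y∈

        support : ∀ {x} → x ∈ Support (difference G e f) → Live G S x × AtPair x
        support (here refl)         = e-live , inj₁ ue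
        support (there (here refl)) = f-live , inj₂ vf

        nonzero : per R (columns G C) ≢ 0ℤ
        nonzero per≡0 = [ !-≢0 (length R) , prodOver-≢0 α R (λ {r} r∈ →
            column-≢0 {r} (proj₂ (∈-pairRows⁻ {S} {u} {v} r∈))) ]′
          (ℤ.i*j≡0⇒i≡0∨j≡0 (+ (length R !)) (trans (sym (trans
            (cong (per R) (List.map-replicate _ (length R) (difference G e f)))
            (per-replicate (length R) α R refl))) per≡0))
          where α = combine (column G) (difference G e f)

        R≤D : length R ≤ D
        R≤D = ℕ.≤-trans (pairRows-length S u v) deg≤D

        1≤D : 1 ≤ D
        1≤D = ℕ.≤-trans (∈⇒1≤length (∈-pairRows⁺ {S} {u} {v} {e} e-within (inj₁ ue))) R≤D

        few : ∀ x → uses G x C ℕ.+ uses G x (map (single G ∘ g) isolated) ≤ D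
        few x with _∈supp?_ G x (difference G e f)
        -- `e` and `f` are used for the rows `R` alone, since candidates avoid them.
        ... | yes x∈ = ℕ.≤-trans (ℕ.+-mono-≤ (List.length-filter (λ v → _∈supp?_ G x v) C)
              (ℕ.≤-reflexive (count-none (λ v → _∈supp?_ G x v) (map (single G ∘ g) isolated) unused)))
              (ℕ.≤-trans (ℕ.≤-reflexive (trans (ℕ.+-identityʳ _) (List.length-replicate (length R)))) R≤D)
          where
          other : x ∈ Support (difference G e f) → x ≢ e → x ≢ f → ⊥
          other (here x≡e)         x≢e x≢f = x≢e x≡e
          other (there (here x≡f)) x≢e x≢f = x≢f x≡f
          unused : ∀ {y} → y ∈ map (single G ∘ g) isolated → ¬ x ∈ Support y
          unused y∈ xy with ∈-map⁻ (single G ∘ g) y∈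
          unused y∈ (here x≡) | r , r∈ , refl with g-candidate r∈
          ... | _ , _ , ≢e , ≢f = other x∈ (subst (_≢ e) (sym x≡) ≢e) (subst (_≢ f) (sym x≡) ≢f)
        -- Any other edge is used only as `g r`, and for at most one `r`.
        ... | no x∉  = ℕ.≤-trans (ℕ.≤-reflexive (cong (ℕ._+ uses G x (map (single G ∘ g) isolated))
              (count-none (λ v → _∈supp?_ G x v) C λ y∈ xy → x∉ (subst (λ z → x ∈ Support z) (∈-replicate y∈) xy))))
              (ℕ.≤-trans (uses-attach g (λ r∈ → proj₁ (proj₂ (g-candidate r∈))) x) 1≤D)

      remove-star : (∀ {a b c} → FarPair S a b c → deg S u ℕ.+ deg S v ≤ deg S a ℕ.+ deg S b) →
                    ∀ {r} → r ∈ isolated → ¬ (∃[ x ] Candidate r x) →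
                    Good G D S⁻ → Good G D S
      remove-star least {r} r∈ none = extend G A C
        (λ p∈ → proj₁ (∈-∖∖⁻ G {S} {u} {v} p∈)) split refl nonzero vanish new few
        where
        iso = ∈-isolated⁻ r∈
        in⁻ = proj₁ (proj₂ iso)
        dead = proj₂ (proj₂ iso)

        A : List E
        A = e ∷ f ∷ r ∷ []

        -- In the star each edge vanishes on its own row, and only `D ≥ 2` is available. Taking `e`
        -- twice and `f` once respects this and gives the permanent ±2.
        C : List (Vector E)
        C = single G e ∷ single G e ∷ single G f ∷ []

        p≡w : ∀ {q p} → q ≡ u ⊎ q ≡ v → Inc G p r → Adj G q p → p ≡ w
        p≡w {q} {p} q≡ pr qp with p Fin.≟ w
        ... | yes p≡w = p≡w
        ... | no p≢w  = contradiction (candidate {q} {p} {r} in⁻ q≡ pr qp p≢w) none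

        wr : Inc G w r
        wr = let q , p , q≡ , pr , qp = isolated-neighbour {r} iso in subst (λ p → Inc G p r) (p≡w q≡ pr qp) pr

        b   = proj₁ (other-end G r wr)
        w≢b = proj₁ (proj₂ (other-end G r wr))
        br  = proj₂ (proj₂ (other-end G r wr))
        b-away = away {r} in⁻ br

        b-isolated : ∀ {q} → q ≡ u ⊎ q ≡ v → ¬ Adj G q b
        b-isolated q≡ qb = w≢b (sym (p≡w q≡ br qb))

        -- b is a leaf: its neighbours other than w would keep r alive.
        only-w : ∀ {q} → q ∈ˢ S → Adj G b q → q ≡ w
        only-w {q} q∈ bq = decide (q Fin.≟ u) (q Fin.≟ v) (inc? G q r)
          where
          decide : Dec (q ≡ u) → Dec (q ≡ v) → Dec (Inc G q r) → q ≡ w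
          decide (yes q≡u) _         _        = contradiction (Adj-sym G bq) (b-isolated (inj₁ q≡u))
          decide (no _)    (yes q≡v) _        = contradiction (Adj-sym G bq) (b-isolated (inj₂ q≡v))
          decide (no _)    (no _)    (yes qr) = [ (λ q≡w → q≡w)
            , (λ q≡b → contradiction (sym q≡b) (Adj⇒≢ G bq)) ]′ (two-ends G r w≢b wr br qr)
          decide (no q≢u)  (no q≢v)  (no ¬qr) = contradiction
            (in⁻ , q , ∈-∖∖⁺ G q∈ q≢u q≢v , ¬qr , b , br , Adj-sym G bq) dead

        wb : Adj G w b
        wb = ends-adjacent G r w≢b wr br

        deg-b : deg S b ≤ 1
        deg-b = unique⊆-length {ys = w ∷ []}
          (Unique.filter⁺ (adj? G b) (Unique.filter⁺ (_∈? S) (Unique.allFin⁺ n)))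
          λ q∈ → let q∈S , bq = ∈-neighbours⁻ {S} {b} q∈ in here (only-w q∈S bq)

        -- The leaf `b` may replace `u`: it is at distance 2 from `v` through `w`, so minimality of
        -- the degree sum compares `u` with `b`.
        deg-u : deg S u ≤ 1
        deg-u = ℕ.≤-trans (ℕ.+-cancelʳ-≤ (deg S v) (deg S u) (deg S b) (least {b} {v} {w}
          (far (proj₂ (proj₂ b-away)) (λ bv → b-isolated (inj₂ refl) (Adj-sym G bv))
            (proj₁ b-away) v∈ w∈ wb wv))) deg-b

        deg-v : deg S v ≤ 1
        deg-v = ℕ.≤-trans (ℕ.+-cancelˡ-≤ (deg S u) (deg S v) (deg S b) (least {u} {b} {w}
          (far (proj₁ (proj₂ b-away) ∘ sym) (b-isolated (inj₁ refl)) u∈ (proj₁ b-away) w∈ wu wb))) deg-b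

        leaf-w : ∀ {q p} → q ≡ u ⊎ q ≡ v → p ∈ˢ S → Adj G q p → p ≡ w
        leaf-w (inj₁ refl) p∈ qp = length≤1 deg-u (∈-neighbours⁺ {S} p∈ qp) (∈-neighbours⁺ {S} w∈ (Adj-sym G wu))
        leaf-w (inj₂ refl) p∈ qp = length≤1 deg-v (∈-neighbours⁺ {S} p∈ qp) (∈-neighbours⁺ {S} w∈ (Adj-sym G wv))

        2≤D : 2 ≤ D
        2≤D = ℕ.≤-trans (ℕ.+-mono-≤ (∈⇒1≤length (∈-neighbours⁺ {S} {u} w∈ (Adj-sym G wu)))
                                    (∈⇒1≤length (∈-neighbours⁺ {S} {v} w∈ (Adj-sym G wv)))) deg≤D

        entry : ∀ x {y a b} (a≢b : a ≢ b) (ay : Inc G a y) (by : Inc G b y) {i j} →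
                incidence G x a ≡ i → incidence G x b ≡ j →
                combine (column G) (single G x) y ≡ proj₁ (diff-oriented G y a≢b ay by) * (i - j)
        entry x {y} {a} {b} a≢b ay by i j = combine-oriented G (single G x) a≢b ay by
          (trans (potential-single G x a) i) (trans (potential-single G x b) j)

        b∉e : ¬ Inc G b e
        b∉e be = [ w≢b ∘ sym , proj₁ (proj₂ b-away) ]′ (two-ends G e w≢u we ue be)

        b∉f : ¬ Inc G b f
        b∉f bf = [ w≢b ∘ sym , proj₂ (proj₂ b-away) ]′ (two-ends G f w≢v wf vf bf)

        nonzero : per A (columns G C) ≢ 0ℤ
        nonzero = star-permanent
          (proj₁ (proj₂ (diff-oriented G e (w≢u ∘ sym) ue we)))
          (proj₁ (proj₂ (diff-oriented G f (w≢v ∘ sym) vf wf)))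
          (proj₁ (proj₂ (diff-oriented G r w≢b wr br)))
          (combine (column G) (single G e)) (combine (column G) (single G f)) {e} {f} {r}
          (trans (entry e (w≢u ∘ sym) ue we (incidence-1 G ue) (incidence-1 G we)) (ℤ.*-zeroʳ (proj₁ (diff-oriented G e (w≢u ∘ sym) ue we))))
          (entry e (w≢v ∘ sym) vf wf (incidence-0 G v∉e) (incidence-1 G we))
          (entry e w≢b wr br (incidence-1 G we) (incidence-0 G b∉e))
          (entry f (w≢u ∘ sym) ue we (incidence-0 G u∉f) (incidence-1 G wf))
          (trans (entry f (w≢v ∘ sym) vf wf (incidence-1 G vf) (incidence-1 G wf)) (ℤ.*-zeroʳ (proj₁ (diff-oriented G f (w≢v ∘ sym) vf wf))))
          (entry f w≢b wr br (incidence-1 G wf) (incidence-0 G b∉f))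

        -- `r` contains `w` and is isolated in `S⁻`. The single edges `e` and `f`, unlike their
        -- difference, do not cancel at `w`, so their columns vanish on the rest only because no
        -- live row is left there.
        w-absent : ∀ {r′} → r′ ∈ rows G S⁻ → ¬ Inc G w r′
        w-absent {r′} r′∈ wr′ with isolated-unique G {S⁻} {r} {r′} in⁻ dead (proj₁ (∈-rows⁻ G {S⁻} r′∈)) wr wr′
        ... | refl = dead (∈-rows⁻ G {S⁻} r′∈)

        vanishes : ∀ x {r′} → (∀ {p} → Inc G p r′ → ¬ Inc G p x) → combine (column G) (single G x) r′ ≡ 0ℤ
        vanishes x {r′} foreign = trans (combine-column G (single G x) r′) (diff-0 G r′ λ {p} pr′ →
          trans (potential-single G x p) (incidence-0 G (foreign pr′)))

        e-vanishes : ∀ {r′} → r′ ∈ rows G S⁻ → combine (column G) (single G e) r′ ≡ 0ℤ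
        e-vanishes {r′} r′∈ = vanishes e {r′} λ pr′ pe → [ (λ { refl → w-absent r′∈ pr′ })
          , proj₁ (proj₂ (away {r′} (proj₁ (∈-rows⁻ G {S⁻} r′∈)) pr′)) ]′ (two-ends G e w≢u we ue pe)

        f-vanishes : ∀ {r′} → r′ ∈ rows G S⁻ → combine (column G) (single G f) r′ ≡ 0ℤ
        f-vanishes {r′} r′∈ = vanishes f {r′} λ pr′ pf → [ (λ { refl → w-absent r′∈ pr′ })
          , proj₂ (proj₂ (away {r′} (proj₁ (∈-rows⁻ G {S⁻} r′∈)) pr′)) ]′ (two-ends G f w≢v wf vf pf)

        vanish : ∀ {x r′} → x ∈ C → r′ ∈ rows G S⁻ → combine (column G) x r′ ≡ 0ℤ
        vanish {r′ = r′} (here refl)                 = e-vanishes {r′}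
        vanish {r′ = r′} (there (here refl))         = e-vanishes {r′}
        vanish {r′ = r′} (there (there (here refl))) = f-vanishes {r′}

        e-new : Live G S e × ¬ Within G S⁻ e
        e-new = e-live , λ in⁻ → not-at-pair {e} in⁻ (inj₁ ue)

        f-new : Live G S f × ¬ Within G S⁻ f
        f-new = f-live , λ in⁻ → not-at-pair {f} in⁻ (inj₂ vf)

        new : ∀ {x y} → x ∈ C → y ∈ Support x → Live G S y × ¬ Within G S⁻ y
        new (here refl)                 (here refl) = e-new
        new (there (here refl))         (here refl) = e-new
        new (there (there (here refl))) (here refl) = f-new

        few : ∀ x → uses G x C ≤ D
        few x = ℕ.≤-trans (ℕ.≤-trans (ℕ.≤-reflexive (count-++ (λ v → _∈supp?_ G x v)
            (single G e ∷ single G e ∷ []) (single G f ∷ []))) (bound (_≟_ G x e))) 2≤D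
          where
          bound : Dec (x ≡ e) → uses G x (single G e ∷ single G e ∷ []) ℕ.+ uses G x (single G f ∷ []) ≤ 2
          bound (yes x≡e) = ℕ.+-mono-≤
            (List.length-filter (λ v → _∈supp?_ G x v) (single G e ∷ single G e ∷ []))
            (ℕ.≤-reflexive (count-none (λ v → _∈supp?_ G x v) (single G f ∷ [])
              λ { (here refl) (here x≡f) → e≢f (trans (sym x≡e) x≡f) }))
          bound (no x≢e) = ℕ.+-mono-≤ {_} {0}
            (ℕ.≤-reflexive (count-none (λ v → _∈supp?_ G x v) (single G e ∷ single G e ∷ [])
              λ { (here refl) (here x≡e) → x≢e x≡e ; (there (here refl)) (here x≡e) → x≢e x≡e }))
            (ℕ.≤-trans (List.length-filter (λ v → _∈supp?_ G x v) (single G f ∷ [])) (s≤s z≤n))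

        split : rows G S ↭ A ++ rows G S⁻
        split = unique-↭ (rows-unique G S) unique to from
          where
          e≢r : e ≢ r
          e≢r eq = not-at-pair {r} in⁻ (inj₁ (subst (Inc G u) eq ue))
          f≢r : f ≢ r
          f≢r eq = not-at-pair {r} in⁻ (inj₂ (subst (Inc G v) eq vf))
          unique : Unique (A ++ rows G S⁻)
          unique = (e≢f ∷ e≢r ∷ All.tabulate λ { y∈ refl → proj₂ e-new (proj₁ (∈-rows⁻ G {S⁻} y∈)) })
                 ∷ (f≢r ∷ All.tabulate λ { y∈ refl → proj₂ f-new (proj₁ (∈-rows⁻ G {S⁻} y∈)) })
                 ∷ All.tabulate (λ { y∈ refl → dead (∈-rows⁻ G {S⁻} y∈) })
                 ∷ rows-unique G S⁻
          to : ∀ {y} → y ∈ rows G S → y ∈ A ++ rows G S⁻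
          to {y} y∈ with ∈-rows⁻ G {S} y∈
          ... | l with within-or-at-pair {y} (proj₁ l) | live? G S⁻ y
          ...   | inj₂ in⁻′ | yes l⁻ = there (there (there (∈-rows⁺ G {S⁻} l⁻)))
          -- An isolated row contains a neighbour of `u` or `v`, which can only be `w`, and is
          -- therefore `r`.
          ...   | inj₂ in⁻′ | no ¬l⁻ with isolated-neighbour {y} (l , in⁻′ , ¬l⁻)
          ...     | q , p , q≡ , py , qp = there (there (here (isolated-unique G {S⁻} {y} {r} in⁻′ ¬l⁻ in⁻
                      (subst (λ p → Inc G p y) (leaf-w q≡ (proj₁ (away {y} in⁻′ py)) qp) py) wr)))
          to {y} y∈ | l | inj₁ (inj₁ uy) | _ with other-end G y uy
          ...     | a , u≢a , ay = here (same-ends G w≢u (subst (λ p → Inc G p y)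
                      (leaf-w (inj₁ refl) (within-ends G {S} {y} (proj₁ l) ay) (ends-adjacent G y u≢a uy ay)) ay) uy we ue)
          to {y} y∈ | l | inj₁ (inj₂ vy) | _ with other-end G y vy
          ...     | a , v≢a , ay = there (here (same-ends G w≢v (subst (λ p → Inc G p y)
                      (leaf-w (inj₂ refl) (within-ends G {S} {y} (proj₁ l) ay) (ends-adjacent G y v≢a vy ay)) ay) vy wf vf))
          from : ∀ {y} → y ∈ A ++ rows G S⁻ → y ∈ rows G S
          from (here refl)                 = ∈-rows⁺ G {S} e-live
          from (there (here refl))         = ∈-rows⁺ G {S} f-live
          from (there (there (here refl))) = ∈-rows⁺ G {S} (proj₁ iso)
          from {y} (there (there (there y∈))) = ∈-rows⁺ G {S} (Live-mono G {S} {S⁻} {y}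
            (λ p∈ → proj₁ (∈-∖∖⁻ G {S} {u} {v} p∈)) (∈-rows⁻ G {S⁻} y∈))

      far-good : (∀ {a b c} → FarPair S a b c → deg S u ℕ.+ deg S v ≤ deg S a ℕ.+ deg S b) →
                 Good G D S⁻ → Good G D S
      far-good least with all? (λ r → any? (candidate? r) (edges G)) isolated
      ... | yes all = remove-far λ r∈ → satisfied (All.lookup all r∈)
      ... | no ¬all with find (All.¬All⇒Any¬ (λ r → any? (candidate? r) (edges G)) isolated ¬all)
      ...   | r , r∈ , none = remove-star least r∈ λ (x , cx) → none (lose (edges-complete G x) cx)

-- Removing two vertices of a clique

module Clique where

  open import Data.Fin.Base as Fin using (Fin)
  import Data.Fin.Properties as Fin
  open import Data.Fin.Subset using () renaming (_∈_ to _∈ˢ_; _-_ to _∖_)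
  open import Data.Fin.Subset.Properties using (_∈?_)
  open import Data.Integer.Base using (ℤ; +_; 0ℤ; 1ℤ; -1ℤ; _+_; _*_; _-_; -_)
  import Data.Integer.Properties as ℤ
  open import Data.Integer.Tactic.RingSolver using (solve-∀)
  open import Data.List.Base as List using (List; []; _∷_; _++_; map; filter; length; replicate; allFin)
  import Data.List.Properties as List
  open import Data.List.Membership.Propositional using (_∈_)
  open import Data.List.Membership.Propositional.Properties using (∈-filter⁺; ∈-filter⁻; ∈-allFin; ∈-map⁻)
  open import Data.List.Relation.Binary.Pointwise.Base using (Pointwise; []; _∷_)
  open import Data.List.Relation.Unary.All using (All; []; _∷_)
  import Data.List.Relation.Unary.All as All
  open import Data.List.Relation.Unary.AllPairs using ([]; _∷_)
  open import Data.List.Relation.Unary.Any using (here; there)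
  open import Data.List.Relation.Unary.Unique.Propositional using (Unique)
  import Data.List.Relation.Unary.Unique.Propositional.Properties as Unique
  open import Data.Nat.Base as ℕ using (ℕ; suc; _≤_; z≤n; _!)
  import Data.Nat.Properties as ℕ
  open import Data.Product.Base using (∃-syntax; _×_; _,_; proj₁; proj₂)
  open import Data.Sum.Base using (_⊎_; inj₁; inj₂; [_,_]′)
  open import Function.Base using (_∘_)
  open import Relation.Binary.PropositionalEquality
    using (_≡_; _≢_; refl; sym; trans; cong; cong₂; subst)
  open import Relation.Nullary using (¬_; Dec; yes; no; contradiction)
  open import Relation.Nullary.Decidable using (_×-dec_; ¬?)
  open import Relation.Unary using (Decidable)
  open import Defs
  open Edges
  open Permanent
  open Elimination
  open DistantPair

  module _ {n} (G : Graph n) {D S}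
           (closed : ∀ {a b c} → a ∈ˢ S → b ∈ˢ S → c ∈ˢ S → Adj G a b → Adj G b c → a ≢ c → Adj G a c)
           (2≤D : 2 ≤ D) {u v c : Fin n} {e : Edge G} (u≢v : u ≢ v) (ue : Inc G u e) (ve : Inc G v e)
           (u∈ : u ∈ˢ S) (v∈ : v ∈ˢ S) (c∈ : c ∈ˢ S) (cu : Adj G c u) (cv : Adj G c v) where

    open RemovePair G {S} u≢v u∈ v∈

    private
      E = Edge G

    uv : Adj G u v
    uv = ends-adjacent G e u≢v ue ve

    Common : Fin n → Set
    Common q = q ∈ˢ S × Adj G q u × Adj G q v

    c-common : Common c
    c-common = c∈ , cu , cv

    toᵘ toᵛ : Fin n → E
    toᵘ w = between G e w u
    toᵛ w = between G e w v

    spokes : List (Fin n) → List E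
    spokes []       = []
    spokes (w ∷ ws) = toᵘ w ∷ toᵛ w ∷ spokes ws

    dipole : Fin n → Vector E
    dipole w = difference G (toᵘ w) (toᵛ w)

    doubled : List (Fin n) → List (Vector E)
    doubled []       = []
    doubled (w ∷ ws) = dipole w ∷ dipole w ∷ doubled ws

    W : List (Fin n)
    W = filter (λ q → (q ∈? S ×-dec adj? G q u ×-dec adj? G q v) ×-dec ¬? (q Fin.≟ c)) (allFin n)

    R : List E
    R = e ∷ spokes (c ∷ W)

    -- With a single copy of `e` the permanent would carry the factor `sumOver γ R`, which is 0. The
    -- dipole of `c` appears only once, which keeps a use of `toᵘ c` free for an isolated row.
    C : List (Vector E)
    C = single G e ∷ single G e ∷ dipole c ∷ doubled W

    W-unique : Unique W
    W-unique = Unique.filter⁺ _ (Unique.allFin⁺ n)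

    W-common : ∀ {w} → w ∈ W → Common w
    W-common w∈ = proj₁ (proj₂ (∈-filter⁻ _ {xs = allFin n} w∈))

    c∉W : All (c ≢_) W
    c∉W = All.tabulate λ w∈ c≡w → proj₂ (proj₂ (∈-filter⁻ _ {xs = allFin n} w∈)) (sym c≡w)

    cW-common : ∀ {w} → w ∈ c ∷ W → Common w
    cW-common (here refl) = c-common
    cW-common (there w∈)  = W-common w∈

    cW-complete : ∀ {w} → Common w → w ∈ c ∷ W
    cW-complete {w} cw with w Fin.≟ c
    ... | yes w≡c = here w≡c
    ... | no w≢c  = there (∈-filter⁺ _ (∈-allFin w) (cw , w≢c))

    module Spoke {w} (cw : Common w) where
      w≢u = Adj⇒≢ G (proj₁ (proj₂ cw))
      w≢v = Adj⇒≢ G (proj₂ (proj₂ cw))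
      wᵘ = proj₁ (between-ends G e (proj₁ (proj₂ cw)))
      uᵘ = proj₂ (between-ends G e (proj₁ (proj₂ cw)))
      wᵛ = proj₁ (between-ends G e (proj₂ (proj₂ cw)))
      vᵛ = proj₂ (between-ends G e (proj₂ (proj₂ cw)))
      open Dipoles G {e = toᵘ w} {toᵛ w} u≢v (proj₁ (proj₂ cw)) (proj₂ (proj₂ cw)) wᵘ uᵘ wᵛ vᵛ public

      liveᵘ : Live G S (toᵘ w)
      liveᵘ = within-pair G {S} {toᵘ w} w≢u wᵘ uᵘ (proj₁ cw) u∈ , v , v∈ , v∉e , u , uᵘ , Adj-sym G uv

      liveᵛ : Live G S (toᵛ w)
      liveᵛ = within-pair G {S} {toᵛ w} w≢v wᵛ vᵛ (proj₁ cw) v∈ , u , u∈ , u∉f , v , vᵛ , uv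

      absent : ¬ Inc G w e
      absent we = [ w≢u , w≢v ]′ (two-ends G e u≢v ue ve we)

    e-live : Live G S e
    e-live = within-pair G {S} {e} u≢v ue ve u∈ v∈ , c , c∈ , Spoke.absent c-common , u , ue , cu

    ∈-spokes : ∀ {ws x} → (∀ {w} → w ∈ ws → Common w) → x ∈ spokes ws →
               ∃[ w ] (w ∈ ws × (x ≡ toᵘ w ⊎ x ≡ toᵛ w))
    ∈-spokes {w ∷ ws} common (here x≡)          = w , here refl , inj₁ x≡
    ∈-spokes {w ∷ ws} common (there (here x≡))  = w , here refl , inj₂ x≡
    ∈-spokes {w ∷ ws} common (there (there x∈)) with ∈-spokes (common ∘ there) x∈
    ... | w′ , w′∈ , x≡ = w′ , there w′∈ , x≡

    toᵘ-∈ : ∀ {ws w} → w ∈ ws → toᵘ w ∈ spokes ws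
    toᵘ-∈ (here refl) = here refl
    toᵘ-∈ (there w∈)  = there (there (toᵘ-∈ w∈))

    toᵛ-∈ : ∀ {ws w} → w ∈ ws → toᵛ w ∈ spokes ws
    toᵛ-∈ (here refl) = there (here refl)
    toᵛ-∈ (there w∈)  = there (there (toᵛ-∈ w∈))

    spoke-hub : ∀ {w x} → Common w → x ≡ toᵘ w ⊎ x ≡ toᵛ w → Inc G w x × AtPair x
    spoke-hub cw (inj₁ refl) = Spoke.wᵘ cw , inj₁ (Spoke.uᵘ cw)
    spoke-hub cw (inj₂ refl) = Spoke.wᵛ cw , inj₂ (Spoke.vᵛ cw)

    -- Besides `u` or `v` the edge has just one further end. Hence the dipoles of different common
    -- neighbours share no edge.
    hub-unique : ∀ {w w′ x} → Common w → Common w′ → AtPair x → Inc G w x → Inc G w′ x → w ≡ w′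
    hub-unique {x = x} cw cw′ (inj₁ ux) wx w′x with two-ends G x (Spoke.w≢u cw) wx ux w′x
    ... | inj₁ w′≡w = sym w′≡w
    ... | inj₂ w′≡u = contradiction w′≡u (Spoke.w≢u cw′)
    hub-unique {x = x} cw cw′ (inj₂ vx) wx w′x with two-ends G x (Spoke.w≢v cw) wx vx w′x
    ... | inj₁ w′≡w = sym w′≡w
    ... | inj₂ w′≡v = contradiction w′≡v (Spoke.w≢v cw′)

    spokes-unique : ∀ {ws} → Unique ws → (∀ {w} → w ∈ ws → Common w) → Unique (spokes ws)
    spokes-unique []                      common = []
    spokes-unique {w ∷ ws} (w∉ ∷ uniq) common =
      (Spoke.e≢f cw ∷ All.tabulate (foreign (inj₁ refl))) ∷
      All.tabulate (foreign (inj₂ refl)) ∷ spokes-unique uniq (common ∘ there)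
      where
      cw = common (here refl)
      foreign : ∀ {x y} → x ≡ toᵘ w ⊎ x ≡ toᵛ w → y ∈ spokes ws → x ≢ y
      foreign {x} x≡ y∈ refl with ∈-spokes (common ∘ there) y∈
      ... | w′ , w′∈ , y≡ = All.lookup w∉ w′∈ (hub-unique {x = x} cw (common (there w′∈))
        (proj₂ (spoke-hub cw x≡)) (proj₁ (spoke-hub cw x≡)) (proj₁ (spoke-hub (common (there w′∈)) y≡)))

    R-unique : Unique R
    R-unique = All.tabulate (λ { y∈ refl → let w , w∈ , y≡ = ∈-spokes cW-common y∈ in
        Spoke.absent (cW-common w∈) (proj₁ (spoke-hub (cW-common w∈) y≡)) })
      ∷ spokes-unique (c∉W ∷ W-unique) cW-common

    R-sound : ∀ {r} → r ∈ R → Live G S r × AtPair r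
    R-sound (here refl) = e-live , inj₁ ue
    R-sound (there r∈) with ∈-spokes cW-common r∈
    ... | w , w∈ , inj₁ refl = Spoke.liveᵘ (cW-common w∈) , inj₁ (Spoke.uᵘ (cW-common w∈))
    ... | w , w∈ , inj₂ refl = Spoke.liveᵛ (cW-common w∈) , inj₂ (Spoke.vᵛ (cW-common w∈))

    -- No two vertices of `S` are at distance 2, so the other end of a row at `u` or `v`, if not one
    -- of these, is adjacent to both.
    R-complete : ∀ {r} → Within G S r → AtPair r → r ∈ R
    R-complete {r} in-r (inj₁ ur) with other-end G r ur
    ... | a , u≢a , ar with a Fin.≟ v
    ...   | yes refl = here (same-ends G u≢v ur ar ue ve)
    ...   | no a≢v   = subst (_∈ R) (same-ends G u≢a (Spoke.uᵘ ca) (Spoke.wᵘ ca) ur ar)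
                         (there (toᵘ-∈ (cW-complete ca)))
      where
      a∈ = within-ends G {S} {r} in-r ar
      au = Adj-sym G (ends-adjacent G r u≢a ur ar)
      ca : Common a
      ca = a∈ , au , closed a∈ u∈ v∈ au uv a≢v
    R-complete {r} in-r (inj₂ vr) with other-end G r vr
    ... | a , v≢a , ar with a Fin.≟ u
    ...   | yes refl = here (same-ends G u≢v ar vr ue ve)
    ...   | no a≢u   = subst (_∈ R) (same-ends G v≢a (Spoke.vᵛ ca) (Spoke.wᵛ ca) vr ar)
                         (there (toᵛ-∈ (cW-complete ca)))
      where
      a∈ = within-ends G {S} {r} in-r ar
      av = Adj-sym G (ends-adjacent G r v≢a vr ar)
      ca : Common a
      ca = a∈ , closed a∈ v∈ u∈ av (Adj-sym G uv) a≢u , av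

    ∈-doubled : ∀ {ws x} → x ∈ doubled ws → ∃[ w ] (w ∈ ws × x ≡ dipole w)
    ∈-doubled {w ∷ ws} (here x≡)          = w , here refl , x≡
    ∈-doubled {w ∷ ws} (there (here x≡))  = w , here refl , x≡
    ∈-doubled {w ∷ ws} (there (there x∈)) with ∈-doubled x∈
    ... | w′ , w′∈ , x≡ = w′ , there w′∈ , x≡

    ∈-C : ∀ {x} → x ∈ C → x ≡ single G e ⊎ ∃[ w ] (w ∈ c ∷ W × x ≡ dipole w)
    ∈-C (here x≡)                  = inj₁ x≡
    ∈-C (there (here x≡))          = inj₁ x≡
    ∈-C (there (there (here x≡)))  = inj₂ (c , here refl , x≡)
    ∈-C (there (there (there x∈))) with ∈-doubled x∈
    ... | w , w∈ , x≡ = inj₂ (w , there w∈ , x≡)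

    C-dipole : ∀ {x} → x ∈ C → Dipole (potential G x)
    C-dipole {x} x∈ {p} p≢u p≢v with ∈-C x∈
    ... | inj₁ refl            = trans (potential-single G e p)
      (incidence-0 G λ pe → [ p≢u , p≢v ]′ (two-ends G e u≢v ue ve pe))
    ... | inj₂ (w , w∈ , refl) = Spoke.elsewhere (cW-common w∈) p≢u p≢v

    ∈-dipole : ∀ {w x} → x ∈ Support (dipole w) → x ≡ toᵘ w ⊎ x ≡ toᵛ w
    ∈-dipole (here x≡)         = inj₁ x≡
    ∈-dipole (there (here x≡)) = inj₂ x≡

    C-support : ∀ {x y} → x ∈ C → y ∈ Support x → Live G S y × AtPair y
    C-support {x} x∈ y∈ with ∈-C x∈
    C-support {x} x∈ (here refl) | inj₁ refl = e-live , inj₁ ue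
    C-support {x} x∈ y∈          | inj₂ (w , w∈ , refl) with ∈-dipole y∈
    ... | inj₁ refl = Spoke.liveᵘ (cW-common w∈) , inj₁ (Spoke.uᵘ (cW-common w∈))
    ... | inj₂ refl = Spoke.liveᵛ (cW-common w∈) , inj₂ (Spoke.vᵛ (cW-common w∈))

    α β γ : E → ℤ
    α = combine (column G) (dipole c)
    β = combine (column G) (single G e)
    γ r = incidence G r u - incidence G r v

    -- The potential of a dipole does not depend on `w`. All common neighbours thus realise the same
    -- column by disjoint sets of edges, which spreads its uses.
    dipole-column : ∀ {w} → Common w → ∀ r → combine (column G) (dipole w) r ≡ α r
    dipole-column {w} cw r = trans (combine-column G (dipole w) r)
      (trans (diff-cong G r λ {p} _ → same p) (sym (combine-column G (dipole c) r)))
      where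
      same : ∀ p → potential G (dipole w) p ≡ potential G (dipole c) p
      same p with p Fin.≟ u | p Fin.≟ v
      ... | yes refl | _        = trans (Spoke.at-u cw) (sym (Spoke.at-u c-common))
      ... | no _     | yes refl = trans (Spoke.at-v cw) (sym (Spoke.at-v c-common))
      ... | no p≢u   | no p≢v   = trans (Spoke.elsewhere cw p≢u p≢v) (sym (Spoke.elsewhere c-common p≢u p≢v))

    γ-e : γ e ≡ 0ℤ
    γ-e = cong₂ _-_ (incidence-1 G ue) (incidence-1 G ve)

    γ-toᵘ : ∀ {w} → Common w → γ (toᵘ w) ≡ 1ℤ
    γ-toᵘ cw = cong₂ _-_ (incidence-1 G (Spoke.uᵘ cw)) (incidence-0 G (Spoke.v∉e cw))

    γ-toᵛ : ∀ {w} → Common w → γ (toᵛ w) ≡ -1ℤ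
    γ-toᵛ cw = cong₂ _-_ (incidence-0 G (Spoke.u∉f cw)) (incidence-1 G (Spoke.vᵛ cw))

    -- On a row `wu` the columns `α` and `β` see only `u`, with equal values; on `wv` they see only
    -- `v`, with opposite values; on `uv` the two ends cancel in `β`.
    twisted : ∀ {r} → r ∈ R → β r ≡ γ r * α r
    twisted (here refl) = trans
      (trans (combine-oriented G (single G e) u≢v ue ve
          (trans (potential-single G e u) (incidence-1 G ue)) (trans (potential-single G e v) (incidence-1 G ve)))
        (ℤ.*-zeroʳ (proj₁ (diff-oriented G e u≢v ue ve))))
      (sym (cong (_* α e) γ-e))
    twisted (there r∈) with ∈-spokes cW-common r∈
    ... | w , w∈ , inj₁ refl = trans
      (combine-oriented G (single G e) {toᵘ w} (w≢u ∘ sym) uᵘ wᵘ (trans (potential-single G e u) (incidence-1 G ue))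
        (trans (potential-single G e w) (incidence-0 G absent)))
      (sym (trans (cong₂ _*_ (γ-toᵘ (cW-common w∈))
          (combine-oriented G (dipole c) (w≢u ∘ sym) uᵘ wᵘ (Spoke.at-u c-common) (Spoke.elsewhere c-common w≢u w≢v)))
        (ℤ.*-identityˡ _)))
      where open Spoke (cW-common w∈)
    ... | w , w∈ , inj₂ refl = trans
      (combine-oriented G (single G e) {toᵛ w} (w≢v ∘ sym) vᵛ wᵛ (trans (potential-single G e v) (incidence-1 G ve))
        (trans (potential-single G e w) (incidence-0 G absent)))
      (sym (trans (cong₂ _*_ (γ-toᵛ (cW-common w∈))
          (combine-oriented G (dipole c) (w≢v ∘ sym) vᵛ wᵛ (Spoke.at-v c-common) (Spoke.elsewhere c-common w≢u w≢v)))
        (flip-sign (proj₁ (diff-oriented G (toᵛ w) (w≢v ∘ sym) vᵛ wᵛ)))))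
      where
      open Spoke (cW-common w∈)
      flip-sign : ∀ s → -1ℤ * (s * -1ℤ) ≡ s * 1ℤ
      flip-sign = solve-∀

    sum-γ : ∀ ws → (∀ {w} → w ∈ ws → Common w) → sumOver γ (spokes ws) ≡ 0ℤ
    sum-γ []       common = refl
    sum-γ (w ∷ ws) common = trans (cong₂ (λ a b → a + (b + sumOver γ (spokes ws)))
        (γ-toᵘ (common (here refl))) (γ-toᵛ (common (here refl))))
      (cong (λ z → 1ℤ + (-1ℤ + z)) (sum-γ ws (common ∘ there)))

    sum-γ² : ∀ ws → (∀ {w} → w ∈ ws → Common w) →
             sumOver (λ r → γ r * γ r) (spokes ws) ≡ + length (spokes ws)
    sum-γ² []       common = refl
    sum-γ² (w ∷ ws) common = trans
      (cong₂ (λ a b → a * a + (b * b + sumOver (λ r → γ r * γ r) (spokes ws)))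
        (γ-toᵘ (common (here refl))) (γ-toᵛ (common (here refl))))
      (cong (λ z → 1ℤ + (1ℤ + z)) (sum-γ² ws (common ∘ there)))

    doubled-length : ∀ ws → length (doubled ws) ≡ length (spokes ws)
    doubled-length []       = refl
    doubled-length (w ∷ ws) = cong (suc ∘ suc) (doubled-length ws)

    doubled-columns : ∀ ws → (∀ {w} → w ∈ ws → Common w) →
      Pointwise (λ a b → ∀ r → a r ≡ b r) (columns G (doubled ws)) (replicate (length (spokes ws)) α)
    doubled-columns []       common = []
    doubled-columns (w ∷ ws) common = dipole-column (common (here refl)) ∷
      dipole-column (common (here refl)) ∷ doubled-columns ws (common ∘ there)

    -- The values 1 and -1 of `γ` balance, so its sum is 0, while the sum of the squares is the
    -- number of spokes. The bracket of `per-twisted` is minus this positive number.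
    C-regular : per R (columns G C) ≢ 0ℤ
    C-regular per≡0 = [ (λ eq → [ !-≢0 (suc (length (spokes W))) , prodOver-≢0 α R
        (λ {r} r∈ → Spoke.column-≢0 c-common {r} (proj₂ (R-sound r∈))) ]′
          (ℤ.i*j≡0⇒i≡0∨j≡0 (+ (suc (length (spokes W)) !)) eq)) , (λ ()) ]′
      (ℤ.i*j≡0⇒i≡0∨j≡0 (+ (suc (length (spokes W)) !) * prodOver α R)
        (trans (sym (trans
          (per-cong R {columns G C} {β ∷ β ∷ replicate (suc (length (spokes W))) α}
            ((λ _ → refl) ∷ (λ _ → refl) ∷ (λ _ → refl) ∷ doubled-columns W W-common))
          (trans (per-twisted (suc (length (spokes W))) α β γ R refl λ {r} → twisted {r})
            (cong (+ (suc (length (spokes W)) !) * prodOver α R *_)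
              (cong₂ (λ s t → s * s - t)
                (cong₂ _+_ γ-e (sum-γ (c ∷ W) cW-common))
                (cong₂ _+_ (cong (λ z → z * z) γ-e) (sum-γ² (c ∷ W) cW-common))))))) per≡0))

    -- An isolated edge has an end adjacent to `u` or `v`, which `closed` joins to `c` unless it is
    -- `c`. As `c` survives in `S⁻`, it would keep an edge that avoids it live.
    c-isolated : ∀ {r} → r ∈ isolated → Inc G c r
    c-isolated {r} r∈ with ∈-isolated⁻ r∈ | inc? G c r
    ... | _                  | yes cr = cr
    ... | iso@(_ , in⁻ , dead) | no ¬cr with isolated-neighbour {r} iso
    ...   | q , p , q≡ , pr , qp = contradiction
        (in⁻ , c , ∈-∖∖⁺ G c∈ (Adj⇒≢ G cu) (Adj⇒≢ G cv) , ¬cr , p , pr , cp q≡ qp) dead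
      where
      p∈ = proj₁ (away {r} in⁻ pr)
      c≢p : c ≢ p
      c≢p refl = ¬cr pr
      cp : ∀ {q} → q ≡ u ⊎ q ≡ v → Adj G q p → Adj G c p
      cp (inj₁ refl) qp = closed c∈ u∈ p∈ cu qp c≢p
      cp (inj₂ refl) qp = closed c∈ v∈ p∈ cv qp c≢p

    -- A constant is enough: all isolated edges contain `c`, so there is at most one.
    g : E → E
    g _ = toᵘ c

    g-attaches : ∀ {r} → r ∈ isolated → Live G S (g r) × Attaches r (g r)
    g-attaches r∈ = Spoke.liveᵘ c-common , inj₁ (Spoke.uᵘ c-common) , c , Spoke.wᵘ c-common , c-isolated r∈

    uses-none : ∀ x ws → (∀ {w} → w ∈ ws → ¬ x ∈ Support (dipole w)) → uses G x (doubled ws) ≡ 0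
    uses-none x ws none = count-none (λ v → _∈supp?_ G x v) (doubled ws) λ {y} y∈ xy →
      let w , w∈ , y≡ = ∈-doubled y∈ in none w∈ (subst (λ y → x ∈ Support y) y≡ xy)

    dipole-hub : ∀ {w x} → Common w → x ∈ Support (dipole w) → Inc G w x × AtPair x
    dipole-hub cw x∈ = spoke-hub cw (∈-dipole x∈)

    uses-doubled : ∀ x {ws} → Unique ws → (∀ {w} → w ∈ ws → Common w) → uses G x (doubled ws) ≤ 2
    uses-doubled x []                     common = z≤n
    uses-doubled x {w ∷ ws} (w∉ ∷ uniq) common = ℕ.≤-trans
      (ℕ.≤-reflexive (count-++ (λ v → _∈supp?_ G x v) (dipole w ∷ dipole w ∷ []) (doubled ws))) bound
      where
      bound : uses G x (dipole w ∷ dipole w ∷ []) ℕ.+ uses G x (doubled ws) ≤ 2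
      bound with _∈supp?_ G x (dipole w)
      ... | yes x∈ = ℕ.+-mono-≤ (List.length-filter (λ v → _∈supp?_ G x v) (dipole w ∷ dipole w ∷ []))
            (ℕ.≤-reflexive (uses-none x ws λ w′∈ x∈′ → All.lookup w∉ w′∈
              (hub-unique {x = x} (common (here refl)) (common (there w′∈))
                (proj₂ (dipole-hub (common (here refl)) x∈)) (proj₁ (dipole-hub (common (here refl)) x∈))
                (proj₁ (dipole-hub (common (there w′∈)) x∈′)))))
      ... | no x∉  = ℕ.+-mono-≤ {_} {0} (ℕ.≤-reflexive (count-none (λ v → _∈supp?_ G x v) (dipole w ∷ dipole w ∷ [])
              λ { (here refl) → x∉ ; (there (here refl)) → x∉ }))
            (uses-doubled x uniq (common ∘ there))

    -- The edge `e` is used twice by its own columns; an edge at `c` at most once by `dipole c` and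
    -- at most once as `g r`; any other edge at most twice, by a doubled dipole.
    clique-few : ∀ x → uses G x C ℕ.+ uses G x (map (single G ∘ g) isolated) ≤ D
    clique-few x = ℕ.≤-trans (ℕ.≤-trans (ℕ.≤-reflexive (cong (ℕ._+ rest)
        (trans (count-++ supp? (single G e ∷ single G e ∷ []) (dipole c ∷ doubled W))
          (cong (ofᵉ ℕ.+_) (count-++ supp? (dipole c ∷ []) (doubled W))))))
      (bound (_≟_ G x e) (inc? G c x))) 2≤D
      where
      supp? : Decidable (λ v → x ∈ Support v)
      supp? v = _∈supp?_ G x v
      ofᵉ ofᶜ ofᵂ rest : ℕ
      ofᵉ  = uses G x (single G e ∷ single G e ∷ [])
      ofᶜ  = uses G x (dipole c ∷ [])
      ofᵂ  = uses G x (doubled W)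
      rest = uses G x (map (single G ∘ g) isolated)

      no-e : x ≢ e → ofᵉ ≡ 0
      no-e x≢e = count-none supp? (single G e ∷ single G e ∷ [])
        λ { (here refl) (here x≡e) → x≢e x≡e ; (there (here refl)) (here x≡e) → x≢e x≡e }

      no-c : ¬ Inc G c x → ofᶜ ≡ 0
      no-c ¬cx = count-none supp? (dipole c ∷ []) λ { (here refl) x∈ → ¬cx (proj₁ (dipole-hub c-common x∈)) }

      no-rest : ¬ Inc G c x → rest ≡ 0
      no-rest ¬cx = count-none supp? (map (single G ∘ g) isolated) none
        where
        none : ∀ {y} → y ∈ map (single G ∘ g) isolated → ¬ x ∈ Support y
        none y∈ x∈ with ∈-map⁻ (single G ∘ g) y∈
        none y∈ (here x≡) | _ , _ , refl = ¬cx (subst (Inc G c) (sym x≡) (Spoke.wᵘ c-common))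

      no-W : Inc G c x → ofᵂ ≡ 0
      no-W cx = uses-none x W λ w∈ x∈ → All.lookup c∉W w∈
        (let wx , at = dipole-hub (W-common w∈) x∈ in hub-unique {x = x} c-common (W-common w∈) at cx wx)

      bound : Dec (x ≡ e) → Dec (Inc G c x) → ofᵉ ℕ.+ (ofᶜ ℕ.+ ofᵂ) ℕ.+ rest ≤ 2
      bound (yes x≡e) _ = ℕ.≤-trans
        (ℕ.≤-reflexive (trans (cong₂ (λ a b → ofᵉ ℕ.+ a ℕ.+ b)
          (cong₂ ℕ._+_ (no-c ¬cx) (uses-none x W λ w∈ x∈ →
            Spoke.absent (W-common w∈) (subst (Inc G _) x≡e (proj₁ (dipole-hub (W-common w∈) x∈)))))
          (no-rest ¬cx)) (trans (ℕ.+-identityʳ _) (ℕ.+-identityʳ _))))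
        (List.length-filter supp? (single G e ∷ single G e ∷ []))
        where
        ¬cx : ¬ Inc G c x
        ¬cx cx = Spoke.absent c-common (subst (Inc G c) x≡e cx)
      bound (no x≢e) (yes cx) = ℕ.≤-trans
        (ℕ.≤-reflexive (cong₂ (λ a b → a ℕ.+ (ofᶜ ℕ.+ b) ℕ.+ rest) (no-e x≢e) (no-W cx)))
        (ℕ.+-mono-≤ (ℕ.≤-trans (ℕ.≤-reflexive (ℕ.+-identityʳ ofᶜ)) (List.length-filter supp? (dipole c ∷ [])))
          (uses-attach g (λ r∈ → proj₂ (g-attaches r∈)) x))
      bound (no x≢e) (no ¬cx) = ℕ.≤-trans
        (ℕ.≤-reflexive (trans (cong₂ (λ a b → a ℕ.+ (b ℕ.+ ofᵂ) ℕ.+ rest) (no-e x≢e) (no-c ¬cx))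
          (trans (cong (ofᵂ ℕ.+_) (no-rest ¬cx)) (ℕ.+-identityʳ ofᵂ))))
        (uses-doubled x W-unique W-common)

    clique-good : Good G D S⁻ → Good G D S
    clique-good = remove R C g R-unique R-sound R-complete
      (cong (λ k → suc (suc (suc k))) (doubled-length W)) C-regular C-dipole C-support g-attaches clique-few

-- The parameter ∂₂ and the induction over vertex subsets

module Parameter where

  open import Data.Bool.Base using (Bool; true; false; T)
  open import Data.Bool.Properties using (T?)
  open import Data.Fin.Base using (Fin; zero; suc)
  open import Data.Fin.Subset using (Subset; inside; outside; ∣_∣; ⁅_⁆) renaming (_∈_ to _∈ˢ_; _-_ to _∖_)
  open import Data.Fin.Subset.Properties
    using (_∈?_; ∣⁅x⁆∣≡1; p⊆q⇒∣p∣≤∣q∣; x∈⁅y⁆⇒x≡y; x∈p⇒∣p-x∣<∣p∣; x∈p∧x≢y⇒x∈p-y)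
  open import Data.List.Base
    using (List; []; _∷_; _++_; allFin; cartesianProduct; filter; length; map; mapMaybe; lookup)
  open import Data.List.Membership.Propositional using (_∈_)
  open import Data.List.Membership.Propositional.Properties
    using (∈-filter⁺; ∈-filter⁻; ∈-allFin; ∈-cartesianProduct⁺; ∈-map⁺; ∈-map⁻; ∈-++⁺ˡ; ∈-++⁺ʳ; ∈-lookup)
  open import Data.List.Relation.Unary.All using (All; []; _∷_)
  import Data.List.Relation.Unary.All as All
  import Data.List.Relation.Unary.All.Properties as All
  open import Data.List.Relation.Unary.AllPairs using ([]; _∷_)
  open import Data.List.Relation.Unary.Any using (here; there; index)
  open import Data.List.Relation.Unary.Any.Properties using (lookup-index)
  open import Data.List.Relation.Unary.Unique.Propositional using (Unique)
  import Data.List.Relation.Unary.Unique.Propositional.Properties as Unique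
  open import Data.Maybe.Base using (Maybe; just; nothing; fromMaybe)
  open import Data.Nat.Base as ℕ using (ℕ; zero; suc; _+_; _*_; _≤_; _<_; z≤n; s≤s)
  import Data.Nat.Properties as ℕ
  open import Data.List.Extrema ℕ.≤-totalOrder using (argmin-sel; min≤⊤; min≤xs; xs≤max; ⊥≤max)
  open import Data.Nat.Induction using (<-wellFounded)
  open import Data.Product.Base using (∃-syntax; _×_; _,_; proj₁; proj₂)
  open import Data.Sum.Base using (_⊎_; inj₁; inj₂)
  open import Data.Vec.Base as Vec using (tabulate; []; _∷_)
  import Data.Vec.Properties as Vec
  open import Function.Base using (_∘_; id)
  open import Induction.WellFounded using (Acc; acc)
  open import Relation.Binary.PropositionalEquality
    using (_≡_; _≢_; refl; sym; trans; cong; cong₂; subst; subst₂)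
  open import Relation.Nullary using (¬_; yes; no; contradiction)
  open import Defs
  open Edges
  open Elimination
  open DistantPair
  open Clique

  lookup-injective : {A : Set} {xs : List A} → Unique xs → ∀ i j → lookup xs i ≡ lookup xs j → i ≡ j
  lookup-injective (x∉ ∷ uniq) zero    zero    eq = refl
  lookup-injective (x∉ ∷ uniq) zero    (suc j) eq = contradiction eq (All.lookup x∉ (∈-lookup j))
  lookup-injective (x∉ ∷ uniq) (suc i) zero    eq = contradiction (sym eq) (All.lookup x∉ (∈-lookup i))
  lookup-injective (x∉ ∷ uniq) (suc i) (suc j) eq = cong suc (lookup-injective uniq i j eq)

  -- Links degrees in the renumbered graph `induced G S` to `deg G S`, so that the elimination can
  -- stay with the vertices of `G`.
  ∣tabulate∣ : {A : Set} (f : A → Bool) (xs : List A) →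
               ∣ tabulate (f ∘ lookup xs) ∣ ≡ length (filter (T? ∘ f) xs)
  ∣tabulate∣ f []       = refl
  ∣tabulate∣ f (x ∷ xs) with f x
  ... | true  = cong suc (∣tabulate∣ f xs)
  ... | false = ∣tabulate∣ f xs

  ∈-subsets : ∀ {n} (S : Subset n) → S ∈ subsets n
  ∈-subsets []                = here refl
  ∈-subsets {suc n} (outside ∷ S) = ∈-++⁺ˡ (∈-map⁺ (outside ∷_) (∈-subsets S))
  ∈-subsets {suc n} (inside ∷ S)  = ∈-++⁺ʳ (map (outside ∷_) (subsets n)) (∈-map⁺ (inside ∷_) (∈-subsets S))

  ∈-mapMaybe⁻ : {A B : Set} (f : A → Maybe B) {y : B} (xs : List A) →
                y ∈ mapMaybe f xs → ∃[ x ] (f x ≡ just y)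
  ∈-mapMaybe⁻ f (x ∷ xs) y∈ with f x in eq
  ∈-mapMaybe⁻ f (x ∷ xs) y∈          | nothing = ∈-mapMaybe⁻ f xs y∈
  ∈-mapMaybe⁻ f (x ∷ xs) (here refl) | just _  = x , eq
  ∈-mapMaybe⁻ f (x ∷ xs) (there y∈)  | just _  = ∈-mapMaybe⁻ f xs y∈

  minimum-map : {A : Set} (f : A → ℕ) (xs : List A) →
    (xs ≡ [] × minimum (map f xs) ≡ nothing) ⊎
    ∃[ x ] (x ∈ xs × minimum (map f xs) ≡ just (f x) × (∀ {y} → y ∈ xs → f x ≤ f y))
  minimum-map f []       = inj₁ (refl , refl)
  minimum-map f (x ∷ xs) with argmin-sel id (f x) (map f xs)
  ... | inj₁ eq = inj₂ (x , here refl , cong just eq , least)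
    where
    least : ∀ {y} → y ∈ x ∷ xs → f x ≤ f y
    least (here refl) = ℕ.≤-refl
    least (there y∈)  = subst (_≤ _) eq (All.lookup (min≤xs (f x) (map f xs)) (∈-map⁺ f y∈))
  ... | inj₂ m∈ with ∈-map⁻ f m∈
  ...   | z , z∈ , eq = inj₂ (z , there z∈ , cong just eq , least)
    where
    least : ∀ {y} → y ∈ x ∷ xs → f z ≤ f y
    least (here refl) = subst (_≤ f x) eq (min≤⊤ (f x) (map f xs))
    least (there y∈)  = subst (_≤ _) eq (All.lookup (min≤xs (f x) (map f xs)) (∈-map⁺ f y∈))

  module _ {n} (G : Graph n) where

    module _ (S : Subset n) where

      private
        H = induced G S
        vertex = lookup (elements S)
        pairs = filter (λ (i , j) → distance? H 2 i j)
                  (cartesianProduct (allFin (length (elements S))) (allFin (length (elements S))))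

      elements-unique : Unique (elements S)
      elements-unique = Unique.filter⁺ (_∈? S) (Unique.allFin⁺ n)

      degree-induced : ∀ i → degree H i ≡ deg G S (vertex i)
      degree-induced i = ∣tabulate∣ (adj G (vertex i)) (elements S)

      vertex∈ : ∀ i → vertex i ∈ˢ S
      vertex∈ i = ∈-elements⁻ G (∈-lookup i)

      distance⇒far : ∀ {i j} → Distance H 2 i j → ∃[ k ] FarPair G S (vertex i) (vertex j) k
      distance⇒far {i} {j} ((k , ik , .j , kj , refl) , shortest) = vertex k
        , far (λ eq → shortest (s≤s z≤n) (lookup-injective elements-unique i j eq))
            (λ ij → shortest (s≤s (s≤s z≤n)) (j , ij , refl))
            (vertex∈ i) (vertex∈ j) (vertex∈ k) (Adj-sym G ik) kj

      far⇒distance : ∀ {a b c} → FarPair G S a b c →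
                     ∃[ i ] ∃[ j ] (Distance H 2 i j × vertex i ≡ a × vertex j ≡ b)
      far⇒distance {a} {b} {c} (far a≢b ¬ab a∈ b∈ c∈ ca cb) =
        i , j , ((k , subst₂ (Adj G) i≡ k≡ (Adj-sym G ca) , j , subst₂ (Adj G) k≡ j≡ cb , refl) , shortest)
        , sym i≡ , sym j≡
        where
        i = index (∈-elements⁺ G a∈)
        j = index (∈-elements⁺ G b∈)
        k = index (∈-elements⁺ G c∈)
        i≡ : a ≡ vertex i
        i≡ = lookup-index (∈-elements⁺ G a∈)
        j≡ : b ≡ vertex j
        j≡ = lookup-index (∈-elements⁺ G b∈)
        k≡ : c ≡ vertex k
        k≡ = lookup-index (∈-elements⁺ G c∈)
        shortest : ∀ {m} → m < 2 → ¬ Walk H m i j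
        shortest {zero}        _ i≡j           = a≢b (trans i≡ (trans (cong vertex i≡j) (sym j≡)))
        shortest {suc zero}    _ (_ , ij , refl) = ¬ab (subst₂ (Adj G) (sym i≡) (sym j≡) ij)
        shortest {suc (suc _)} (s≤s (s≤s ())) _

      Closest : Fin n → Fin n → Set
      Closest u v = ∀ {a b c} → FarPair G S a b c → deg G S u + deg G S v ≤ deg G S a + deg G S b

      -- Carries the outcome of `δ₂` from the renumbered graph back to `G`; the alternatives are the
      -- two cases of the elimination.
      analyse : ((∀ {a b c} → ¬ FarPair G S a b c) × δ₂ H ≡ nothing) ⊎
                (∃[ u ] ∃[ v ] ∃[ w ] (FarPair G S u v w × δ₂ H ≡ just (deg G S u + deg G S v) × Closest u v))
      analyse with minimum-map (λ (i , j) → degree H i + degree H j) pairs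
      ... | inj₁ (none , eq) = inj₁ (no-far , eq)
        where
        no-far : ∀ {a b c} → ¬ FarPair G S a b c
        no-far pair with far⇒distance pair
        ... | i , j , d , _ with subst ((i , j) ∈_) none
                (∈-filter⁺ (λ (i , j) → distance? H 2 i j) (∈-cartesianProduct⁺ (∈-allFin i) (∈-allFin j)) d)
        ...   | ()
      ... | inj₂ ((i , j) , ij∈ , eq , least) with distance⇒far {i} {j} (proj₂ (∈-filter⁻ (λ (i , j) → distance? H 2 i j)
                  {xs = cartesianProduct (allFin (length (elements S))) (allFin (length (elements S)))} ij∈))
      ...   | k , pair = inj₂ (vertex i , vertex j , k , pair
              , trans eq (cong just (cong₂ _+_ (degree-induced i) (degree-induced j))) , closest)
        where
        closest : Closest (vertex i) (vertex j)
        closest pair′ with far⇒distance pair′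
        ... | i′ , j′ , d , refl , refl = subst₂ _≤_ (cong₂ _+_ (degree-induced i) (degree-induced j))
          (cong₂ _+_ (degree-induced i′) (degree-induced j′))
          (least (∈-filter⁺ (λ (i , j) → distance? H 2 i j) (∈-cartesianProduct⁺ (∈-allFin i′) (∈-allFin j′)) d))

    δ₂-values : List ℕ
    δ₂-values = mapMaybe (λ S → δ₂ (induced G S)) (subsets n)

    δ₂≤∂₂ : ∀ {S m} → δ₂ (induced G S) ≡ just m → m ≤ ∂₂ G
    δ₂≤∂₂ {S} {m} eq = bound δ₂-values (∈-mapMaybe (λ S → δ₂ (induced G S)) (∈-subsets S) eq)
      where
      bound : ∀ ms → m ∈ ms → m ≤ fromMaybe (2 * Δ G) (maximum ms)
      bound (x ∷ ms) (here refl) = ⊥≤max x ms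
      bound (x ∷ ms) (there m∈)  = All.lookup (xs≤max x ms) m∈

    degree-≥1 : ∀ {u v} → Adj G u v → 1 ≤ degree G u
    degree-≥1 {u} {v} uv = subst (_≤ degree G u) (∣⁅x⁆∣≡1 v) (p⊆q⇒∣p∣≤∣q∣ λ x∈ →
      subst (_∈ˢ tabulate (adj G u)) (sym (x∈⁅y⁆⇒x≡y v x∈))
        (Vec.lookup⇒[]= v (tabulate (adj G u)) (trans (Vec.lookup∘tabulate (adj G u) v) (T⇒true uv))))
      where
      T⇒true : ∀ {b} → T b → b ≡ true
      T⇒true {true} _ = refl

    deg-≥1 : ∀ {S u v} → v ∈ˢ S → Adj G u v → 1 ≤ deg G S u
    deg-≥1 {S} {u} v∈ uv = ∈⇒1≤length (∈-neighbours⁺ G {S} v∈ uv)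

    -- Without pairs at distance 2 the convention gives `2 * Δ G`. Otherwise each value of `δ₂` is a
    -- degree sum of two vertices with a common neighbour, so both degrees are positive.
    2≤∂₂ : ∀ {u v} → Adj G u v → 2 ≤ ∂₂ G
    2≤∂₂ {u} {v} uv with δ₂-values in eq
    ... | []     = ℕ.*-monoʳ-≤ 2 (ℕ.≤-trans (degree-≥1 uv)
                     (All.lookup (xs≤max 0 (map (degree G) (allFin n))) (∈-map⁺ (degree G) (∈-allFin u))))
    ... | m ∷ ms = ℕ.≤-trans 2≤m (⊥≤max m ms)
      where
      2≤m : 2 ≤ m
      2≤m with ∈-mapMaybe⁻ (λ S → δ₂ (induced G S)) (subsets n) (subst (m ∈_) (sym eq) (here refl))
      ... | S , eq′ with analyse S
      ...   | inj₁ (_ , none) with trans (sym none) eq′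
      ...     | ()
      2≤m | S , eq′ | inj₂ (a , b , c , far _ _ _ _ c∈ ca cb , eq″ , _) with trans (sym eq″) eq′
      ...     | refl = ℕ.+-mono-≤ (deg-≥1 {S} c∈ (Adj-sym G ca)) (deg-≥1 {S} c∈ (Adj-sym G cb))

    ∖∖-smaller : ∀ {S : Subset n} {u v} → u ≢ v → u ∈ˢ S → v ∈ˢ S → ∣ S ∖ u ∖ v ∣ < ∣ S ∣
    ∖∖-smaller {S} {u} {v} u≢v u∈ v∈ = ℕ.<-trans
      (x∈p⇒∣p-x∣<∣p∣ (x∈p∧x≢y⇒x∈p-y v∈ (u≢v ∘ sym))) (x∈p⇒∣p-x∣<∣p∣ u∈)

    good : ∀ S → Good G (∂₂ G) S
    good S = go S (<-wellFounded ∣ S ∣)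
      where
      go : ∀ S → Acc _<_ ∣ S ∣ → Good G (∂₂ G) S
      go S (acc rec) with analyse S
      ... | inj₂ (u , v , w , pair@(far distinct _ u∈ v∈ _ _ _) , eq , closest) = far-good G pair (δ₂≤∂₂ {S} eq) closest
        (go (S ∖ u ∖ v) (rec (∖∖-smaller {S} distinct u∈ v∈)))
      ... | inj₁ (no-far , _) with rows G S in eq
      ...   | []    = good-[] G {S = S} eq
      -- In a union of cliques the witness that `r` is live is adjacent to both ends of `r`, which
      -- supplies the common neighbour for `clique-good`.
      ...   | r ∷ _ with ∈-rows⁻ G {S} (subst (r ∈_) (sym eq) (here refl))
      ...     | (lo∈ , hi∈) , c , c∈ , ¬cr , p , pr , cp =
        clique-good G {S = S} closed (2≤∂₂ cp) {e = r} (lo≢hi G r) (inj₁ refl) (inj₂ refl) lo∈ hi∈ c∈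
          (proj₁ (both pr)) (proj₂ (both pr)) (go _ (rec (∖∖-smaller {S} (lo≢hi G r) lo∈ hi∈)))
        where
        closed : ∀ {a b c} → a ∈ˢ S → b ∈ˢ S → c ∈ˢ S → Adj G a b → Adj G b c → a ≢ c → Adj G a c
        closed {a} {b} {c} a∈ b∈ c∈ ab bc a≢c with adj? G a c
        ... | yes ac = ac
        ... | no ¬ac = contradiction (far a≢c ¬ac a∈ c∈ b∈ (Adj-sym G ab) bc) no-far
        both : Inc G p r → Adj G c (Edge.lo r) × Adj G c (Edge.hi r)
        both (inj₁ refl) = cp , closed c∈ lo∈ hi∈ cp (adjacent G r) λ { refl → ¬cr (inj₂ refl) }
        both (inj₂ refl) = closed c∈ hi∈ lo∈ cp (Adj-sym G (adjacent G r)) (λ { refl → ¬cr (inj₁ refl) }) , cp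

-- From a good system to edge weights

module Weighting {c ℓ p} (R : CoefficientRing c ℓ p) where

  open import Data.Fin.Base using (Fin)
  import Data.Fin.Properties as Fin
  open import Data.List.Base as List using (List; []; _∷_; length; map; lookup)
  import Data.List.Properties as List
  open import Data.List.Membership.Propositional using (_∈_)
  open import Data.List.Relation.Binary.Pointwise.Base using (Pointwise; []; _∷_)
  open import Data.List.Relation.Unary.Any using (index)
  open import Data.List.Relation.Unary.Any.Properties using (lookup-index)
  open import Data.Nat.Base as ℕ using (ℕ; _≤_; _<_; s≤s)
  import Data.Nat.Properties as ℕ
  open import Data.Product.Base using (∃-syntax; _×_; _,_; proj₁; proj₂)
  import Data.Vec.Base as Vec
  import Data.Vec.Properties as Vec
  open import Relation.Binary.PropositionalEquality as ≡ using (_≡_)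
  open import Relation.Nullary using (yes; no; contradiction)
  open import Defs using (Graph; Edge; edges; edgesAt)
  open Permanent using (per; per-expand; Support)
  open Edges
  open Elimination using (Good; uses; _∈supp?_)
  open Parameter using (lookup-injective)
  open Nullstellensatz R
  open CoefficientRing R

  module _ {n} (G : Graph n) where

    open Edge using (lo; hi)

    variableOf : Edge G → Fin (length (edges G))
    variableOf e = index (edges-complete G e)

    lookup-variableOf : ∀ e → lookup (edges G) (variableOf e) ≡ e
    lookup-variableOf e = ≡.sym (lookup-index (edges-complete G e))

    variableOf-lookup : ∀ i → variableOf (lookup (edges G) i) ≡ i
    variableOf-lookup i = lookup-injective (edges-unique G) _ i (lookup-variableOf (lookup (edges G) i))

    -- Each vector contributes a single edge, and one of its own support, so an edge is chosen at
    -- most as often as it occurs in supports.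
    counts≤uses : ∀ {es vs} → Pointwise (λ e v → e ∈ Support v) es vs → ∀ i →
                  Vec.lookup (counts (map variableOf es)) i ≤ uses G (lookup (edges G) i) vs
    counts≤uses []                   i = ℕ.≤-reflexive (Vec.lookup-replicate i 0)
    counts≤uses {e ∷ es} {v ∷ vs} (e∈ ∷ es∈) i with i Fin.≟ variableOf e | _∈supp?_ G (lookup (edges G) i) v
    ... | yes ≡.refl | yes _ = ℕ.≤-trans (ℕ.≤-reflexive (Vec.lookup∘updateAt i (counts (map variableOf es))))
                                 (s≤s (counts≤uses es∈ i))
    ... | yes ≡.refl | no ∉v = contradiction (≡.subst (_∈ Support v) (≡.sym (lookup-variableOf e)) e∈) ∉v
    ... | no i≢      | yes _ = ℕ.≤-trans (ℕ.≤-reflexive (Vec.lookup∘updateAt′ i _ i≢ (counts (map variableOf es))))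
                                 (ℕ.m≤n⇒m≤1+n (counts≤uses es∈ i))
    ... | no i≢      | no _  = ℕ.≤-trans (ℕ.≤-reflexive (Vec.lookup∘updateAt′ i _ i≢ (counts (map variableOf es))))
                                 (counts≤uses es∈ i)

    total : (Fin n → Carrier) → (Edge G → Carrier) → Fin n → Carrier
    total wⱽ wᴱ v = wⱽ v + ∑ˡ wᴱ (edgesAt G v)

    choose-weights : ∀ {D S} → Good G D S → (wⱽ : Fin n → Carrier)
      (value : Edge G → ℕ → Carrier) → (∀ e i j → i < j → j ≤ D → NZ (value e j - value e i)) →
      ∃[ τ ] ((∀ e → τ e ≤ D) × (∀ {r} → r ∈ rows G S →
        NZ (total wⱽ (λ e → value e (τ e)) (lo r) - total wⱽ (λ e → value e (τ e)) (hi r))))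
    choose-weights {D} {S} good wⱽ value separated with per-expand (column G) (rows G S) (Good.vectors good) (Good.regular good)
    ... | es , es∈ , nz with nullstellensatz D (λ i → value (lookup (edges G) i)) (λ i o j → proj₁ (gap (lookup (edges G) i) o j))
            -- The vertex weights enter as the constant terms `κ`, which may be arbitrary.
            (λ i o j → proj₂ (gap (lookup (edges G) i) o j)) (λ r → wⱽ (lo r) - wⱽ (hi r)) (λ i → column G (lookup (edges G) i))
            (rows G S) (map variableOf es)
            (≡.trans (≡.sym (Good.square good))
              (≡.trans (≡.sym (Pointwise-length es∈)) (≡.sym (List.length-map variableOf es))))
            (λ per≡0 → nz (≡.trans (≡.cong (per (rows G S)) (≡.sym columns≡)) per≡0))
            (λ i → ℕ.≤-trans (counts≤uses es∈ i) (Good.sparse good (lookup (edges G) i)))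
      where
      open import Data.List.Relation.Binary.Pointwise using (Pointwise-length)
      gap : ∀ e i j → ∃[ b ] (i < j → j ≤ D → (value e j - value e i) * b ≈ 1#)
      gap e i j with i ℕ.<? j | j ℕ.≤? D
      ... | yes i<j | yes j≤D = let b , eq = invert (separated e i j i<j j≤D) in b , λ _ _ → eq
      -- Outside the range `i < j ≤ D` the value 0 is a dummy inverse of which nothing is required.
      ... | no i≮j  | _       = 0# , λ i<j _ → contradiction i<j i≮j
      ... | yes _   | no j≰D  = 0# , λ _ j≤D → contradiction j≤D j≰D
      columns≡ : map (λ i → column G (lookup (edges G) i)) (map variableOf es) ≡ map (column G) es
      columns≡ = ≡.trans (≡.sym (List.map-∘ es)) (List.map-cong (λ e → ≡.cong (column G) (lookup-variableOf e)) es)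
    ...   | σ , σ≤D , nonzero = τ , (λ e → σ≤D (variableOf e)) , λ {r} r∈ → NZ-resp (difference r) (nonzero r∈)
      where
      τ : Edge G → ℕ
      τ e = Vec.lookup σ (variableOf e)
      difference : ∀ r → (wⱽ (lo r) - wⱽ (hi r)) + ∑ (λ i → ι (column G (lookup (edges G) i) r) * value (lookup (edges G) i) (Vec.lookup σ i))
                       ≈ total wⱽ (λ e → value e (τ e)) (lo r) - total wⱽ (λ e → value e (τ e)) (hi r)
      difference r = sym (trans
        (filter-difference (inc? G (lo r)) (inc? G (hi r)) (λ e → incidence G e (lo r)) (λ e → incidence G e (hi r))
          (λ {e} → incidence-1 G {e}) (λ {e} → incidence-0 G {e})
          (λ {e} → incidence-1 G {e}) (λ {e} → incidence-0 G {e}) (wⱽ (lo r)) (wⱽ (hi r)) _ (edges G))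
        (+-congˡ (∑-cong λ i → *-congˡ (reflexive
          (≡.cong (λ k → value (lookup (edges G) i) (Vec.lookup σ k)) (variableOf-lookup i))))))

-- Nice graphs and the choice from lists of reals

open import Data.Nat.Base using (ℕ; _+_)
open import Defs

open import Data.Bool.Base using (true)
open import Data.Bool.Properties using (T-≡)
open import Data.Fin.Base as Fin using (Fin; zero; suc; fromℕ<)
import Data.Fin.Properties as Fin
open import Data.Fin.Subset using (Subset; ⊤; ⁅_⁆; _∪_) renaming (_∈_ to _∈ˢ_)
open import Data.Fin.Subset.Properties using (∈⊤; x∈p∪q⁻; x∈p∪q⁺; x∈⁅x⁆; x∈⁅y⁆⇒x≡y)
open import Data.List.Base using (length; lookup)
open import Data.List.Membership.Propositional using (_∈_)
open import Data.List.Relation.Unary.Any using (index)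
open import Data.List.Relation.Unary.Any.Properties using (lookup-index)
open import Data.Nat.Base using (_≤_; _<_; s≤s)
import Data.Nat.Properties as ℕ
open import Data.Product.Base using (∃-syntax; _×_; _,_; proj₁; proj₂)
import Data.Rational as ℚ
import Data.Rational.Properties as ℚ
open import Data.Sum.Base using (_⊎_; inj₁; inj₂)
open import Data.Vec.Base as Vec using (Vec; []; _∷_)
open import Data.Vec.Membership.Propositional using () renaming (_∈_ to _∈ᵛ_)
open import Data.Vec.Membership.Propositional.Properties using () renaming (∈-lookup to ∈-lookupᵛ)
open import Data.Vec.Relation.Unary.Any using (here)
import Data.Vec.Relation.Unary.All.Properties as Allᵛ
open import Data.Vec.Relation.Unary.AllPairs using (AllPairs; []; _∷_)
open import Function.Bundles using (mk⇔; mk↔ₛ′; Equivalence)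
open import Relation.Binary.PropositionalEquality
  using (_≡_; refl; sym; trans; cong; subst)
open import Relation.Nullary using (¬_; yes; no; contradiction)
open Edges
open Elimination
open DistantPair using (∈-elements⁺; ∈-elements⁻)
open Parameter
open Reals
open CoefficientRing ℝ-coefficientRing using (NZ; _-_)
open Weighting ℝ-coefficientRing

module _ {n} (G : Graph n) where

  open Edge using (lo; hi)

  module IsolatedEdge {e : Edge G} (dead : ¬ Live G ⊤ e) where

    trapped : ∀ {p q} → Inc G p e → Adj G p q → Inc G q e
    trapped {p} {q} pe pq with inc? G q e
    ... | yes qe = qe
    ... | no ¬qe = contradiction ((∈⊤ , ∈⊤) , q , ∈⊤ , ¬qe , p , pe , Adj-sym G pq) dead

    walk-trapped : ∀ k {p q} → Inc G p e → Walk G k p q → Inc G q e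
    walk-trapped ℕ.zero    pe refl         = pe
    walk-trapped (ℕ.suc k) pe (w , pw , wq) = walk-trapped k (trapped pe pw) wq

    S : Subset n
    S = ⁅ lo e ⁆ ∪ ⁅ hi e ⁆

    S⇒inc : ∀ {p} → p ∈ˢ S → Inc G p e
    S⇒inc p∈ with x∈p∪q⁻ ⁅ lo e ⁆ ⁅ hi e ⁆ p∈
    ... | inj₁ p∈lo = inj₁ (x∈⁅y⁆⇒x≡y (lo e) p∈lo)
    ... | inj₂ p∈hi = inj₂ (x∈⁅y⁆⇒x≡y (hi e) p∈hi)

    inc⇒S : ∀ {p} → Inc G p e → p ∈ˢ S
    inc⇒S (inj₁ refl) = x∈p∪q⁺ (inj₁ (x∈⁅x⁆ (lo e)))
    inc⇒S (inj₂ refl) = x∈p∪q⁺ (inj₂ (x∈⁅x⁆ (hi e)))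

    walk : ∀ {p q} → Inc G p e → Inc G q e → ∃[ k ] Walk G k p q
    walk {p} {q} pe qe with p Fin.≟ q
    ... | yes p≡q = 0 , p≡q
    ... | no p≢q  = 1 , q , ends-adjacent G e p≢q pe qe , refl

    component : IsComponent G S
    component = (lo e , inc⇒S (inj₁ refl)) , λ p p∈ q → mk⇔
      (λ q∈ → walk (S⇒inc p∈) (S⇒inc q∈)) (λ { (k , w) → inc⇒S (walk-trapped k (S⇒inc p∈) w) })

    vertex : Fin (length (elements S)) → Fin n
    vertex = lookup (elements S)

    vertex-inc : ∀ i → Inc G (vertex i) e
    vertex-inc i = S⇒inc (∈-elements⁻ G (∈-lookup i))
      where open import Data.List.Membership.Propositional.Properties using (∈-lookup)

    to : Fin (length (elements S)) → Fin 2
    to i with vertex i Fin.≟ lo e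
    ... | yes _ = zero
    ... | no _  = suc zero

    to-lo : ∀ i → vertex i ≡ lo e → to i ≡ zero
    to-lo i eq with vertex i Fin.≟ lo e
    ... | yes _  = refl
    ... | no neq = contradiction eq neq

    to-hi : ∀ i → vertex i ≡ hi e → to i ≡ suc zero
    to-hi i eq with vertex i Fin.≟ lo e
    ... | yes eq′ = contradiction (trans (sym eq′) eq) (lo≢hi G e)
    ... | no _    = refl

    lo∈ : lo e ∈ elements S
    lo∈ = ∈-elements⁺ G (inc⇒S (inj₁ refl))

    hi∈ : hi e ∈ elements S
    hi∈ = ∈-elements⁺ G (inc⇒S (inj₂ refl))

    from : Fin 2 → Fin (length (elements S))
    from zero       = index lo∈
    from (suc zero) = index hi∈

    to-from : ∀ j → to (from j) ≡ j
    to-from zero       = to-lo (index lo∈) (sym (lookup-index lo∈))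
    to-from (suc zero) = to-hi (index hi∈) (sym (lookup-index hi∈))

    from-to : ∀ i → from (to i) ≡ i
    from-to i with vertex-inc i
    ... | inj₁ eq = trans (cong from (to-lo i eq))
      (lookup-injective (elements-unique G S) _ i (trans (sym (lookup-index lo∈)) (sym eq)))
    ... | inj₂ eq = trans (cong from (to-hi i eq))
      (lookup-injective (elements-unique G S) _ i (trans (sym (lookup-index hi∈)) (sym eq)))

    isomorphic : induced G S ≅ K 2
    isomorphic = mk↔ₛ′ to from to-from from-to , preserved
      where
      transport : ∀ {i j a b s t} → vertex i ≡ a → vertex j ≡ b → to i ≡ s → to j ≡ t →
                  adj G a b ≡ adj (K 2) s t → adj G (vertex i) (vertex j) ≡ adj (K 2) (to i) (to j)
      transport refl refl refl refl eq = eq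
      is-true : ∀ {u v} → Adj G u v → adj G u v ≡ true
      is-true = Equivalence.to T-≡
      preserved : ∀ i j → adj G (vertex i) (vertex j) ≡ adj (K 2) (to i) (to j)
      preserved i j with vertex-inc i | vertex-inc j
      ... | inj₁ p | inj₁ q = transport p q (to-lo i p) (to-lo j q) (adj-irrefl G (lo e))
      ... | inj₁ p | inj₂ q = transport p q (to-lo i p) (to-hi j q) (is-true (adjacent G e))
      ... | inj₂ p | inj₁ q = transport p q (to-hi i p) (to-lo j q) (is-true (Adj-sym G (adjacent G e)))
      ... | inj₂ p | inj₂ q = transport p q (to-hi i p) (to-hi j q) (adj-irrefl G (hi e))

  -- The ends of a dead edge are closed under walks and induce K₂. Niceness thus makes every edge of
  -- `G` a row of the full matrix.
  nice⇒live : Nice G → ∀ e → Live G ⊤ e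
  nice⇒live nice e with live? G ⊤ e
  ... | yes live = live
  ... | no dead  = contradiction isomorphic (nice S component)
    where open IsolatedEdge {e} dead

#-sym : ∀ {x y} → x # y → y # x
#-sym {x} {y} (ε , 0<ε , N , ε≤) = ε , 0<ε , N , λ n N≤n → subst (ε ℚ.≤_) (∣-∣-comm (seq x n) (seq y n)) (ε≤ n N≤n)
  where
  ∣-∣-comm : ∀ p q → ℚ.∣ p ℚ.- q ∣ ≡ ℚ.∣ q ℚ.- p ∣
  ∣-∣-comm p q = trans (sym (ℚ.∣-p∣≡∣p∣ (p ℚ.- q))) (cong ℚ.∣_∣ (flip p q))
    where
    open import Data.Rational.Solver using (module +-*-Solver)
    open +-*-Solver
    flip : ∀ p q → ℚ.- (p ℚ.- q) ≡ q ℚ.- p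
    flip = solve 2 (λ p q → :- (p :- q) := q :- p) refl

allPairs-lookup : ∀ {k} {v : Vec ℝ k} → AllPairs _#_ v → ∀ {i j} → i Fin.< j → Vec.lookup v i # Vec.lookup v j
allPairs-lookup (x# ∷ _)  {zero}  {suc j} _         = Allᵛ.lookup⁺ x# j
allPairs-lookup (_ ∷ ap)  {suc i} {suc j} (s≤s i<j) = allPairs-lookup ap i<j

-- 0 beyond the end of v.
entry : ∀ {k} → Vec ℝ k → ℕ → ℝ
entry {k} v j with j ℕ.<? k
... | yes j<k = Vec.lookup v (fromℕ< j<k)
... | no _    = 0ʳ

entry-∈ : ∀ {k} (v : Vec ℝ k) {j} → j < k → entry v j ∈ᵛ v
entry-∈ {k} v {j} j<k with j ℕ.<? k
... | yes p = ∈-lookupᵛ (fromℕ< p) v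
... | no ¬p = contradiction j<k ¬p

entry-# : ∀ {k} {v : Vec ℝ k} → AllPairs _#_ v → ∀ {i j} → i < j → j < k → entry v i # entry v j
entry-# {k} {v} ap {i} {j} i<j j<k with i ℕ.<? k | j ℕ.<? k
... | yes p | yes q = allPairs-lookup ap (ℕ.≤-trans (ℕ.≤-reflexive (cong ℕ.suc (Fin.toℕ-fromℕ< p)))
                        (ℕ.≤-trans i<j (ℕ.≤-reflexive (sym (Fin.toℕ-fromℕ< q)))))
... | no ¬p | _     = contradiction (ℕ.<-trans i<j j<k) ¬p
... | yes _ | no ¬q = contradiction j<k ¬q

-- `NonZero` of a difference unfolds term by term to `_#_`, and `total` unfolds to `weightedSum`.
total-differ : ∀ {n} (G : Graph n) wⱽ wᴱ u v → NZ (total G wⱽ wᴱ u - total G wⱽ wᴱ v) →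
               weightedSum G wⱽ wᴱ u # weightedSum G wⱽ wᴱ v
total-differ G wⱽ wᴱ u v nz = nz

entries-separated : ∀ {k} {v : Vec ℝ k} → AllPairs _#_ v → ∀ {i j} → i < j → j < k →
                    NZ (entry v j - entry v i)
entries-separated {v = v} v# {i} {j} i<j j<k = #-sym {entry v i} {entry v j} (entry-# v# i<j j<k)

corollary4p2 : (n : ℕ) (G : Graph n) → Nice G → WeightChoosable G 1 (∂₂ G + 1)
corollary4p2 n G nice Lⱽ Lᴱ _ Lᴱ# = conclude (choose-weights G (good G ⊤) wⱽ (λ e → entry (Lᴱ e))
    λ e i j i<j j≤ → entries-separated (Lᴱ# e) i<j (≤⇒< j≤))
  where
  open Edge using (lo; hi)

  wⱽ : Fin n → ℝ
  wⱽ v = Vec.head (Lⱽ v)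

  wⱽ∈ : ∀ v → wⱽ v ∈ᵛ Lⱽ v
  wⱽ∈ v with Lⱽ v
  ... | x ∷ [] = here refl

  -- A variable of degree at most `∂₂ G` needs the nodes 0, ..., `∂₂ G`, which are exactly the
  -- positions in a list of length `∂₂ G + 1`.
  ≤⇒< : ∀ {j} → j ≤ ∂₂ G → j < ∂₂ G + 1
  ≤⇒< j≤ = ℕ.≤-trans (s≤s j≤) (ℕ.≤-reflexive (ℕ.+-comm 1 (∂₂ G)))

  proper : ∀ wᴱ → (∀ r → weightedSum G wⱽ wᴱ (lo r) # weightedSum G wⱽ wᴱ (hi r)) →
           ∀ u v → Adj G u v → weightedSum G wⱽ wᴱ u # weightedSum G wⱽ wᴱ v
  proper wᴱ ends-differ u v uv = let e , ue , ve = join G uv in orient e (ends G e (Adj⇒≢ G uv) ue ve)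
    where
    orient : ∀ {u v} e → (u ≡ lo e × v ≡ hi e) ⊎ (u ≡ hi e × v ≡ lo e) →
             weightedSum G wⱽ wᴱ u # weightedSum G wⱽ wᴱ v
    orient e (inj₁ (refl , refl)) = ends-differ e
    orient e (inj₂ (refl , refl)) = #-sym {weightedSum G wⱽ wᴱ (lo e)} {weightedSum G wⱽ wᴱ (hi e)} (ends-differ e)

  conclude : ∃[ τ ] ((∀ e → τ e ≤ ∂₂ G) × (∀ {r} → r ∈ rows G ⊤ →
               NZ (total G wⱽ (λ e → entry (Lᴱ e) (τ e)) (lo r) - total G wⱽ (λ e → entry (Lᴱ e) (τ e)) (hi r)))) →
             ∃[ wⱽ ] ∃[ wᴱ ] ((∀ v → wⱽ v ∈ᵛ Lⱽ v) × (∀ e → wᴱ e ∈ᵛ Lᴱ e) ×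
               (∀ u v → Adj G u v → weightedSum G wⱽ wᴱ u # weightedSum G wⱽ wᴱ v))
  conclude (τ , τ≤ , distinct) = wⱽ , wᴱ , wⱽ∈ , (λ e → entry-∈ (Lᴱ e) (≤⇒< (τ≤ e)))
    , proper wᴱ λ r → total-differ G wⱽ wᴱ (lo r) (hi r) (distinct {r} (∈-rows⁺ G {⊤} {r} (nice⇒live G nice r)))
    where
    wᴱ : Edge G → ℝ
    wᴱ e = entry (Lᴱ e) (τ e)
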